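{- For all $\varepsilon>0$ and integers $r\geq 2$, $k\geq 2$ there exist $\delta=\delta(\varepsilon,r)>0$, $\xi=\xi(\varepsilon,r)>0$, $L=L(\varepsilon,r,k)$ and $n_0$ such that for every graph $G$ of order $n\geq n_0$ the following holds: if $V(G)=\bigcup_{i=0}^{k}V_i$ is a $\delta$-uniform partition such that for every $i\in[k]$, \[ k_r(V_i)\leq \xi|V_i|^r\quad\text{or}\quad k_r\big(\overline{G[V_i]}\big)\leq \xi|V_i|^r, \] then there exists an $\varepsilon$-uniform partition $V(G)=\bigcup_{i=0}^{q}W_i$ with $k\leq q\leq L$ such that for every $i\in[q]$, \[ e(W_i)<\varepsilon\binom{|W_i|}{2}\quad\text{or}\quad e(W_i)>(1-\varepsilon)\binom{|W_i|}{2}. \]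
   Context: All graphs are finite and simple. $k_r(F)$ is the number of $r$-cliques of a graph $F$; $k_r(U)=k_r(G[U])$ for $U\subset V(G)$, and $\overline{G[U]}$ is the complement of the induced subgraph $G[U]$ (so $k_r(\overline{G[U]})$ counts independent $r$-sets in $G[U]$). $e(U)$ is the number of edges of $G[U]$. For disjoint nonempty $A,B\subset V(G)$, $d(A,B)=e(A,B)/(|A||B|)$ where $e(A,B)$ is the number of $A$–$B$ edges. A pair $(A,B)$ is $\varepsilon$-uniform if for all $X\subset A$, $Y\subset B$ with $|X|\geq\varepsilon|A|$, $|Y|\geq\varepsilon|B|$ one has $|d(X,Y)-d(A,B)|<\varepsilon$. A partition $V=\bigcup_{i=0}^{k}V_i$ is equitable if $|V_0|<k$ and $|V_1|=\dots=|V_k|$; it is $\varepsilon$-uniform if it is equitable and at most $\varepsilon k^2$ pairs $(V_i,V_j)$, $1\le i<j\le k$, are not $\varepsilon$-uniform. -}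

module Defs where

open import Data.Bool using (Bool; true; false; _∧_; _∨_; not; if_then_else_)
open import Data.Nat as ℕ using (ℕ; zero; suc; _+_; _<ᵇ_; _≡ᵇ_)
open import Data.Nat.Combinatorics using (_C_)
open import Data.Fin using (Fin; zero; suc; toℕ; _≟_)
open import Data.Fin.Subset using (Subset; _⊆_; ∣_∣)
open import Data.Vec using (Vec; []; _∷_; lookup; tabulate)
open import Data.List using (List; []; _∷_; map; _++_)
open import Data.Integer using (+_)
open import Data.Rational using (ℚ; 0ℚ; _/_; _*_; _-_; _≤_; _<_) renaming (∣_∣ to abs)
open import Data.Product using (Σ; _×_)
open import Relation.Nullary.Decidable using (⌊_⌋)
open import Relation.Binary.PropositionalEquality using (_≡_)

ℕ→ℚ : ℕ → ℚ
ℕ→ℚ m = + m / 1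

record Graph (n : ℕ) : Set where
  field
    adj    : Fin n → Fin n → Bool
    sym    : ∀ u v → adj u v ≡ adj v u
    irrefl : ∀ u → adj u u ≡ false
open Graph public

sumF : {n : ℕ} → (Fin n → ℕ) → ℕ
sumF {zero}  f = 0
sumF {suc n} f = f zero + sumF (λ i → f (suc i))

countF : {n : ℕ} → (Fin n → Bool) → ℕ
countF f = sumF (λ i → if f i then 1 else 0)

allF : {n : ℕ} → (Fin n → Bool) → Bool
allF {zero}  f = true
allF {suc n} f = f zero ∧ allF (λ i → f (suc i))

allSubsets : (n : ℕ) → List (Subset n)
allSubsets zero    = [] ∷ []
allSubsets (suc n) = map (true ∷_) (allSubsets n) ++ map (false ∷_) (allSubsets n)

countL : {A : Set} → (A → Bool) → List A → ℕ
countL p []       = 0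
countL p (x ∷ xs) = (if p x then 1 else 0) + countL p xs

isClique : {n : ℕ} → (Fin n → Fin n → Bool) → Subset n → Bool
isClique a S = allF λ u → allF λ v →
  not (lookup S u ∧ lookup S v ∧ not ⌊ u ≟ v ⌋) ∨ a u v

subsetᵇ : {n : ℕ} → Subset n → Subset n → Bool
subsetᵇ S U = allF λ u → not (lookup S u) ∨ lookup U u

kr : {n : ℕ} → (Fin n → Fin n → Bool) → ℕ → Subset n → ℕ
kr {n} a r U = countL (λ S → subsetᵇ S U ∧ (∣ S ∣ ≡ᵇ r) ∧ isClique a S) (allSubsets n)

compl : {n : ℕ} → Graph n → Fin n → Fin n → Bool
compl G u v = not (adj G u v) ∧ not ⌊ u ≟ v ⌋

kᵣ : {n : ℕ} → Graph n → ℕ → Subset n → ℕ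
kᵣ G r U = kr (adj G) r U

kᵣ̄ : {n : ℕ} → Graph n → ℕ → Subset n → ℕ
kᵣ̄ G r U = kr (compl G) r U

eIn : {n : ℕ} → Graph n → Subset n → ℕ
eIn G U = sumF λ u → countF λ v →
  lookup U u ∧ lookup U v ∧ (toℕ u <ᵇ toℕ v) ∧ adj G u v

eBetween : {n : ℕ} → Graph n → Subset n → Subset n → ℕ
eBetween G A B = sumF λ u → countF λ v → lookup A u ∧ lookup B v ∧ adj G u v

-- e / m as a rational (convention: 0 when m = 0; only used with nonempty sets)
divℕ : ℕ → ℕ → ℚ
divℕ e zero    = 0ℚ
divℕ e (suc m) = + e / suc m

dens : {n : ℕ} → Graph n → Subset n → Subset n → ℚ
dens G A B = divℕ (eBetween G A B) (∣ A ∣ ℕ.* ∣ B ∣)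

UniformPair : {n : ℕ} → Graph n → ℚ → Subset n → Subset n → Set
UniformPair G ε A B = ∀ X Y → X ⊆ A → Y ⊆ B →
  ε * ℕ→ℚ ∣ A ∣ ≤ ℕ→ℚ ∣ X ∣ → ε * ℕ→ℚ ∣ B ∣ ≤ ℕ→ℚ ∣ Y ∣ →
  abs (dens G X Y - dens G A B) < ε

record Partition (n k : ℕ) : Set where
  field
    part : Fin n → Fin (suc k)
open Partition public

cls : {n k : ℕ} → Partition n k → Fin (suc k) → Subset n
cls P i = tabulate λ v → ⌊ part P v ≟ i ⌋

Equitable : {n k : ℕ} → Partition n k → Set
Equitable {n} {k} P = (∣ cls P zero ∣ ℕ.< k) ×
  (∀ (i j : Fin k) → ∣ cls P (suc i) ∣ ≡ ∣ cls P (suc j) ∣)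

countPairs : {k : ℕ} → (Fin k → Fin k → Bool) → ℕ
countPairs bad = sumF λ i → countF λ j → (toℕ i <ᵇ toℕ j) ∧ bad i j

-- ε-uniform partition: equitable, and the non-ε-uniform pairs (V_i,V_j),
-- 1 ≤ i < j ≤ k, are contained in a set of at most ε k² pairs
UniformPartition : {n k : ℕ} → Graph n → ℚ → Partition n k → Set
UniformPartition {n} {k} G ε P = Equitable P ×
  Σ (Fin k → Fin k → Bool) λ bad →
    (ℕ→ℚ (countPairs bad) ≤ ε * ℕ→ℚ (k ℕ.* k)) ×
    (∀ (i j : Fin k) → toℕ i ℕ.< toℕ j → bad i j ≡ false →
       UniformPair G ε (cls P (suc i)) (cls P (suc j)))

{-# OPTIONS --safe #-}
-- A class V spanning few r-cliques (or few independent r-sets) contains sparse (dense)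
-- sets of every size up to a fixed proportion of |V|: descend through neighbourhoods of
-- vertices whose neighbourhood spans few smaller cliques, then delete vertices of large
-- degree to reach the prescribed size.  Hence all but a small part of each class splits
-- greedily into homogeneous pieces of one common size; the vertices left over, together
-- with V₀, are spread evenly over the pieces.  A pair of pieces from a uniform pair of
-- classes is uniform, and pairs of pieces within one class are negligible when k is large
-- compared with 1 / ε.  For the remaining finitely many k the given partition is first
-- refined by Szemerédi's regularity lemma; as k is then bounded in terms of ε, so is the
-- number of classes, and ξ can be chosen so small that the refined classes still span
-- few cliques.  Densities are handled throughout as inequalities between natural numbers,
-- with ε replaced by 1 / s.
module Submission where

-- The obstacle is the order of the quantifiers: δ and ξ precede k. A subset smaller by a factor f
-- inherits a bound on the proportion of r-cliques only at the cost of f ^ r, so classes may be cut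
-- by factors depending on ε and r alone. Regularising for every k would violate this, since the
-- number of parts grows with k; plain cutting leaves the pairs inside a class uncontrolled, about a
-- 1 / k proportion of all pairs. The case distinction at k = 8 s plays these two losses off against
-- each other. An equitable partition with fewer than q exceptional vertices forces the leftover
-- into the pieces, and the constants pay for that. Densities are read in units of 1 / (7 s): two
-- units of error between large subsets of classes, a third for the vertices added, and twice that
-- when two densities are compared, which makes 6 < 7. For homogeneity the pieces start sparse to
-- the scale 1 / (8 s): their own edges use 2 of 8 shares, the edges at added vertices 4.

module Core where

  open import Defs renaming (sym to adj-sym; irrefl to adj-irrefl)
  import Data.Bool
  open import Data.Bool using (Bool; true; false; _∧_; _∨_; not; if_then_else_)
  open import Data.Bool.Properties using (∧-zeroʳ)
  open import Data.Empty using (⊥-elim)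
  open import Data.Nat hiding (_≟_)
  open import Data.Nat.Properties hiding (_≟_)
  open import Data.Nat.DivMod
  open import Data.Nat.Combinatorics using (_C_; nC1≡n; nCk+nC[k+1]≡[n+1]C[k+1])
  open import Data.Nat.Tactic.RingSolver using (solve-∀)
  open import Data.Fin using (Fin; zero; suc; toℕ; _≟_; fromℕ<; combine; funToFin; finToFun)
  open import Data.Fin.Properties using (all?; any?; toℕ-injective; toℕ-fromℕ<; combine-injectiveˡ; combine-injectiveʳ; finToFun-funToFin)
  open import Data.Fin.Subset using (Subset; _⊆_; ∣_∣)
  open import Data.Fin.Subset.Properties using (anySubset?)
  open import Data.Vec using ([]; _∷_; lookup; tabulate; _[_]≔_; replicate)
  open import Data.Vec.Properties using (lookup∘update′; lookup-replicate; lookup∘tabulate; []=⇒lookup; lookup⇒[]=)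
  open import Data.List using ([]; _∷_; map; _++_)
  open import Data.Integer using (+≤+; +<+) renaming (+_ to int)
  import Data.Integer
  import Data.Integer.Properties as ℤₚ
  open import Data.Rational using (ℚ; mkℚ; 0ℚ; 1ℚ) renaming (∣_∣ to abs)
  import Data.Rational as ℚ
  import Data.Rational.Properties as ℚₚ
  import Data.Rational.Unnormalised as ℚᵘ
  import Data.Rational.Unnormalised.Properties as ℚᵘₚ
  open import Data.Product using (Σ; _×_; _,_; proj₁; proj₂; ∃)
  import Data.Sum
  open import Data.Sum using (_⊎_; inj₁; inj₂)
  open import Data.Unit using (⊤; tt)
  open import Function using (_∘_; flip; case_of_)
  open import Relation.Nullary using (¬_; Dec; yes; no)
  open import Relation.Nullary.Decidable using (⌊_⌋; _×-dec_; _⊎-dec_; _→-dec_)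
  open import Relation.Binary.Definitions using (tri<; tri≈; tri>)
  open import Relation.Binary.PropositionalEquality using (_≡_; refl; sym; trans; cong; cong₂; subst; subst₂; module ≡-Reasoning)

  -- Indicators of Boolean conditions

  ι : Bool → ℕ
  ι b = if b then 1 else 0

  ι-∧ : ∀ x y → ι (x ∧ y) ≡ ι x * ι y
  ι-∧ false y = refl
  ι-∧ true  y = sym (+-identityʳ (ι y))

  ι-not : ∀ b → ι b + ι (not b) ≡ 1
  ι-not false = refl
  ι-not true  = refl

  ι-split : ∀ x y → ι x ≡ ι (x ∧ y) + ι (x ∧ not y)
  ι-split false y     = refl
  ι-split true  false = refl
  ι-split true  true  = refl

  ι-mono : ∀ {x y} → (x ≡ true → y ≡ true) → ι x ≤ ι y
  ι-mono {false} h = z≤n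
  ι-mono {true}  h rewrite h refl = ≤-refl

  ι≤1 : ∀ b → ι b ≤ 1
  ι≤1 false = z≤n
  ι≤1 true  = ≤-refl

  ι*-< : ∀ b {x y} → ι b * x < ι b * y → b ≡ true × x < y
  ι*-< true {x} {y} h = refl , subst₂ _<_ (+-identityʳ x) (+-identityʳ y) h

  ι*-mono : ∀ b {x y} → (b ≡ true → x ≤ y) → ι b * x ≤ ι b * y
  ι*-mono false h = z≤n
  ι*-mono true  h = +-monoˡ-≤ 0 (h refl)

  ∧-true : ∀ {x y} → x ∧ y ≡ true → x ≡ true × y ≡ true
  ∧-true {true} {true} _ = refl , refl

  ∧-intro : ∀ {x y} → x ≡ true → y ≡ true → x ∧ y ≡ true
  ∧-intro refl refl = refl

  bool-eq : ∀ {x y} → (x ≡ true → y ≡ true) → (y ≡ true → x ≡ true) → x ≡ y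
  bool-eq {false} {false} f g = refl
  bool-eq {true}          f g = sym (f refl)
  bool-eq {false} {true}  f g = g refl

  not-true : ∀ {b} → not b ≡ true → b ≡ false
  not-true {false} _ = refl

  ≟-refl : ∀ {n} (i : Fin n) → ⌊ i ≟ i ⌋ ≡ true
  ≟-refl i with i ≟ i
  ... | yes _ = refl
  ... | no ¬p = ⊥-elim (¬p refl)

  ≟-sound : ∀ {n} {i j : Fin n} → ⌊ i ≟ j ⌋ ≡ true → i ≡ j
  ≟-sound {i = i} {j} h with i ≟ j
  ≟-sound h | yes p = p

  ≟-complete : ∀ {n} {i j : Fin n} → i ≡ j → ⌊ i ≟ j ⌋ ≡ true
  ≟-complete {i = i} refl = ≟-refl i

  ≟-suc : ∀ {n} (i j : Fin n) → ⌊ Fin.suc i ≟ suc j ⌋ ≡ ⌊ i ≟ j ⌋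
  ≟-suc i j with i ≟ j
  ... | yes _ = refl
  ... | no  _ = refl

  -- Finite sums

  sum-cong : ∀ {n} {f g : Fin n → ℕ} → (∀ i → f i ≡ g i) → sumF f ≡ sumF g
  sum-cong {zero}  h = refl
  sum-cong {suc n} h = cong₂ _+_ (h zero) (sum-cong (h ∘ suc))

  sum-mono : ∀ {n} {f g : Fin n → ℕ} → (∀ i → f i ≤ g i) → sumF f ≤ sumF g
  sum-mono {zero}  h = z≤n
  sum-mono {suc n} h = +-mono-≤ (h zero) (sum-mono (h ∘ suc))

  sum-+ : ∀ {n} (f g : Fin n → ℕ) → sumF (λ i → f i + g i) ≡ sumF f + sumF g
  sum-+ {zero}  f g = refl
  sum-+ {suc n} f g rewrite sum-+ (f ∘ suc) (g ∘ suc) = lem (f zero) (g zero) _ _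
    where
    lem : ∀ a b c d → a + b + (c + d) ≡ a + c + (b + d)
    lem = solve-∀

  sum-*ˡ : ∀ {n} c (f : Fin n → ℕ) → sumF (λ i → c * f i) ≡ c * sumF f
  sum-*ˡ {zero}  c f = sym (*-zeroʳ c)
  sum-*ˡ {suc n} c f rewrite sum-*ˡ c (f ∘ suc) = sym (*-distribˡ-+ c _ _)

  sum-*ʳ : ∀ {n} c (f : Fin n → ℕ) → sumF (λ i → f i * c) ≡ sumF f * c
  sum-*ʳ c f = trans (sum-cong (λ i → *-comm (f i) c)) (trans (sum-*ˡ c f) (*-comm c _))

  sum-const : ∀ n c → sumF {n} (λ _ → c) ≡ n * c
  sum-const zero    c = refl
  sum-const (suc n) c = cong (c +_) (sum-const n c)

  sum-zero : ∀ n → sumF {n} (λ _ → 0) ≡ 0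
  sum-zero n = trans (sum-const n 0) (*-zeroʳ n)

  sum-swap : ∀ {m n} (f : Fin m → Fin n → ℕ) →
    sumF (λ i → sumF (λ j → f i j)) ≡ sumF (λ j → sumF (λ i → f i j))
  sum-swap {zero}  {n} f = sym (sum-zero n)
  sum-swap {suc m} {n} f rewrite sum-swap (f ∘ suc) =
    sym (sum-+ (f zero) (λ j → sumF (λ i → f (suc i) j)))

  term≤sum : ∀ {n} (f : Fin n → ℕ) i → f i ≤ sumF f
  term≤sum f zero    = m≤m+n _ _
  term≤sum f (suc i) = ≤-trans (term≤sum (f ∘ suc) i) (m≤n+m _ _)

  -- Averaging without division: vertices, classes and key values that do better than average are
  -- later obtained by comparing two sums.
  sum-<⇒∃< : ∀ {n} {f g : Fin n → ℕ} → sumF f < sumF g → ∃ λ i → f i < g i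
  sum-<⇒∃< {suc n} {f} {g} h with f zero <? g zero
  ... | yes p = zero , p
  ... | no ¬p with sum-<⇒∃< {n} {f ∘ suc} {g ∘ suc}
                   (+-cancelˡ-< (g zero) _ _ (≤-<-trans (+-monoˡ-≤ _ (≮⇒≥ ¬p)) h))
  ...   | i , q = suc i , q

  sum-δ : ∀ {n} (j : Fin n) (f : Fin n → ℕ) → sumF (λ i → ι ⌊ j ≟ i ⌋ * f i) ≡ f j
  sum-δ {suc n} zero f rewrite sum-zero n = trans (+-identityʳ _) (+-identityʳ _)
  sum-δ {suc n} (suc j) f = trans
    (sum-cong (λ i → cong (λ b → ι b * f (suc i)) (≟-suc j i))) (sum-δ j (f ∘ suc))

  sum-fibre : ∀ {n k} (f : Fin n → Fin k) (g : Fin n → ℕ) →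
    sumF g ≡ sumF (λ i → sumF (λ u → ι ⌊ f u ≟ i ⌋ * g u))
  sum-fibre f g = trans (sum-cong (λ u → sym (sum-δ (f u) (λ _ → g u))))
    (sum-swap (λ u i → ι ⌊ f u ≟ i ⌋ * g u))

  sum-fibre-const : ∀ {n k} (f : Fin n → Fin k) (h : Fin k → ℕ) →
    sumF (h ∘ f) ≡ sumF (λ i → countF (λ u → ⌊ f u ≟ i ⌋) * h i)
  sum-fibre-const {n} f h = trans (sum-fibre f (h ∘ f)) (sum-cong (λ i →
    trans (sum-cong (λ u → aux u i)) (sum-*ʳ {n} (h i) _)))
    where
    aux : ∀ u i → ι ⌊ f u ≟ i ⌋ * h (f u) ≡ ι ⌊ f u ≟ i ⌋ * h i
    aux u i with f u ≟ i
    ... | yes refl = refl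
    ... | no _     = refl

  -- Sets as Boolean predicates

  infix 4 _⊑_

  _⊑_ : ∀ {n} → (Fin n → Bool) → (Fin n → Bool) → Set
  X ⊑ Y = ∀ u → X u ≡ true → Y u ≡ true

  ⊑-trans : ∀ {n} {X Y Z : Fin n → Bool} → X ⊑ Y → Y ⊑ Z → X ⊑ Z
  ⊑-trans p q u = q u ∘ p u

  _∖_ : ∀ {n} → (Fin n → Bool) → (Fin n → Bool) → Fin n → Bool
  (X ∖ Y) u = X u ∧ not (Y u)

  count-mono : ∀ {n} {X Y : Fin n → Bool} → X ⊑ Y → countF X ≤ countF Y
  count-mono h = sum-mono (λ u → ι-mono (h u))

  count-cong : ∀ {n} {X Y : Fin n → Bool} → (∀ u → X u ≡ Y u) → countF X ≡ countF Y
  count-cong h = sum-cong (λ u → cong ι (h u))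

  count-split : ∀ {n} (X Y : Fin n → Bool) →
    countF X ≡ countF (λ u → X u ∧ Y u) + countF (X ∖ Y)
  count-split {n} X Y = trans (sum-cong (λ u → ι-split (X u) (Y u))) (sum-+ {n} _ _)

  count-∖ : ∀ {n} {X Y : Fin n → Bool} → Y ⊑ X → countF X ≡ countF Y + countF (X ∖ Y)
  count-∖ {X = X} {Y} h = trans (count-split X Y)
    (cong (_+ countF (X ∖ Y)) (count-cong (λ u → bool-eq (proj₂ ∘ ∧-true)
      (λ p → ∧-intro (h u p) p))))

  count≤n : ∀ {n} (X : Fin n → Bool) → countF X ≤ n
  count≤n {n} X = ≤-trans (sum-mono (λ u → ι≤1 (X u))) (≤-reflexive (trans (sum-const n 1) (*-identityʳ n)))

  count-true : ∀ n → countF {n} (λ _ → true) ≡ n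
  count-true n = trans (sum-const n 1) (*-identityʳ n)

  count-fibre : ∀ {n k} (f : Fin n → Fin k) (X : Fin n → Bool) →
    countF X ≡ sumF (λ i → countF (λ u → ⌊ f u ≟ i ⌋ ∧ X u))
  count-fibre f X = trans (sum-fibre f (ι ∘ X))
    (sum-cong (λ i → sum-cong (λ u → sym (ι-∧ ⌊ f u ≟ i ⌋ (X u)))))

  count-inhabited : ∀ {n} {X : Fin n → Bool} → 0 < countF X → ∃ λ u → X u ≡ true
  count-inhabited {n} {X} h
    with sum-<⇒∃< {n} {λ _ → 0} {ι ∘ X} (subst (_< countF X) (sym (sum-zero n)) h)
  ... | u , p with X u in eq
  ...   | true = u , eq

  ∣∣≡count : ∀ {n} (S : Subset n) → ∣ S ∣ ≡ countF (lookup S)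
  ∣∣≡count []          = refl
  ∣∣≡count (true  ∷ S) = cong suc (∣∣≡count S)
  ∣∣≡count (false ∷ S) = ∣∣≡count S

  subset-of-size : ∀ {n} (U : Fin n → Bool) c → c ≤ countF U →
    ∃ λ W → W ⊑ U × countF W ≡ c
  subset-of-size {n} U zero h = (λ _ → false) , (λ _ ()) , sum-zero n
  subset-of-size {suc n} U (suc c) h with U zero in eq
  ... | true with subset-of-size (U ∘ suc) c (s≤s⁻¹ h)
  ...   | W , sub , size = W⁺ , sub⁺ , cong suc size
    where
    W⁺ : Fin (suc n) → Bool
    W⁺ zero    = true
    W⁺ (suc i) = W i
    sub⁺ : W⁺ ⊑ U
    sub⁺ zero    _ = eq
    sub⁺ (suc i) p = sub i p
  subset-of-size {suc n} U (suc c) h | false with subset-of-size (U ∘ suc) (suc c) h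
  ...   | W , sub , size = W⁺ , sub⁺ , size
    where
    W⁺ : Fin (suc n) → Bool
    W⁺ zero    = false
    W⁺ (suc i) = W i
    sub⁺ : W⁺ ⊑ U
    sub⁺ (suc i) p = sub i p

  -- Weighted sums over rectangles

  E : ∀ {n} → (Fin n → Fin n → ℕ) → (Fin n → Bool) → (Fin n → Bool) → ℕ
  E w X Y = sumF λ u → sumF λ v → ι (X u) * (ι (Y v) * w u v)

  E-+ : ∀ {n} (w w' : Fin n → Fin n → ℕ) X Y →
    E (λ u v → w u v + w' u v) X Y ≡ E w X Y + E w' X Y
  E-+ {n} w w' X Y = trans (sum-cong (λ u → trans (sum-cong (λ v →
    lem (ι (X u)) (ι (Y v)) (w u v) (w' u v))) (sum-+ {n} _ _))) (sum-+ {n} _ _)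
    where
    lem : ∀ a b c d → a * (b * (c + d)) ≡ a * (b * c) + a * (b * d)
    lem = solve-∀

  E-*ˡ : ∀ {n} c (w : Fin n → Fin n → ℕ) X Y → E (λ u v → c * w u v) X Y ≡ c * E w X Y
  E-*ˡ {n} c w X Y = trans (sum-cong (λ u → trans (sum-cong (λ v →
    lem c (ι (X u)) (ι (Y v)) (w u v))) (sum-*ˡ {n} c _))) (sum-*ˡ {n} c _)
    where
    lem : ∀ c a b d → a * (b * (c * d)) ≡ c * (a * (b * d))
    lem = solve-∀

  E-const : ∀ {n} c (X Y : Fin n → Bool) → E (λ _ _ → c) X Y ≡ c * (countF X * countF Y)
  E-const c X Y = trans (sum-cong (λ u → trans (sum-*ˡ (ι (X u)) (λ v → ι (Y v) * c))
    (cong (ι (X u) *_) (sum-*ʳ c (ι ∘ Y))))) (trans (sum-*ʳ _ (ι ∘ X))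
    (lem (countF X) (countF Y) c))
    where
    lem : ∀ a b c → a * (b * c) ≡ c * (a * b)
    lem = solve-∀

  E-mono : ∀ {n} {w w' : Fin n → Fin n → ℕ} {X Y : Fin n → Bool} →
    (∀ u v → X u ≡ true → Y v ≡ true → w u v ≤ w' u v) → E w X Y ≤ E w' X Y
  E-mono {X = X} {Y} h = sum-mono (λ u → sum-mono (λ v →
    ι*-mono (X u) (λ p → ι*-mono (Y v) (h u v p))))

  E-cong : ∀ {n} {w w' : Fin n → Fin n → ℕ} {X Y : Fin n → Bool} →
    (∀ u v → X u ≡ true → Y v ≡ true → w u v ≡ w' u v) → E w X Y ≡ E w' X Y
  E-cong h = ≤-antisym (E-mono (λ u v p q → ≤-reflexive (h u v p q)))
    (E-mono (λ u v p q → ≤-reflexive (sym (h u v p q))))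

  E-⊑ : ∀ {n} (w : Fin n → Fin n → ℕ) {X X' Y Y' : Fin n → Bool} →
    X ⊑ X' → Y ⊑ Y' → E w X Y ≤ E w X' Y'
  E-⊑ w p q = sum-mono (λ u → sum-mono (λ v →
    *-mono-≤ (ι-mono (p u)) (*-monoˡ-≤ (w u v) (ι-mono (q v)))))

  E-flip : ∀ {n} (w : Fin n → Fin n → ℕ) X Y → E w X Y ≡ E (flip w) Y X
  E-flip w X Y = trans (sum-swap (λ u v → ι (X u) * (ι (Y v) * w u v)))
    (sum-cong (λ v → sum-cong (λ u → lem (ι (X u)) (ι (Y v)) (w u v))))
    where
    lem : ∀ a b c → a * (b * c) ≡ b * (a * c)
    lem = solve-∀

  E-splitˡ : ∀ {n} (w : Fin n → Fin n → ℕ) {X X₁ X₂ : Fin n → Bool} Y →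
    (∀ u → ι (X u) ≡ ι (X₁ u) + ι (X₂ u)) → E w X Y ≡ E w X₁ Y + E w X₂ Y
  E-splitˡ {n} w {X} {X₁} {X₂} Y h = trans (sum-cong (λ u → trans (sum-cong (λ v →
    trans (cong (_* (ι (Y v) * w u v)) (h u)) (*-distribʳ-+ _ (ι (X₁ u)) _))) (sum-+ {n} _ _)))
    (sum-+ {n} _ _)

  E-splitʳ : ∀ {n} (w : Fin n → Fin n → ℕ) X {Y Y₁ Y₂ : Fin n → Bool} →
    (∀ u → ι (Y u) ≡ ι (Y₁ u) + ι (Y₂ u)) → E w X Y ≡ E w X Y₁ + E w X Y₂
  E-splitʳ w X {Y} {Y₁} {Y₂} h = trans (E-flip w X Y)
    (trans (E-splitˡ (flip w) {Y} {Y₁} {Y₂} X h)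
    (cong₂ _+_ (sym (E-flip w X Y₁)) (sym (E-flip w X Y₂))))

  E-congˢ : ∀ {n} (w : Fin n → Fin n → ℕ) {X X' Y Y' : Fin n → Bool} →
    (∀ u → X u ≡ X' u) → (∀ u → Y u ≡ Y' u) → E w X Y ≡ E w X' Y'
  E-congˢ w p q = sum-cong (λ u → sum-cong (λ v →
    cong₂ (λ x y → ι x * (ι y * w u v)) (p u) (q v)))

  edge : ∀ {n} → (Fin n → Fin n → Bool) → Fin n → Fin n → ℕ
  edge a u v = ι (a u v)

  E-not : ∀ {n} (a : Fin n → Fin n → Bool) X Y →
    E (edge a) X Y + E (λ u v → ι (not (a u v))) X Y ≡ countF X * countF Y
  E-not a X Y = trans (sym (E-+ _ _ X Y)) (trans (E-cong {X = X} {Y} (λ u v _ _ → ι-not (a u v)))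
    (trans (E-const 1 X Y) (*-identityˡ _)))

  -- Passing to the complement makes the missing edges monotone as well.
  E-loss : ∀ {n} (a : Fin n → Fin n → Bool) {X X' Y Y' : Fin n → Bool} → X' ⊑ X → Y' ⊑ Y →
    E (edge a) X Y + countF X' * countF Y' ≤ E (edge a) X' Y' + countF X * countF Y
  E-loss a {X} {X'} {Y} {Y'} p q = begin
    E (edge a) X Y + countF X' * countF Y'      ≡⟨ cong (E (edge a) X Y +_) (sym (E-not a X' Y')) ⟩
    E (edge a) X Y + (E (edge a) X' Y' + E ā X' Y') ≤⟨ +-monoʳ-≤ (E (edge a) X Y) (+-monoʳ-≤ (E (edge a) X' Y') (E-⊑ ā p q)) ⟩
    E (edge a) X Y + (E (edge a) X' Y' + E ā X Y)   ≡⟨ lem (E (edge a) X Y) (E (edge a) X' Y') _ ⟩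
    E (edge a) X' Y' + (E (edge a) X Y + E ā X Y)   ≡⟨ cong (E (edge a) X' Y' +_) (E-not a X Y) ⟩
    E (edge a) X' Y' + countF X * countF Y ∎
    where
    open ≤-Reasoning
    ā : _
    ā = λ u v → ι (not (a u v))
    lem : ∀ a b c → a + (b + c) ≡ b + (a + c)
    lem = solve-∀

  E-edge≤ : ∀ {n} (a : Fin n → Fin n → Bool) X Y → E (edge a) X Y ≤ countF X * countF Y
  E-edge≤ a X Y = m+n≤o⇒m≤o _ (≤-reflexive (E-not a X Y))

  -- Ordered cliques

  -- Ordered cliques are counted because fixing the first vertex leaves exactly an ordered clique in
  -- its neighbourhood; the descent to neighbourhoods is then the recursion itself.
  T : ∀ {n} → (Fin n → Fin n → Bool) → ℕ → (Fin n → Bool) → ℕ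
  T a zero    U = 1
  T a (suc r) U = sumF λ v → ι (U v) * T a r (λ u → U u ∧ a v u)

  T-mono : ∀ {n} (a : Fin n → Fin n → Bool) r {U V : Fin n → Bool} → U ⊑ V → T a r U ≤ T a r V
  T-mono a zero    h = ≤-refl
  T-mono a (suc r) h = sum-mono (λ v → *-mono-≤ (ι-mono (h v))
    (T-mono a r (λ u p → ∧-intro (h u (proj₁ (∧-true p))) (proj₂ (∧-true p)))))

  -- Sums over all subsets, and the number of cliques

  sumS : ∀ {n} → (Subset n → ℕ) → ℕ
  sumS {zero}  f = f []
  sumS {suc n} f = sumS (f ∘ (true ∷_)) + sumS (f ∘ (false ∷_))

  sumS-cong : ∀ {n} {f g : Subset n → ℕ} → (∀ S → f S ≡ g S) → sumS f ≡ sumS g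
  sumS-cong {zero}  h = h []
  sumS-cong {suc n} h = cong₂ _+_ (sumS-cong (h ∘ (true ∷_))) (sumS-cong (h ∘ (false ∷_)))

  sumS-mono : ∀ {n} {f g : Subset n → ℕ} → (∀ S → f S ≤ g S) → sumS f ≤ sumS g
  sumS-mono {zero}  h = h []
  sumS-mono {suc n} h = +-mono-≤ (sumS-mono (h ∘ (true ∷_))) (sumS-mono (h ∘ (false ∷_)))

  sumS-zero : ∀ n → sumS {n} (λ _ → 0) ≡ 0
  sumS-zero zero    = refl
  sumS-zero (suc n) = cong₂ _+_ (sumS-zero n) (sumS-zero n)

  sumS-*ˡ : ∀ {n} c (f : Subset n → ℕ) → sumS (λ S → c * f S) ≡ c * sumS f
  sumS-*ˡ {zero}  c f = refl
  sumS-*ˡ {suc n} c f = trans (cong₂ _+_ (sumS-*ˡ c (f ∘ (true ∷_))) (sumS-*ˡ c (f ∘ (false ∷_))))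
    (sym (*-distribˡ-+ c _ _))

  sumS-sumF : ∀ {m n} (f : Fin m → Subset n → ℕ) →
    sumF (λ i → sumS (f i)) ≡ sumS (λ S → sumF (λ i → f i S))
  sumS-sumF {n = zero}  f = refl
  sumS-sumF {m} {suc n} f = trans (sum-+ {m} _ _) (cong₂ _+_
    (sumS-sumF (λ i → f i ∘ (true ∷_))) (sumS-sumF (λ i → f i ∘ (false ∷_))))

  -- Inserting `v` is a bijection from the sets that avoid `v` to the sets that contain it.
  sumS-insert : ∀ {n} (v : Fin n) (f : Subset n → ℕ) →
    sumS (λ S → ι (not (lookup S v)) * f (S [ v ]≔ true)) ≡ sumS (λ S → ι (lookup S v) * f S)
  sumS-insert {suc n} zero f rewrite sumS-zero n = sym (+-identityʳ _)
  sumS-insert (suc v) f = cong₂ _+_ (sumS-insert v (f ∘ (true ∷_))) (sumS-insert v (f ∘ (false ∷_)))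

  term≤sumS : ∀ {n} (f : Subset n → ℕ) S → f S ≤ sumS f
  term≤sumS f []          = ≤-refl
  term≤sumS f (true  ∷ S) = ≤-trans (term≤sumS (f ∘ (true ∷_)) S) (m≤m+n _ _)
  term≤sumS f (false ∷ S) = ≤-trans (term≤sumS (f ∘ (false ∷_)) S) (m≤n+m _ _)

  countL-++ : ∀ {A : Set} (p : A → Bool) xs ys → countL p (xs ++ ys) ≡ countL p xs + countL p ys
  countL-++ p []       ys = refl
  countL-++ p (x ∷ xs) ys = trans (cong (ι (p x) +_) (countL-++ p xs ys)) (sym (+-assoc (ι (p x)) _ _))

  countL-map : ∀ {A B : Set} (p : B → Bool) (f : A → B) xs → countL p (map f xs) ≡ countL (p ∘ f) xs
  countL-map p f []       = refl
  countL-map p f (x ∷ xs) = cong (ι (p (f x)) +_) (countL-map p f xs)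

  countL-allSubsets : ∀ n (p : Subset n → Bool) → countL p (allSubsets n) ≡ sumS (ι ∘ p)
  countL-allSubsets zero    p = +-identityʳ _
  countL-allSubsets (suc n) p = trans (countL-++ p (map (true ∷_) (allSubsets n)) _) (cong₂ _+_
    (trans (countL-map p (true ∷_) (allSubsets n)) (countL-allSubsets n (p ∘ (true ∷_))))
    (trans (countL-map p (false ∷_) (allSubsets n)) (countL-allSubsets n (p ∘ (false ∷_)))))

  allF-elim : ∀ {n} {f : Fin n → Bool} → allF f ≡ true → ∀ i → f i ≡ true
  allF-elim h zero    = proj₁ (∧-true h)
  allF-elim h (suc i) = allF-elim (proj₂ (∧-true h)) i

  allF-intro : ∀ {n} {f : Fin n → Bool} → (∀ i → f i ≡ true) → allF f ≡ true
  allF-intro {zero}  h = refl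
  allF-intro {suc n} h = ∧-intro (h zero) (allF-intro (h ∘ suc))

  isCliqueIn : ∀ {n} → (Fin n → Fin n → Bool) → ℕ → (Fin n → Bool) → Subset n → Bool
  isCliqueIn a r U S = (allF λ u → not (lookup S u) ∨ U u) ∧ (∣ S ∣ ≡ᵇ r) ∧ isClique a S

  kr≡sumS : ∀ {n} (a : Fin n → Fin n → Bool) r U → kr a r U ≡ sumS (ι ∘ isCliqueIn a r (lookup U))
  kr≡sumS {n} a r U = countL-allSubsets n (isCliqueIn a r (lookup U))

  CliqueIn : ∀ {n} → (Fin n → Fin n → Bool) → ℕ → (Fin n → Bool) → Subset n → Set
  CliqueIn a r U S = lookup S ⊑ U × ∣ S ∣ ≡ r ×
    (∀ u v → lookup S u ≡ true → lookup S v ≡ true → ¬ u ≡ v → a u v ≡ true)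

  implies-elim : ∀ {x y} → not x ∨ y ≡ true → x ≡ true → y ≡ true
  implies-elim {true} h refl = h

  implies-intro : ∀ {x y} → (x ≡ true → y ≡ true) → not x ∨ y ≡ true
  implies-intro {false} h = refl
  implies-intro {true}  h = h refl

  isCliqueIn-sound : ∀ {n} {a : Fin n → Fin n → Bool} {r U S} →
    isCliqueIn a r U S ≡ true → CliqueIn a r U S
  isCliqueIn-sound {n} {a} {r} {U} {S} h =
    (λ u → implies-elim (allF-elim (proj₁ h₁) u)) ,
    ≡ᵇ⇒≡ ∣ S ∣ r (subst Data.Bool.T (sym (proj₁ h₂)) _) ,
    λ u v p q u≢v → implies-elim
      (allF-elim {f = λ v → not (lookup S u ∧ lookup S v ∧ not ⌊ u ≟ v ⌋) ∨ a u v}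
        (allF-elim {f = λ u → allF λ v → not (lookup S u ∧ lookup S v ∧ not ⌊ u ≟ v ⌋) ∨ a u v}
          (proj₂ h₂) u) v)
      (∧-intro p (∧-intro q (≢⇒not u v u≢v)))
    where
    h₁ = ∧-true {allF λ u → not (lookup S u) ∨ U u} h
    h₂ = ∧-true {∣ S ∣ ≡ᵇ r} (proj₂ h₁)
    ≢⇒not : ∀ u v → ¬ u ≡ v → not ⌊ u ≟ v ⌋ ≡ true
    ≢⇒not u v ne with u ≟ v
    ... | yes p = ⊥-elim (ne p)
    ... | no _  = refl

  isCliqueIn-complete : ∀ {n} {a : Fin n → Fin n → Bool} {r U S} →
    CliqueIn a r U S → isCliqueIn a r U S ≡ true
  isCliqueIn-complete {a = a} {r} {U} {S} (sub , size , adjacent) = ∧-intro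
    (allF-intro (λ u → implies-intro (sub u)))
    (∧-intro (size-true size)
      (allF-intro (λ u → allF-intro (λ v → implies-intro (λ h →
        let p , h′ = ∧-true {lookup S u} h
            q , ne = ∧-true {lookup S v} h′
        in adjacent u v p q (not⇒≢ u v ne))))))
    where
    size-true : ∀ {m} → m ≡ r → (m ≡ᵇ r) ≡ true
    size-true {m} refl with m ≡ᵇ m | ≡⇒≡ᵇ m m refl
    ... | true | _ = refl
    not⇒≢ : ∀ u v → not ⌊ u ≟ v ⌋ ≡ true → ¬ u ≡ v
    not⇒≢ u v h u≡v with u ≟ v
    not⇒≢ u v () u≡v | yes _
    not⇒≢ u v h  u≡v | no ne = ne u≡v

  ∣insert∣ : ∀ {n} (S : Subset n) v → lookup S v ≡ false → ∣ S [ v ]≔ true ∣ ≡ suc ∣ S ∣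
  ∣insert∣ (false ∷ S) zero    h = refl
  ∣insert∣ (true  ∷ S) (suc v) h = cong suc (∣insert∣ S v h)
  ∣insert∣ (false ∷ S) (suc v) h = ∣insert∣ S v h

  lookup-insert : ∀ {n} (S : Subset n) v u → lookup (S [ v ]≔ true) u ≡ true →
    u ≡ v ⊎ lookup S u ≡ true
  lookup-insert S v u h with u ≟ v
  ... | yes p = inj₁ p
  ... | no ne = inj₂ (trans (sym (lookup∘update′ ne S true)) h)

  clique-insert : ∀ {n} {a : Fin n → Fin n → Bool} → (∀ u v → a u v ≡ a v u) → (∀ u → a u u ≡ false) →
    ∀ {r U S v} → U v ≡ true → CliqueIn a r (λ u → U u ∧ a v u) S →
    not (lookup S v) ≡ true × CliqueIn a (suc r) U (S [ v ]≔ true)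
  clique-insert {a = a} a-sym a-irr {r} {U} {S} {v} Uv (sub , size , adjacent) =
    cong not v∉S , sub⁺ , trans (∣insert∣ S v v∉S) (cong suc size) , adjacent⁺
    where
    v∉S : lookup S v ≡ false
    v∉S with lookup S v in eq
    ... | false = refl
    ... | true with () ← trans (sym (a-irr v)) (proj₂ (∧-true (sub v eq)))
    nbr : ∀ u → lookup S u ≡ true → a v u ≡ true
    nbr u p = proj₂ (∧-true (sub u p))
    sub⁺ : lookup (S [ v ]≔ true) ⊑ U
    sub⁺ u h with lookup-insert S v u h
    ... | inj₁ refl = Uv
    ... | inj₂ p    = proj₁ (∧-true (sub u p))
    adjacent⁺ : ∀ x y → lookup (S [ v ]≔ true) x ≡ true → lookup (S [ v ]≔ true) y ≡ true →
      ¬ x ≡ y → a x y ≡ true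
    adjacent⁺ x y p q ne with lookup-insert S v x p | lookup-insert S v y q
    ... | inj₁ refl | inj₁ refl = ⊥-elim (ne refl)
    ... | inj₁ refl | inj₂ y∈S  = nbr y y∈S
    ... | inj₂ x∈S  | inj₁ refl = trans (a-sym x y) (nbr x x∈S)
    ... | inj₂ x∈S  | inj₂ y∈S  = adjacent x y x∈S y∈S ne

  -- Induction via the first vertex, which can be inserted into any clique of its neighbourhood.
  -- After `sumS-insert` a clique `S` is met once for each of its `suc r` elements, and this
  -- supplies the step from `r !` to `suc r !`.
  T≤r!*cliques : ∀ {n} (a : Fin n → Fin n → Bool) → (∀ u v → a u v ≡ a v u) → (∀ u → a u u ≡ false) →
    ∀ r U → T a r U ≤ r ! * sumS (ι ∘ isCliqueIn a r U)
  T≤r!*cliques {n} a a-sym a-irr zero U = subst (1 ≤_) (sym (+-identityʳ _))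
    (≤-trans (≤-reflexive (sym (cong ι (isCliqueIn-complete {a = a} {0} {U} {∅} empty))))
      (term≤sumS (ι ∘ isCliqueIn a 0 U) ∅))
    where
    ∅ : Subset n
    ∅ = replicate n false
    ∉∅ : ∀ u → lookup ∅ u ≡ false
    ∉∅ u = lookup-replicate u false
    empty : CliqueIn a 0 U ∅
    empty = (λ u p → case trans (sym p) (∉∅ u) of λ ()) ,
      trans (∣∣≡count ∅) (trans (sum-cong (λ u → cong ι (∉∅ u))) (sum-zero n)) ,
      λ u v p → case trans (sym p) (∉∅ u) of λ ()
  T≤r!*cliques {n} a a-sym a-irr (suc r) U = begin
    sumF (λ v → ι (U v) * T a r (N v))
      ≤⟨ sum-mono (λ v → *-monoʳ-≤ (ι (U v)) (T≤r!*cliques a a-sym a-irr r (N v))) ⟩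
    sumF (λ v → ι (U v) * (r ! * sumS (ι ∘ isCliqueIn a r (N v))))
      ≡⟨ sum-cong (λ v → trans (lem (ι (U v)) (r !) _) (cong (r ! *_) (sym (sumS-*ˡ {n} (ι (U v)) _)))) ⟩
    sumF (λ v → r ! * sumS (λ S → ι (U v) * ι (isCliqueIn a r (N v) S)))
      ≡⟨ sum-*ˡ (r !) (λ v → sumS (λ S → ι (U v) * ι (isCliqueIn a r (N v) S))) ⟩
    r ! * sumF (λ v → sumS (λ S → ι (U v) * ι (isCliqueIn a r (N v) S)))
      ≤⟨ *-monoʳ-≤ (r !) (sum-mono (λ v → sumS-mono (λ S → insert v S))) ⟩
    r ! * sumF (λ v → sumS (λ S → ι (not (lookup S v)) * c (S [ v ]≔ true)))
      ≡⟨ cong (r ! *_) (sum-cong (λ v → sumS-insert v c)) ⟩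
    r ! * sumF (λ v → sumS (λ S → ι (lookup S v) * c S))
      ≡⟨ cong (r ! *_) (sumS-sumF (λ v S → ι (lookup S v) * c S)) ⟩
    r ! * sumS (λ S → sumF (λ v → ι (lookup S v) * c S))
      ≡⟨ cong (r ! *_) (sumS-cong (λ S → trans (sum-*ʳ (c S) (ι ∘ lookup S)) (size S))) ⟩
    r ! * sumS (λ S → suc r * c S)
      ≡⟨ cong (r ! *_) (sumS-*ˡ (suc r) c) ⟩
    r ! * (suc r * sumS c)
      ≡⟨ lem′ (r !) (suc r) (sumS c) ⟩
    suc r * r ! * sumS c ∎
    where
    open ≤-Reasoning
    N : Fin n → Fin n → Bool
    N v u = U u ∧ a v u
    c : Subset n → ℕ
    c S = ι (isCliqueIn a (suc r) U S)
    lem : ∀ x y z → x * (y * z) ≡ y * (x * z)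
    lem = solve-∀
    lem′ : ∀ x y z → x * (y * z) ≡ y * x * z
    lem′ = solve-∀
    insert : ∀ v S → ι (U v) * ι (isCliqueIn a r (N v) S) ≤ ι (not (lookup S v)) * c (S [ v ]≔ true)
    insert v S = subst₂ _≤_ (ι-∧ (U v) _) (ι-∧ (not (lookup S v)) _) (ι-mono λ h →
      let (p , q) = clique-insert a-sym a-irr {S = S} (proj₁ (∧-true h)) (isCliqueIn-sound {S = S} (proj₂ (∧-true {U v} h)))
      in ∧-intro p (isCliqueIn-complete {S = S [ v ]≔ true} q))
    size : ∀ S → countF (lookup S) * c S ≡ suc r * c S
    size S with isCliqueIn a (suc r) U S in eq
    ... | false = trans (*-zeroʳ (countF (lookup S))) (sym (*-zeroʳ (suc r)))
    ... | true  = cong (_* 1) (trans (sym (∣∣≡count S)) (proj₁ (proj₂ (isCliqueIn-sound {S = S} eq))))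

  -- Sparse subsets of graphs with few cliques

  degree : ∀ {n} → (Fin n → Fin n → Bool) → (Fin n → Bool) → Fin n → ℕ
  degree a U v = countF (λ u → U u ∧ a v u)

  E≡sum-degree : ∀ {n} (a : Fin n → Fin n → Bool) X Y →
    E (edge a) X Y ≡ sumF (λ v → ι (X v) * degree a Y v)
  E≡sum-degree {n} a X Y = sum-cong (λ v → trans (sum-*ˡ {n} (ι (X v)) _)
    (cong (ι (X v) *_) (sum-cong (λ u → sym (ι-∧ (Y u) (a v u))))))

  -- A descent step costs `(2 * s) ^ r` because the degree may be only m / (2 s), and one more
  -- `2 * s` in the averaging. The value 2 at `zero` makes the hypothesis there read 2 ≤ 1, so the
  -- descent must meet a sparse set earlier.
  sparseX : ℕ → ℕ → ℕ
  sparseX s zero    = 2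
  sparseX s (suc r) = (2 * s) ^ suc r * sparseX s r

  ^-distribʳ-* : ∀ r m n → (m * n) ^ r ≡ m ^ r * n ^ r
  ^-distribʳ-* zero    m n = refl
  ^-distribʳ-* (suc r) m n = trans (cong (m * n *_) (^-distribʳ-* r m n)) (lem m n (m ^ r) (n ^ r))
    where
    lem : ∀ a b c d → a * b * (c * d) ≡ a * c * (b * d)
    lem = solve-∀

  private
    0<-of-square : ∀ {m e} s → m * m < s * e → e ≤ m * m → 0 < m
    0<-of-square {zero}  s h z≤n = ⊥-elim (n≮0 (subst (0 <_) (*-zeroʳ s) h))
    0<-of-square {suc m} s h _   = z<s

    -- The hypothesis on `t` makes the clique term at most the first term, and the failure of
    -- sparsity makes the right-hand side exceed twice that term.
    sum-bound : ∀ s r m x t e → 0 < m → m * m < s * e → (2 * s) ^ suc r * x * t ≤ m ^ suc r →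
      m * (m * m ^ r) + 2 * s * ((2 * s) ^ r * (x * (m * t))) < e * (2 * s * m ^ r)
    sum-bound s r m@(suc _) x t e _ h₁ h₂ = begin-strict
      m * (m * m ^ r) + 2 * s * ((2 * s) ^ r * (x * (m * t)))
        ≡⟨ cong (m * (m * m ^ r) +_) (l₁ (2 * s) ((2 * s) ^ r) x m t) ⟩
      m * (m * m ^ r) + m * ((2 * s) ^ suc r * x * t)
        ≤⟨ +-monoʳ-≤ (m * (m * m ^ r)) (*-monoʳ-≤ m h₂) ⟩
      m * (m * m ^ r) + m * (m * m ^ r) ≡⟨ l₂ m (m ^ r) ⟩
      m * m * (2 * m ^ r) <⟨ *-monoˡ-< (2 * m ^ r) {{m*n≢0 2 (m ^ r) {{_}} {{m^n≢0 m r}}}} h₁ ⟩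
      s * e * (2 * m ^ r) ≡⟨ l₃ s e (m ^ r) ⟩
      e * (2 * s * m ^ r) ∎
      where
      open ≤-Reasoning
      l₁ : ∀ p q x m t → p * (q * (x * (m * t))) ≡ m * (p * q * x * t)
      l₁ = solve-∀
      l₂ : ∀ m y → m * (m * y) + m * (m * y) ≡ m * m * (2 * y)
      l₂ = solve-∀
      l₃ : ∀ s e y → s * e * (2 * y) ≡ e * (2 * s * y)
      l₃ = solve-∀

    degree-large : ∀ s r m d x t → m * m ^ r + 2 * s * ((2 * s) ^ r * (x * (m * t))) < d * (2 * s * m ^ r) →
      m ≤ 2 * s * d
    degree-large s r m d x t h = <⇒≤ (*-cancelʳ-< (m ^ r) m (2 * s * d) (begin-strict
      m * m ^ r           ≤⟨ m≤m+n _ _ ⟩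
      m * m ^ r + _       <⟨ h ⟩
      d * (2 * s * m ^ r) ≡⟨ l d s (m ^ r) ⟩
      2 * s * d * m ^ r   ∎))
      where
      open ≤-Reasoning
      l : ∀ d s y → d * (2 * s * y) ≡ 2 * s * d * y
      l = solve-∀

    -- The degree is first bounded above by `m` to remove it from the right-hand side, then below
    -- through `m ≤ 2 * s * d` to turn `m ^ r` into a multiple of `d ^ r`.
    nbrs-few : ∀ s r m d x t → d ≤ m → m * m ^ r + 2 * s * ((2 * s) ^ r * (x * (m * t))) < d * (2 * s * m ^ r) →
      x * t ≤ d ^ r
    nbrs-few s r m d x t d≤m h = <⇒≤ (*-cancelˡ-< ((2 * s) ^ r) _ _ (begin-strict
      (2 * s) ^ r * (x * t)  <⟨ *-cancelˡ-< m _ _ (begin-strict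
          m * ((2 * s) ^ r * (x * t)) ≡⟨ l₁ m ((2 * s) ^ r) x t ⟩
          (2 * s) ^ r * (x * (m * t)) <⟨ *-cancelˡ-< (2 * s) _ _ (begin-strict
              2 * s * ((2 * s) ^ r * (x * (m * t))) ≤⟨ m≤n+m _ _ ⟩
              m * m ^ r + 2 * s * ((2 * s) ^ r * (x * (m * t))) <⟨ h ⟩
              d * (2 * s * m ^ r) ≡⟨ l₂ d (2 * s) (m ^ r) ⟩
              2 * s * (d * m ^ r) ∎) ⟩
          d * m ^ r ≤⟨ *-monoˡ-≤ (m ^ r) d≤m ⟩
          m * m ^ r ∎) ⟩
      m ^ r                  ≤⟨ ^-monoˡ-≤ r (degree-large s r m d x t h) ⟩
      (2 * s * d) ^ r        ≡⟨ ^-distribʳ-* r (2 * s) d ⟩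
      (2 * s) ^ r * d ^ r    ∎))
      where
      open ≤-Reasoning
      l₁ : ∀ m p x t → m * (p * (x * t)) ≡ p * (x * (m * t))
      l₁ = solve-∀
      l₂ : ∀ d s y → d * (s * y) ≡ s * (d * y)
      l₂ = solve-∀

  -- If U itself is not sparse, averaging over U finds a vertex of large degree whose
  -- neighbourhood in U spans few cliques of the next smaller order.
  sparse-subset : ∀ {n} (a : Fin n → Fin n → Bool) s .{{_ : NonZero s}} r (U : Fin n → Bool) →
    sparseX s r * T a r U ≤ countF U ^ r →
    ∃ λ W → W ⊑ U × countF U ≤ (2 * s) ^ r * countF W × s * E (edge a) W W ≤ countF W * countF W
  sparse-subset a s zero U (s≤s ())
  sparse-subset {n} a s (suc r) U few with s * E (edge a) U U ≤? countF U * countF U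
  ... | yes p = U , (λ _ q → q) ,
    m≤n*m (countF U) ((2 * s) ^ suc r) {{m^n≢0 (2 * s) (suc r) {{m*n≢0 2 s}}}} , p
  ... | no ¬p = deeper (sum-<⇒∃< {n} {f} {g} f<g)
    where
    open ≤-Reasoning
    m x : ℕ
    m = countF U
    x = sparseX s r
    N : Fin n → Fin n → Bool
    N v u = U u ∧ a v u
    -- Two requirements are packed into one sum so that a single vertex meets both: in `f v < g v`
    -- the first summand of `f` forces a large degree, the second few cliques in the neighbourhood.
    f g : Fin n → ℕ
    f v = ι (U v) * (m * m ^ r + 2 * s * ((2 * s) ^ r * (x * (m * T a r (N v)))))
    g v = ι (U v) * (degree a U v * (2 * s * m ^ r))
    f-expand : ∀ i y c p x m t → i * (y + c * (p * (x * (m * t)))) ≡ i * y + i * t * (c * p * x * m)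
    f-expand = solve-∀
    f-collect : ∀ i y c p x m t → i * y + t * (c * p * x * m) ≡ i * y + c * (p * (x * (m * t)))
    f-collect = solve-∀
    f<g : sumF f < sumF g
    f<g = begin-strict
      sumF f
        ≡⟨ sum-cong (λ v → f-expand (ι (U v)) (m * m ^ r) (2 * s) ((2 * s) ^ r) x m (T a r (N v))) ⟩
      sumF (λ v → ι (U v) * (m * m ^ r) + ι (U v) * T a r (N v) * (2 * s * (2 * s) ^ r * x * m))
        ≡⟨ sum-+ {n} _ _ ⟩
      sumF (λ v → ι (U v) * (m * m ^ r)) + sumF (λ v → ι (U v) * T a r (N v) * (2 * s * (2 * s) ^ r * x * m))
        ≡⟨ cong₂ _+_ (sum-*ʳ (m * m ^ r) (ι ∘ U)) (sum-*ʳ (2 * s * (2 * s) ^ r * x * m) (λ v → ι (U v) * T a r (N v))) ⟩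
      m * (m * m ^ r) + T a (suc r) U * (2 * s * (2 * s) ^ r * x * m)
        ≡⟨ f-collect m (m * m ^ r) (2 * s) ((2 * s) ^ r) x m (T a (suc r) U) ⟩
      m * (m * m ^ r) + 2 * s * ((2 * s) ^ r * (x * (m * T a (suc r) U)))
        <⟨ sum-bound s r m x (T a (suc r) U) (E (edge a) U U)
             (0<-of-square s (≰⇒> ¬p) (E-edge≤ a U U)) (≰⇒> ¬p) few ⟩
      E (edge a) U U * (2 * s * m ^ r)
        ≡⟨ cong (_* (2 * s * m ^ r)) (E≡sum-degree a U U) ⟩
      sumF (λ v → ι (U v) * degree a U v) * (2 * s * m ^ r)
        ≡⟨ sym (sum-*ʳ (2 * s * m ^ r) (λ v → ι (U v) * degree a U v)) ⟩
      sumF (λ v → ι (U v) * degree a U v * (2 * s * m ^ r))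
        ≡⟨ sum-cong (λ v → *-assoc (ι (U v)) (degree a U v) (2 * s * m ^ r)) ⟩
      sumF g ∎
    deeper : (∃ λ v → f v < g v) →
      ∃ λ W → W ⊑ U × m ≤ (2 * s) ^ suc r * countF W × s * E (edge a) W W ≤ countF W * countF W
    deeper (v , fv<gv)
      with _ , lt ← ι*-< (U v) fv<gv
      with W , W⊑N , N≤ , sparse ← sparse-subset a s r (N v) (nbrs-few s r m (degree a U v) x (T a r (N v))
             (count-mono {X = N v} {U} (λ u → proj₁ ∘ ∧-true)) lt)
      = W , ⊑-trans W⊑N (λ u → proj₁ ∘ ∧-true) , (begin
          m                                  ≤⟨ degree-large s r m (degree a U v) x (T a r (N v)) lt ⟩
          2 * s * degree a U v               ≤⟨ *-monoʳ-≤ (2 * s) N≤ ⟩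
          2 * s * ((2 * s) ^ r * countF W)   ≡⟨ sym (*-assoc (2 * s) ((2 * s) ^ r) (countF W)) ⟩
          (2 * s) ^ suc r * countF W         ∎) , sparse

  -- Ordered pairs at `v` are lost in both directions, and the absence of a loop keeps the two
  -- contributions disjoint; hence twice the degree.
  delete-vertex : ∀ {n} (a : Fin n → Fin n → Bool) → (∀ u v → a u v ≡ a v u) → (∀ u → a u u ≡ false) →
    ∀ (W : Fin n → Bool) v → W v ≡ true → let W⁻ = W ∖ (λ u → ⌊ v ≟ u ⌋) in
    E (edge a) W⁻ W⁻ + 2 * degree a W v ≤ E (edge a) W W × countF W ≡ suc (countF W⁻)
  delete-vertex {n} a a-sym a-irr W v Wv =
    ≤-reflexive (begin-equality
      E w W⁻ W⁻ + 2 * d ≡⟨ lem (E w W⁻ W⁻) d ⟩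
      E w W⁻ W⁻ + d + d ≡⟨ cong₂ (λ y z → E w W⁻ W⁻ + y + z) (sym d⁻) (sym d₀) ⟩
      E w W⁻ W⁻ + E w W⁻ V + E w V W ≡⟨ cong (_+ E w V W) (sym (E-splitʳ w W⁻ {W} {W⁻} {V} split)) ⟩
      E w W⁻ W + E w V W ≡⟨ sym (E-splitˡ w {W} {W⁻} {V} W split) ⟩
      E w W W ∎) ,
    trans (count-∖ {X = W} {V} V⊑W) (cong (_+ countF W⁻) V-size)
    where
    open ≤-Reasoning
    w = edge a
    d = degree a W v
    V W⁻ : Fin n → Bool
    V u = ⌊ v ≟ u ⌋
    W⁻ = W ∖ V
    lem : ∀ x y → x + 2 * y ≡ x + y + y
    lem = solve-∀
    V⊑W : V ⊑ W
    V⊑W u p = subst (λ z → W z ≡ true) (≟-sound p) Wv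
    split : ∀ u → ι (W u) ≡ ι (W⁻ u) + ι (V u)
    split u = trans (ι-split (W u) (V u)) (trans (+-comm (ι (W u ∧ V u)) _) (cong (λ z → ι (W⁻ u) + ι z)
      (bool-eq (proj₂ ∘ ∧-true) (λ p → ∧-intro (V⊑W u p) p))))
    E-V : ∀ Y → E w V Y ≡ degree a Y v
    E-V Y = trans (E≡sum-degree a V Y) (sum-δ v (degree a Y))
    d₀ : E w V W ≡ d
    d₀ = E-V W
    d⁻ : E w W⁻ V ≡ d
    d⁻ = trans (E-flip w W⁻ V) (trans (E-cong {X = V} {W⁻} (λ x y _ _ → cong ι (a-sym y x)))
      (trans (E-V W⁻) (count-cong (λ u → bool-eq
        (λ p → ∧-intro (proj₁ (∧-true (proj₁ (∧-true p)))) (proj₂ (∧-true {W⁻ u} p)))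
        (λ p → ∧-intro (∧-intro (proj₁ (∧-true p)) (v≢ u (proj₂ (∧-true {W u} p)))) (proj₂ (∧-true {W u} p)))))))
      where
      v≢ : ∀ u → a v u ≡ true → not ⌊ v ≟ u ⌋ ≡ true
      v≢ u p with v ≟ u
      ... | no _     = refl
      ... | yes refl = trans (sym (a-irr _)) p
    V-size : countF V ≡ 1
    V-size = trans (sum-cong (λ u → sym (*-identityʳ (ι (V u))))) (sum-δ v (λ _ → 1))

  large-degree : ∀ {n} (a : Fin n → Fin n → Bool) (W : Fin n → Bool) → 0 < countF W →
    ∃ λ v → W v ≡ true × E (edge a) W W ≤ countF W * degree a W v
  large-degree {n} a W pos
    with sum-<⇒∃< {n} {λ v → ι (W v) * e} {λ v → ι (W v) * suc (w * degree a W v)} lt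
    where
    open ≤-Reasoning
    e = E (edge a) W W
    w = countF W
    lem : ∀ i w d → i * suc (w * d) ≡ i + w * (i * d)
    lem = solve-∀
    lt : sumF (λ v → ι (W v) * e) < sumF (λ v → ι (W v) * suc (w * degree a W v))
    lt = begin-strict
      sumF (λ v → ι (W v) * e) ≡⟨ sum-*ʳ e (ι ∘ W) ⟩
      w * e                    <⟨ m<n+m (w * e) pos ⟩
      w + w * e                ≡⟨ cong (λ z → w + w * z) (E≡sum-degree a W W) ⟩
      w + w * sumF (λ v → ι (W v) * degree a W v) ≡⟨ cong (w +_) (sym (sum-*ˡ w (λ v → ι (W v) * degree a W v))) ⟩
      w + sumF (λ v → w * (ι (W v) * degree a W v)) ≡⟨ sym (sum-+ (ι ∘ W) (λ v → w * (ι (W v) * degree a W v))) ⟩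
      sumF (λ v → ι (W v) + w * (ι (W v) * degree a W v)) ≡⟨ sum-cong (λ v → sym (lem (ι (W v)) w (degree a W v))) ⟩
      sumF (λ v → ι (W v) * suc (w * degree a W v)) ∎
  ... | v , lt with ι*-< (W v) lt
  ...   | Wv , le = v , Wv , s≤s⁻¹ le

  private
    -- As `d` is at least the average degree e / (2 + q), at most the proportion q / (2 + q) of the
    -- ordered edges survives, which is exactly the ratio of w (w - 1) after and before the
    -- deletion.
    shrink-step : ∀ s c q e e' d → e' + 2 * d ≤ e → e ≤ (2 + q) * d →
      s * e ≤ c * ((2 + q) * (1 + q)) → s * e' ≤ c * ((1 + q) * q)
    shrink-step s c q e e' d h₁ h₂ h₃ = *-cancelˡ-≤ (2 + q) (begin
      (2 + q) * (s * e')        ≡⟨ l₁ q s e' ⟩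
      s * ((2 + q) * e')        ≤⟨ *-monoʳ-≤ s qe ⟩
      s * (q * e)               ≡⟨ l₂ s q e ⟩
      q * (s * e)               ≤⟨ *-monoʳ-≤ q h₃ ⟩
      q * (c * ((2 + q) * (1 + q))) ≡⟨ l₃ q c ⟩
      (2 + q) * (c * ((1 + q) * q)) ∎)
      where
      open ≤-Reasoning
      l₁ : ∀ q s e → (2 + q) * (s * e) ≡ s * ((2 + q) * e)
      l₁ = solve-∀
      l₂ : ∀ s q e → s * (q * e) ≡ q * (s * e)
      l₂ = solve-∀
      l₃ : ∀ q c → q * (c * ((2 + q) * (1 + q))) ≡ (2 + q) * (c * ((1 + q) * q))
      l₃ = solve-∀
      l₄ : ∀ q e d → (2 + q) * e + 2 * ((2 + q) * d) ≡ (2 + q) * (e + 2 * d)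
      l₄ = solve-∀
      l₅ : ∀ q e → (2 + q) * e ≡ q * e + 2 * e
      l₅ = solve-∀
      qe : (2 + q) * e' ≤ q * e
      qe = +-cancelʳ-≤ (2 * e) _ _ (begin
        (2 + q) * e' + 2 * e ≤⟨ +-monoʳ-≤ ((2 + q) * e') (*-monoʳ-≤ 2 h₂) ⟩
        (2 + q) * e' + 2 * ((2 + q) * d) ≡⟨ l₄ q e' d ⟩
        (2 + q) * (e' + 2 * d) ≤⟨ *-monoʳ-≤ (2 + q) h₁ ⟩
        (2 + q) * e ≡⟨ l₅ q e ⟩
        q * e + 2 * e ∎)

  -- Deleting a vertex of at least average degree does not increase the edge density.
  shrink : ∀ {n} (a : Fin n → Fin n → Bool) → (∀ u v → a u v ≡ a v u) → (∀ u → a u u ≡ false) →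
    ∀ s c t j (W : Fin n → Bool) → countF W ≡ suc (j + t) → s * E (edge a) W W ≤ c * (suc (j + t) * (j + t)) →
    ∃ λ W' → W' ⊑ W × countF W' ≡ suc t × s * E (edge a) W' W' ≤ c * (suc t * t)
  shrink a a-sym a-irr s c t zero W size dense = W , (λ _ p → p) , size , dense
  shrink a a-sym a-irr s c t (suc j) W size dense
    with v , Wv , e≤ ← large-degree a W (subst (0 <_) (sym size) z<s)
    with lt , size⁻ ← delete-vertex a a-sym a-irr W v Wv
    with W' , sub , rest ← shrink a a-sym a-irr s c t j (W ∖ (λ u → ⌊ v ≟ u ⌋))
      (suc-injective (trans (sym size⁻) size))
      (shrink-step s c (j + t) (E (edge a) W W) _ (degree a W v) lt
        (subst (λ z → E (edge a) W W ≤ z * degree a W v) size e≤) dense)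
    = W' , ⊑-trans sub (λ u → proj₁ ∘ ∧-true) , rest

  -- Sparsity passes from the normalisation w² to w (w - 1), the one that `shrink` preserves; this
  -- costs the factor 2 and requires at least two vertices.
  sparse-subset-of-size : ∀ {n} (a : Fin n → Fin n → Bool) → (∀ u v → a u v ≡ a v u) → (∀ u → a u u ≡ false) →
    ∀ s .{{_ : NonZero s}} r t (U : Fin n → Bool) → sparseX s r * T a r U ≤ countF U ^ r →
    1 ≤ t → (2 * s) ^ r * suc t ≤ countF U →
    ∃ λ W → W ⊑ U × countF W ≡ suc t × s * E (edge a) W W ≤ 2 * (suc t * t)
  sparse-subset-of-size a a-sym a-irr s r t U few 1≤t t≤
    with W₀ , sub₀ , U≤ , sparse ← sparse-subset a s r U few
    with j , eq ← m≤n⇒∃[o]m+o≡n (*-cancelˡ-≤ ((2 * s) ^ r) {{m^n≢0 (2 * s) r {{m*n≢0 2 s}}}} (≤-trans t≤ U≤))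
    = let size₀ = trans (sym eq) (cong suc (+-comm t j))
          W , sub , size , sp = shrink a a-sym a-irr s 2 t j W₀ size₀
            (≤-trans sparse (subst (λ z → z * z ≤ 2 * (suc (j + t) * (j + t))) (sym size₀)
              (square≤ (j + t) (≤-trans 1≤t (m≤n+m t j)))))
      in W , ⊑-trans sub sub₀ , size , sp
    where
    square≤ : ∀ q → 1 ≤ q → suc q * suc q ≤ 2 * (suc q * q)
    square≤ q 1≤q = begin
      suc q * suc q       ≤⟨ *-monoʳ-≤ (suc q) (+-monoˡ-≤ q 1≤q) ⟩
      suc q * (q + q)     ≡⟨ l q ⟩
      2 * (suc q * q)     ∎
      where
      open ≤-Reasoning
      l : ∀ q → suc q * (q + q) ≡ 2 * (suc q * q)
      l = solve-∀

  -- Packings by disjoint sets of equal size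

  block : ∀ {n k} → (Fin n → Fin k) → Fin k → Fin n → Bool
  block f i u = ⌊ f u ≟ i ⌋

  block-sizes : ∀ {n q t} (lab : Fin n → Fin (suc q)) → (∀ i → countF (block lab (suc i)) ≡ t) →
    n ≡ countF (block lab zero) + q * t
  block-sizes {n} {q} {t} lab size = trans (sym (count-true n)) (trans (sum-fibre-const lab (λ _ → 1))
    (cong₂ _+_ (*-identityʳ _) (trans (sum-cong (λ i → trans (*-identityʳ _) (size i))) (sum-const q t))))

  -- Label zero marks the unpacked points.
  record Packing {n} (U : Fin n → Bool) (t : ℕ) (Good : (Fin n → Bool) → Set) (q : ℕ) : Set where
    field
      lab    : Fin n → Fin (suc q)
      inside : ∀ {u i} → lab u ≡ suc i → U u ≡ true
      size   : ∀ i → countF (block lab (suc i)) ≡ t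
      good   : ∀ i → Good (block lab (suc i))

  module _ {n : ℕ} {t : ℕ} {Good : (Fin n → Bool) → Set}
           (resp : ∀ {W W'} → (∀ u → W u ≡ W' u) → Good W → Good W') where

    open Packing

    shift : ∀ {q} → Bool → Fin (suc q) → Fin (suc (suc q))
    shift true  i       = suc zero
    shift false zero    = zero
    shift false (suc i) = suc (suc i)

    shift-new : ∀ {q} b (i : Fin (suc q)) → ⌊ shift b i ≟ suc zero ⌋ ≡ b
    shift-new true  i       = refl
    shift-new false zero    = refl
    shift-new false (suc i) = refl

    shift-old : ∀ {q} b (i : Fin (suc q)) j → (i ≡ suc j → b ≡ false) →
      ⌊ shift b i ≟ suc (suc j) ⌋ ≡ ⌊ i ≟ suc j ⌋
    shift-old true i j h = bool-eq (λ ()) λ p → case h (≟-sound p) of λ ()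
    shift-old false zero    j h = refl
    shift-old false (suc i) j h = trans (≟-suc (suc i) (suc j)) refl

    shift-zero : ∀ {q} b (i : Fin (suc q)) → shift b i ≡ zero → b ≡ false × i ≡ zero
    shift-zero false zero h = refl , refl

    empty-packing : ∀ U → Packing U t Good 0
    empty-packing U .lab _  = zero
    empty-packing U .inside ()
    empty-packing U .size ()
    empty-packing U .good ()

    extend : ∀ {U W q} → W ⊑ U → countF W ≡ t → Good W → Packing (U ∖ W) t Good q → Packing U t Good (suc q)
    extend {U} {W} W⊑U W-size W-good P = record
      { lab    = λ u → shift (W u) (lab P u)
      ; inside = λ {u} {i} → in-U u i
      ; size   = λ where
          zero    → trans (count-cong (λ u → shift-new (W u) (lab P u))) W-size
          (suc i) → trans (count-cong (old i)) (size P i)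
      ; good   = λ where
          zero    → resp (λ u → sym (shift-new (W u) (lab P u))) W-good
          (suc i) → resp (λ u → sym (old i u)) (good P i)
      }
      where
      old : ∀ i u → ⌊ shift (W u) (lab P u) ≟ suc (suc i) ⌋ ≡ ⌊ lab P u ≟ suc i ⌋
      old i u = shift-old (W u) (lab P u) i (λ eq → not-true (proj₂ (∧-true {U u} (inside P eq))))
      in-U : ∀ u i → shift (W u) (lab P u) ≡ suc i → U u ≡ true
      in-U u i h with W u in eq | lab P u in eq′
      ... | true  | _     = W⊑U u eq
      ... | false | suc j = proj₁ (∧-true (inside P eq′))

    -- Each round removes `t` vertices and `t` is positive, so the size of `U` bounds the number of
    -- rounds. `R` is the last working set: it contains every vertex of `U` without a piece, so a
    -- bound on it is a bound on the leftover.
    greedy : {Stop : (Fin n → Bool) → Set} → 0 < t → ∀ U →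
      (∀ U' → U' ⊑ U → Stop U' ⊎ ∃ λ W → W ⊑ U' × countF W ≡ t × Good W) →
      ∃ λ q → Σ (Packing U t Good q) λ P → ∃ λ R → Stop R × (∀ u → U u ≡ true → lab P u ≡ zero → R u ≡ true)
    greedy {Stop} 0<t U step = go (suc (countF U)) U (λ _ p → p) ≤-refl
      where
      go : ∀ fuel V → V ⊑ U → countF V < fuel →
        ∃ λ q → Σ (Packing V t Good q) λ P → ∃ λ R → Stop R × (∀ u → V u ≡ true → lab P u ≡ zero → R u ≡ true)
      go (suc fuel) V V⊑U V< with step V V⊑U
      ... | inj₁ stop = 0 , empty-packing V , V , stop , λ _ p _ → p
      ... | inj₂ (W , W⊑V , W-size , W-good)
        with go fuel (V ∖ W) (λ u → V⊑U u ∘ proj₁ ∘ ∧-true)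
               (<-≤-trans (subst (countF (V ∖ W) <_) (sym (count-∖ {X = V} {W} W⊑V))
                 (m<n+m _ (subst (0 <_) (sym W-size) 0<t))) (s≤s⁻¹ V<))
      ...   | q , P , R , stop , rest = suc q , extend W⊑V W-size W-good P , R , stop ,
        λ u p h → let W∌ , l = shift-zero (W u) (lab P u) h in rest u (∧-intro p (cong not W∌)) l

  split-off : ∀ {n} q c (U : Fin n → Bool) → q * c ≤ countF U → Packing U c (λ _ → ⊤) q
  split-off zero    c U h = empty-packing (λ _ _ → tt) U
  split-off (suc q) c U h with subset-of-size U c (≤-trans (m≤m+n c (q * c)) h)
  ... | W , W⊑U , W-size = extend (λ _ _ → tt) W⊑U W-size tt (split-off q c (U ∖ W)
    (+-cancelˡ-≤ c _ _ (≤-trans h (≤-reflexive (trans (count-∖ {X = U} {W} W⊑U) (cong (_+ countF (U ∖ W)) W-size))))))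

  Monochromatic : ∀ {n A} → (Fin n → Fin A) → (Fin n → Bool) → Set
  Monochromatic key W = ∃ λ j → ∀ u → W u ≡ true → key u ≡ j

  -- Pigeonhole: while more than `A * t` vertices are left, some value of `key` is taken by more
  -- than `t` of them.
  chop : ∀ {n A} (key : Fin n → Fin A) t → 0 < t → ∀ U →
    ∃ λ q → Σ (Packing U t (Monochromatic key) q) λ P →
      countF (λ u → U u ∧ block (Packing.lab P) zero u) ≤ A * t
  chop {n} {A} key t 0<t U
    with greedy {Good = Monochromatic key} (λ eq (j , h) → j , λ u p → h u (trans (eq u) p))
           {λ R → countF R ≤ A * t} 0<t U step
    where
    step : ∀ U' → U' ⊑ U → countF U' ≤ A * t ⊎ ∃ λ W → W ⊑ U' × countF W ≡ t × Monochromatic key W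
    step U' _ with countF U' ≤? A * t
    ... | yes p = inj₁ p
    ... | no ¬p with sum-<⇒∃< {A} {λ _ → t} {λ j → countF (λ u → ⌊ key u ≟ j ⌋ ∧ U' u)}
                       (subst₂ _<_ (sym (sum-const A t)) (count-fibre key U') (≰⇒> ¬p))
    ...   | j , lt with subset-of-size (λ u → ⌊ key u ≟ j ⌋ ∧ U' u) t (<⇒≤ lt)
    ...     | W , sub , W-size = inj₂ (W , (λ u p → proj₂ (∧-true {⌊ key u ≟ j ⌋} (sub u p))) , W-size ,
                j , λ u p → ≟-sound (proj₁ (∧-true (sub u p))))
  ... | q , P , R , R≤ , rest = q , P , ≤-trans
    (count-mono {Y = R} (λ u p → rest u (proj₁ (∧-true p)) (≟-sound (proj₂ (∧-true {U u} p))))) R≤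

  -- Regular pairs and the regularity lemma

  -- The density of every large rectangle in A × B lies within 2 / s of c / s,
  -- where a subset counts as large if its relative size is at least 1 / d.
  Regular : ∀ {n} → (Fin n → Fin n → Bool) → ℕ → ℕ → (Fin n → Bool) → (Fin n → Bool) → Set
  Regular a s d A B = ∃ λ c → ∀ X Y → X ⊑ A → Y ⊑ B →
    countF A ≤ d * countF X → countF B ≤ d * countF Y →
    s * E (edge a) X Y ≤ (c + 2) * (countF X * countF Y) ×
    c * (countF X * countF Y) ≤ s * E (edge a) X Y + 2 * (countF X * countF Y)

  -- The square of the difference of two natural numbers; descending in both arguments at once
  -- avoids truncated subtraction.
  sq : ℕ → ℕ → ℕ
  sq zero    g       = g * g
  sq (suc x) zero    = suc x * suc x
  sq (suc x) (suc g) = sq x g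

  sq-0 : ∀ x → sq x 0 ≡ x * x
  sq-0 zero    = refl
  sq-0 (suc x) = refl

  sq-suc : ∀ x g → sq x (suc g) + 2 * x ≡ sq x g + suc (2 * g)
  sq-suc zero    g       = lem g
    where
    lem : ∀ g → suc g * suc g + 0 ≡ g * g + suc (2 * g)
    lem = solve-∀
  sq-suc (suc x) (suc g) = begin
    sq x (suc g) + 2 * suc x         ≡⟨ l₁ (sq x (suc g)) x ⟩
    sq x (suc g) + 2 * x + 2         ≡⟨ cong (_+ 2) (sq-suc x g) ⟩
    sq x g + suc (2 * g) + 2         ≡⟨ l₂ (sq x g) g ⟩
    sq x g + suc (2 * suc g)         ∎
    where
    open ≡-Reasoning
    l₁ : ∀ y x → y + 2 * suc x ≡ y + 2 * x + 2
    l₁ = solve-∀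
    l₂ : ∀ y g → y + suc (2 * g) + 2 ≡ y + suc (2 * suc g)
    l₂ = solve-∀
  sq-suc (suc x) zero = trans (cong (_+ 2 * suc x) (sq-0 x)) (lem x)
    where
    lem : ∀ x → x * x + 2 * suc x ≡ suc x * suc x + 1
    lem = solve-∀

  sq-up : ∀ x g b → sq x (g + ι b) + 2 * (ι b * x) ≡ sq x g + (2 * (ι b * g) + ι b)
  sq-up x g false = cong (λ z → sq x z + 0) (+-identityʳ g)
  sq-up x g true  = begin
    sq x (g + 1) + 2 * (1 * x)       ≡⟨ cong₂ (λ y z → sq x y + 2 * z) (+-comm g 1) (*-identityˡ x) ⟩
    sq x (suc g) + 2 * x             ≡⟨ sq-suc x g ⟩
    sq x g + suc (2 * g)             ≡⟨ lem (sq x g) g ⟩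
    sq x g + (2 * (1 * g) + 1)       ∎
    where
    open ≡-Reasoning
    lem : ∀ y g → y + suc (2 * g) ≡ y + (2 * (1 * g) + 1)
    lem = solve-∀

  -- Only an inequality, because `g ∸ 1` stays at zero when `g` is zero; otherwise it is `sq-suc`
  -- read backwards.
  sq-down : ∀ x g b → sq x (g ∸ ι b) + 2 * (ι b * g) ≤ sq x g + (2 * (ι b * x) + ι b)
  sq-down x g       false = ≤-refl
  sq-down x zero    true  = +-monoʳ-≤ (sq x 0) z≤n
  sq-down x (suc g) true  = ≤-reflexive (begin
    sq x g + 2 * (1 * suc g)               ≡⟨ l₁ (sq x g) g ⟩
    sq x g + suc (2 * g) + 1               ≡⟨ cong (_+ 1) (sym (sq-suc x g)) ⟩
    sq x (suc g) + 2 * x + 1               ≡⟨ l₂ (sq x (suc g)) x ⟩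
    sq x (suc g) + (2 * (1 * x) + 1)       ∎)
    where
    open ≡-Reasoning
    l₁ : ∀ y g → y + 2 * (1 * suc g) ≡ y + suc (2 * g) + 1
    l₁ = solve-∀
    l₂ : ∀ y x → y + 2 * x + 1 ≡ y + (2 * (1 * x) + 1)
    l₂ = solve-∀

  E-restrict : ∀ {n} (w : Fin n → Fin n → ℕ) {A B X Y : Fin n → Bool} → X ⊑ A → Y ⊑ B →
    E (λ u v → ι (X u ∧ Y v) * w u v) A B ≡ E w X Y
  E-restrict w {A} {B} {X} {Y} X⊑A Y⊑B = sum-cong (λ u → sum-cong (λ v →
    lem (A u) (B v) (X u) (Y v) (w u v) (X⊑A u) (Y⊑B v)))
    where
    lem : ∀ a b x y w → (x ≡ true → a ≡ true) → (y ≡ true → b ≡ true) →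
      ι a * (ι b * (ι (x ∧ y) * w)) ≡ ι x * (ι y * w)
    lem a b false y     w p q = trans (cong (ι a *_) (*-zeroʳ (ι b))) (*-zeroʳ (ι a))
    lem a b true  false w p q = trans (cong (ι a *_) (*-zeroʳ (ι b))) (*-zeroʳ (ι a))
    lem a b true  true  w p q rewrite p refl | q refl = cong (_+ 0) (+-identityʳ (w + 0))

  E-blocks : ∀ {n k} (lab : Fin n → Fin k) (w : Fin n → Fin n → ℕ) →
    sumF (λ u → sumF (w u)) ≡ sumF (λ i → sumF (λ j → E w (block lab i) (block lab j)))
  E-blocks {n} {k} lab w = begin
    sumF (λ u → sumF (w u))
      ≡⟨ sum-fibre lab (λ u → sumF (w u)) ⟩
    sumF (λ i → sumF (λ u → ι (block lab i u) * sumF (w u)))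
      ≡⟨ sum-cong (λ i → sum-cong (λ u → cong (ι (block lab i u) *_) (sum-fibre lab (w u)))) ⟩
    sumF (λ i → sumF (λ u → ι (block lab i u) * sumF (λ j → sumF (λ v → ι (block lab j v) * w u v))))
      ≡⟨ sum-cong (λ i → sum-cong (λ u → trans (sym (sum-*ˡ {k} (ι (block lab i u)) _))
           (sum-cong {k} (λ j → sym (sum-*ˡ {n} (ι (block lab i u)) _))))) ⟩
    sumF (λ i → sumF (λ u → sumF (λ j → sumF (λ v → ι (block lab i u) * (ι (block lab j v) * w u v)))))
      ≡⟨ sum-cong (λ i → sum-swap (λ u j → sumF (λ v → ι (block lab i u) * (ι (block lab j v) * w u v)))) ⟩
    sumF (λ i → sumF (λ j → E w (block lab i) (block lab j))) ∎
    where open ≡-Reasoning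

  -- The potential of an approximation to the edge indicator

  module Potential {n : ℕ} (a : Fin n → Fin n → Bool) (s : ℕ) where

    φ : (Fin n → Fin n → ℕ) → Fin n → Fin n → ℕ
    φ γ u v = sq (s * edge a u v) (γ u v)

    Φ : (Fin n → Fin n → ℕ) → ℕ
    Φ γ = sumF λ u → sumF λ v → φ γ u v

    module _ (γ : Fin n → Fin n → ℕ) {A B X Y : Fin n → Bool} (X⊑A : X ⊑ A) (Y⊑B : Y ⊑ B) where
      private
        ρ : Fin n → Fin n → ℕ
        ρ u v = ι (X u ∧ Y v)
        R Γ e : ℕ
        R = countF X * countF Y
        Γ = E γ X Y
        e = s * E (edge a) X Y

        E-2ρ : ∀ w → E (λ u v → 2 * (ρ u v * w u v)) A B ≡ 2 * E w X Y
        E-2ρ w = trans (E-*ˡ 2 (λ u v → ρ u v * w u v) A B) (cong (2 *_) (E-restrict w X⊑A Y⊑B))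

        E-ρ : E ρ A B ≡ R
        E-ρ = trans (E-cong {X = A} {B} (λ u v _ _ → sym (*-identityʳ (ρ u v))))
          (trans (E-restrict (λ _ _ → 1) X⊑A Y⊑B) (trans (E-const 1 X Y) (*-identityˡ R)))

        E-edges : E (λ u v → 2 * (ρ u v * (s * edge a u v))) A B ≡ 2 * e
        E-edges = trans (E-2ρ (λ u v → s * edge a u v)) (cong (2 *_) (E-*ˡ s (edge a) X Y))

      -- Raising γ by one on X × Y changes the sum of squares by R - 2 (e - Γ), which is at most -R
      -- once `s * edge a` exceeds γ there by one on average.
      gain-up : Γ + R ≤ e → E (φ (λ u v → γ u v + ρ u v)) A B + R ≤ E (φ γ) A B
      gain-up h = +-cancelʳ-≤ (2 * Γ + R) _ _ (begin
        Φ' + R + (2 * Γ + R)    ≡⟨ l Φ' R Γ ⟩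
        Φ' + 2 * (Γ + R)        ≤⟨ +-monoʳ-≤ Φ' (*-monoʳ-≤ 2 h) ⟩
        Φ' + 2 * e              ≡⟨ cong (Φ' +_) (sym E-edges) ⟩
        Φ' + E (λ u v → 2 * (ρ u v * (s * edge a u v))) A B ≡⟨ sym (E-+ _ _ A B) ⟩
        E (λ u v → φ (λ u v → γ u v + ρ u v) u v + 2 * (ρ u v * (s * edge a u v))) A B
          ≡⟨ E-cong {X = A} {B} (λ u v _ _ → sq-up (s * edge a u v) (γ u v) (X u ∧ Y v)) ⟩
        E (λ u v → φ γ u v + (2 * (ρ u v * γ u v) + ρ u v)) A B
          ≡⟨ trans (E-+ (φ γ) _ A B) (cong (E (φ γ) A B +_) (E-+ _ ρ A B)) ⟩
        E (φ γ) A B + (E (λ u v → 2 * (ρ u v * γ u v)) A B + E ρ A B)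
          ≡⟨ cong (E (φ γ) A B +_) (cong₂ _+_ (E-2ρ γ) E-ρ) ⟩
        E (φ γ) A B + (2 * Γ + R) ∎)
        where
        open ≤-Reasoning
        Φ' = E (φ (λ u v → γ u v + ρ u v)) A B
        l : ∀ x r g → x + r + (2 * g + r) ≡ x + 2 * (g + r)
        l = solve-∀

      gain-down : e + R ≤ Γ → E (φ (λ u v → γ u v ∸ ρ u v)) A B + R ≤ E (φ γ) A B
      gain-down h = +-cancelʳ-≤ (2 * e + R) _ _ (begin
        Φ' + R + (2 * e + R)    ≡⟨ l Φ' R e ⟩
        Φ' + 2 * (e + R)        ≤⟨ +-monoʳ-≤ Φ' (*-monoʳ-≤ 2 h) ⟩
        Φ' + 2 * Γ              ≡⟨ cong (Φ' +_) (sym (E-2ρ γ)) ⟩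
        Φ' + E (λ u v → 2 * (ρ u v * γ u v)) A B ≡⟨ sym (E-+ _ _ A B) ⟩
        E (λ u v → φ (λ u v → γ u v ∸ ρ u v) u v + 2 * (ρ u v * γ u v)) A B
          ≤⟨ E-mono {X = A} {B} (λ u v _ _ → sq-down (s * edge a u v) (γ u v) (X u ∧ Y v)) ⟩
        E (λ u v → φ γ u v + (2 * (ρ u v * (s * edge a u v)) + ρ u v)) A B
          ≡⟨ trans (E-+ (φ γ) _ A B) (cong (E (φ γ) A B +_) (E-+ _ ρ A B)) ⟩
        E (φ γ) A B + (E (λ u v → 2 * (ρ u v * (s * edge a u v))) A B + E ρ A B)
          ≡⟨ cong (E (φ γ) A B +_) (cong₂ _+_ E-edges E-ρ) ⟩
        E (φ γ) A B + (2 * e + R) ∎)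
        where
        open ≤-Reasoning
        Φ' = E (φ (λ u v → γ u v ∸ ρ u v)) A B
        l : ∀ x r g → x + r + (2 * g + r) ≡ x + 2 * (g + r)
        l = solve-∀

  -- Leftover vertices carry the label zero and must not contribute to counts of pairs of classes.
  lift : ∀ {q} → (Fin q → Fin q → ℕ) → Fin (suc q) → Fin (suc q) → ℕ
  lift g (suc i) (suc j) = g i j
  lift g (suc i) zero    = 0
  lift g zero    _       = 0

  -- One refinement step of the regularity lemma

  module Refine {n : ℕ} (a : Fin n → Fin n → Bool) (s d : ℕ) {K m : ℕ}
                (lab : Fin n → Fin (suc K)) (γ : Fin n → Fin n → ℕ) where

    open Potential a s

    -- The deviation from γ is at least one unit of 1 / s. The sets have type `Subset` so that a
    -- witness can be found by exhaustive search, and `i` and `j` may coincide, so that pairs of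
    -- pieces from one class are controlled as well.
    Irregular : Fin K → Fin K → Subset n → Subset n → Set
    Irregular i j X Y = lookup X ⊑ block lab (suc i) × lookup Y ⊑ block lab (suc j) ×
      m ≤ d * countF (lookup X) × m ≤ d * countF (lookup Y) ×
      (E γ (lookup X) (lookup Y) + countF (lookup X) * countF (lookup Y) ≤ s * E (edge a) (lookup X) (lookup Y)
        ⊎ s * E (edge a) (lookup X) (lookup Y) + countF (lookup X) * countF (lookup Y) ≤ E γ (lookup X) (lookup Y))

    Witness : Fin K → Fin K → Set
    Witness i j = ∃ λ X → ∃ λ Y → Irregular i j X Y

    ⊑? : ∀ (X Y : Fin n → Bool) → Dec (X ⊑ Y)
    ⊑? X Y = all? (λ u → (X u Data.Bool.≟ true) →-dec (Y u Data.Bool.≟ true))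

    witness? : ∀ i j → Dec (Witness i j)
    witness? i j = anySubset? λ X → anySubset? λ Y →
      ⊑? _ _ ×-dec ⊑? _ _ ×-dec (_ ≤? _) ×-dec (_ ≤? _) ×-dec ((_ ≤? _) ⊎-dec (_ ≤? _))

    irr : Fin K → Fin K → Bool
    irr i j = ⌊ witness? i j ⌋

    xOf yOf : ∀ {i j} → Dec (Witness i j) → Fin n → Bool
    xOf (yes (X , _))     = lookup X
    xOf (no _)            = λ _ → false
    yOf (yes (_ , Y , _)) = lookup Y
    yOf (no _)            = λ _ → false

    move : ∀ {i j} → Dec (Witness i j) → Bool → ℕ → ℕ
    move (yes (_ , _ , _ , _ , _ , _ , inj₁ _)) b g = g + ι b
    move (yes (_ , _ , _ , _ , _ , _ , inj₂ _)) b g = g ∸ ι b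
    move (no _)                                 b g = g

    private
      scale : ∀ x y {p q} → m ≤ d * x → m ≤ d * y → p + x * y ≤ q → d * d * p + m * m * 1 ≤ d * d * q
      scale x y {p} {q} X≥ Y≥ h = begin
        d * d * p + m * m * 1       ≡⟨ cong (d * d * p +_) (*-identityʳ (m * m)) ⟩
        d * d * p + m * m           ≤⟨ +-monoʳ-≤ (d * d * p) (*-mono-≤ X≥ Y≥) ⟩
        d * d * p + d * x * (d * y) ≡⟨ cong (d * d * p +_) (lem d x y) ⟩
        d * d * p + d * d * (x * y) ≡⟨ sym (*-distribˡ-+ (d * d) p (x * y)) ⟩
        d * d * (p + x * y)         ≤⟨ *-monoʳ-≤ (d * d) h ⟩
        d * d * q                   ∎
        where
        open ≤-Reasoning
        lem : ∀ d x y → d * x * (d * y) ≡ d * d * (x * y)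
        lem = solve-∀

    -- A witness rectangle has at least m² / d² pairs, each worth one unit of potential on average;
    -- multiplication by `d * d` clears the denominator.
    block-gain : ∀ {i j} (w : Dec (Witness i j)) → let A = block lab (suc i) ; B = block lab (suc j) in
      d * d * E (φ (λ u v → move w (xOf w u ∧ yOf w v) (γ u v))) A B + m * m * ι ⌊ w ⌋ ≤ d * d * E (φ γ) A B
    block-gain {i} {j} (no _) = ≤-reflexive (trans
      (cong (d * d * E (φ γ) (block lab (suc i)) (block lab (suc j)) +_) (*-zeroʳ (m * m))) (+-identityʳ _))
    block-gain (yes (X , Y , X⊑ , Y⊑ , X≥ , Y≥ , inj₁ h)) =
      scale (countF (lookup X)) (countF (lookup Y)) X≥ Y≥ (gain-up γ X⊑ Y⊑ h)
    block-gain (yes (X , Y , X⊑ , Y⊑ , X≥ , Y≥ , inj₂ h)) =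
      scale (countF (lookup X)) (countF (lookup Y)) X≥ Y≥ (gain-down γ X⊑ Y⊑ h)

    xs ys : Fin (suc K) → Fin (suc K) → Fin n → Bool
    xs (suc i) (suc j) = xOf (witness? i j)
    xs _       _       = λ _ → false
    ys (suc i) (suc j) = yOf (witness? i j)
    ys _       _       = λ _ → false

    update : Fin (suc K) → Fin (suc K) → Bool → ℕ → ℕ
    update (suc i) (suc j) b g = move (witness? i j) b g
    update (suc i) zero    b g = g
    update zero    _       b g = g

    γ′ : Fin n → Fin n → ℕ
    γ′ u v = update (lab u) (lab v) (xs (lab u) (lab v) u ∧ ys (lab u) (lab v) v) (γ u v)

    irr⁺ : Fin (suc K) → Fin (suc K) → ℕ
    irr⁺ = lift λ i j → ι (irr i j)

    E-φ-γ′ : ∀ i j → E (φ γ′) (block lab i) (block lab j) ≡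
      E (φ (λ u v → update i j (xs i j u ∧ ys i j v) (γ u v))) (block lab i) (block lab j)
    E-φ-γ′ i j = E-cong {X = block lab i} {block lab j} (λ u v p q → cong (sq (s * edge a u v))
      (cong₂ (λ i j → update i j (xs i j u ∧ ys i j v) (γ u v)) (≟-sound p) (≟-sound q)))

    block-gain⁺ : ∀ i j → d * d * E (φ γ′) (block lab i) (block lab j) + m * m * irr⁺ i j
      ≤ d * d * E (φ γ) (block lab i) (block lab j)
    block-gain⁺ i j = ≤-trans (≤-reflexive (cong (λ z → d * d * z + m * m * irr⁺ i j) (E-φ-γ′ i j))) (aux i j)
      where
      trivial : ∀ {p} → p + m * m * 0 ≤ p
      trivial {p} = ≤-reflexive (trans (cong (p +_) (*-zeroʳ (m * m))) (+-identityʳ p))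
      aux : ∀ i j → d * d * E (φ (λ u v → update i j (xs i j u ∧ ys i j v) (γ u v))) (block lab i) (block lab j)
        + m * m * irr⁺ i j ≤ d * d * E (φ γ) (block lab i) (block lab j)
      aux (suc i) (suc j) = block-gain (witness? i j)
      aux (suc i) zero    = trivial
      aux zero    j       = trivial

    irregular-count : ℕ
    irregular-count = sumF λ i → sumF λ j → ι (irr i j)

    potential-gain : d * d * Φ γ′ + m * m * irregular-count ≤ d * d * Φ γ
    potential-gain = begin
      d * d * Φ γ′ + m * m * irregular-count
        ≡⟨ cong₂ (λ x y → d * d * x + m * m * y) (E-blocks lab (φ γ′)) (sym count⁺) ⟩
      d * d * ΣΣ (e γ′) + m * m * ΣΣ irr⁺
        ≡⟨ sym (ΣΣ-linear (d * d) (m * m) (e γ′) irr⁺) ⟩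
      ΣΣ (λ i j → d * d * e γ′ i j + m * m * irr⁺ i j)
        ≤⟨ sum-mono (λ i → sum-mono (λ j → block-gain⁺ i j)) ⟩
      ΣΣ (λ i j → d * d * e γ i j)
        ≡⟨ ΣΣ-* (d * d) (e γ) ⟩
      d * d * ΣΣ (e γ)
        ≡⟨ cong (d * d *_) (sym (E-blocks lab (φ γ))) ⟩
      d * d * Φ γ ∎
      where
      open ≤-Reasoning
      ΣΣ : (Fin (suc K) → Fin (suc K) → ℕ) → ℕ
      ΣΣ f = sumF λ i → sumF (f i)
      e : (Fin n → Fin n → ℕ) → Fin (suc K) → Fin (suc K) → ℕ
      e γ i j = E (φ γ) (block lab i) (block lab j)
      ΣΣ-* : ∀ c f → ΣΣ (λ i j → c * f i j) ≡ c * ΣΣ f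
      ΣΣ-* c f = trans (sum-cong (λ i → sum-*ˡ c (f i))) (sum-*ˡ c (λ i → sumF (f i)))
      ΣΣ-linear : ∀ c c' f g → ΣΣ (λ i j → c * f i j + c' * g i j) ≡ c * ΣΣ f + c' * ΣΣ g
      ΣΣ-linear c c' f g = trans (sum-cong (λ i → sum-+ (λ j → c * f i j) (λ j → c' * g i j)))
        (trans (sum-+ (λ i → sumF λ j → c * f i j) (λ i → sumF λ j → c' * g i j)) (cong₂ _+_ (ΣΣ-* c f) (ΣΣ-* c' g)))
      count⁺ : ΣΣ irr⁺ ≡ irregular-count
      count⁺ = cong (_+ irregular-count) (sum-zero (suc K))

    bit : Bool → Fin 2
    bit false = zero
    bit true  = suc zero

    bit-injective : ∀ {b c} → bit b ≡ bit c → b ≡ c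
    bit-injective {false} {false} _ = refl
    bit-injective {true}  {true}  _ = refl

    -- A class is cut by the first sets of the pairs in which it comes first and by the second sets
    -- of those in which it comes second. Recording all these memberships gives atoms on whose pairs
    -- `γ′` is again constant.
    xCode yCode : Fin n → Fin (suc K) → Fin 2
    xCode u j = bit (xs (lab u) j u)
    yCode u i = bit (ys i (lab u) u)

    key : Fin n → Fin (suc K * (2 ^ suc K * 2 ^ suc K))
    key u = combine (lab u) (combine (funToFin (xCode u)) (funToFin (yCode u)))

    private
      code-injective : ∀ {f g : Fin (suc K) → Fin 2} → funToFin f ≡ funToFin g → ∀ i → f i ≡ g i
      code-injective {f} {g} h i = trans (sym (finToFun-funToFin f i))
        (trans (cong (λ c → finToFun c i) h) (finToFun-funToFin g i))

    key-lab : ∀ {u u'} → key u ≡ key u' → lab u ≡ lab u'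
    key-lab {u} {u'} h = combine-injectiveˡ (lab u) _ (lab u') _ h

    key-x : ∀ {u u'} → key u ≡ key u' → ∀ j → xs (lab u) j u ≡ xs (lab u') j u'
    key-x {u} {u'} h j = bit-injective (code-injective {xCode u} {xCode u'} (combine-injectiveˡ _ _ _ _
      (combine-injectiveʳ (lab u) (combine (funToFin (xCode u)) (funToFin (yCode u))) (lab u') _ h)) j)

    key-y : ∀ {u u'} → key u ≡ key u' → ∀ i → ys i (lab u) u ≡ ys i (lab u') u'
    key-y {u} {u'} h i = bit-injective (code-injective {yCode u} {yCode u'}
      (combine-injectiveʳ (funToFin (xCode u)) _ (funToFin (xCode u')) _
      (combine-injectiveʳ (lab u) (combine (funToFin (xCode u)) (funToFin (yCode u))) (lab u') _ h)) i)

    γ′-cong : ∀ {u u' v v'} → key u ≡ key u' → key v ≡ key v' → γ u v ≡ γ u' v' → γ′ u v ≡ γ′ u' v'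
    γ′-cong {u} {u'} {v} {v'} hu hv hγ
      rewrite key-x hu (lab v) | key-y hv (lab u) | key-lab hu | key-lab hv | hγ = refl

    -- The single value of γ on the pair serves as `c`: a large rectangle that missed it by one unit
    -- would be a witness.
    not-irr⇒regular : (∀ i → countF (block lab (suc i)) ≡ m) → 0 < m →
      (∀ {u u' v v' i j} → lab u ≡ suc i → lab u' ≡ suc i → lab v ≡ suc j → lab v' ≡ suc j → γ u v ≡ γ u' v') →
      ∀ {i j} → irr i j ≡ false → Regular a s d (block lab (suc i)) (block lab (suc j))
    not-irr⇒regular size 0<m const {i} {j} h
      with u₀ , p₀ ← count-inhabited {X = block lab (suc i)} (subst (0 <_) (sym (size i)) 0<m)
      with v₀ , q₀ ← count-inhabited {X = block lab (suc j)} (subst (0 <_) (sym (size j)) 0<m)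
      = γ u₀ v₀ , bounds
      where
      no-witness : ¬ Witness i j
      no-witness w with witness? i j
      no-witness w | no ¬w = ¬w w
      no-witness w | yes _ = case h of λ ()
      bounds : ∀ X Y → X ⊑ block lab (suc i) → Y ⊑ block lab (suc j) →
        countF (block lab (suc i)) ≤ d * countF X → countF (block lab (suc j)) ≤ d * countF Y →
        s * E (edge a) X Y ≤ (γ u₀ v₀ + 2) * (countF X * countF Y) ×
        γ u₀ v₀ * (countF X * countF Y) ≤ s * E (edge a) X Y + 2 * (countF X * countF Y)
      bounds X Y X⊑ Y⊑ X≥ Y≥ = upper , lower
        where
        open ≤-Reasoning
        R e c : ℕ
        R = countF X * countF Y
        e = s * E (edge a) X Y
        c = γ u₀ v₀
        Γ : E γ X Y ≡ c * R
        Γ = trans (E-cong {X = X} {Y} (λ u v p q → const (≟-sound (X⊑ u p)) (≟-sound p₀) (≟-sound (Y⊑ v q)) (≟-sound q₀)))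
          (E-const c X Y)
        S : (Fin n → Bool) → Subset n
        S = tabulate
        ≗ : ∀ (Z : Fin n → Bool) u → lookup (S Z) u ≡ Z u
        ≗ Z = lookup∘tabulate Z
        no-deviation : ¬ (E γ X Y + R ≤ e ⊎ e + R ≤ E γ X Y)
        no-deviation dev = no-witness (S X , S Y ,
          (λ u p → X⊑ u (trans (sym (≗ X u)) p)) , (λ u p → Y⊑ u (trans (sym (≗ Y u)) p)) ,
          subst₂ (λ y z → y ≤ d * z) (size i) (sym (count-cong (≗ X))) X≥ ,
          subst₂ (λ y z → y ≤ d * z) (size j) (sym (count-cong (≗ Y))) Y≥ ,
          subst₂ (λ (g , r) e → g + r ≤ e ⊎ e + r ≤ g)
            (sym (cong₂ _,_ (E-congˢ γ (≗ X) (≗ Y)) (cong₂ _*_ (count-cong (≗ X)) (count-cong (≗ Y)))))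
            (sym (cong (s *_) (E-congˢ (edge a) (≗ X) (≗ Y)))) dev)
        upper : e ≤ (c + 2) * R
        upper = begin
          e               ≤⟨ <⇒≤ (≰⇒> (no-deviation ∘ inj₁)) ⟩
          E γ X Y + R     ≡⟨ cong (_+ R) Γ ⟩
          c * R + R       ≤⟨ +-monoʳ-≤ (c * R) (m≤m+n R (R + 0)) ⟩
          c * R + 2 * R   ≡⟨ sym (*-distribʳ-+ R c 2) ⟩
          (c + 2) * R     ∎
        lower : c * R ≤ e + 2 * R
        lower = begin
          c * R           ≡⟨ sym Γ ⟩
          E γ X Y         ≤⟨ <⇒≤ (≰⇒> (no-deviation ∘ inj₂)) ⟩
          e + R           ≤⟨ +-monoʳ-≤ e (m≤m+n R (R + 0)) ⟩
          e + 2 * R       ∎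

  -- Iteration of the refinement

  record RegularPartition {n} (a : Fin n → Fin n → Bool) (s d D z κ₀ M : ℕ) {k} (P : Fin n → Fin k) : Set where
    field
      {K m}   : ℕ
      lab     : Fin n → Fin (suc K)
      size    : ∀ i → countF (block lab (suc i)) ≡ m
      κ₀≤K    : κ₀ ≤ K
      K≤M     : K ≤ M
      n≤M*m   : n ≤ M * m
      small   : z * countF (block lab zero) ≤ n
      within  : ∀ {u u' i} → lab u ≡ suc i → lab u' ≡ suc i → P u ≡ P u'
      irr     : Fin K → Fin K → Bool
      few-irr : D * (sumF λ i → sumF λ j → ι (irr i j)) ≤ K * K
      regular : ∀ {i j} → irr i j ≡ false → Regular a s d (block lab (suc i)) (block lab (suc j))

  quotient-bounds : ∀ m r .{{_ : NonZero r}} → r ≤ m → 0 < m / r × r * (m / r) ≤ m × m ≤ 2 * r * (m / r)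
  quotient-bounds m r r≤m = 0<t , ≤-trans (≤-reflexive (*-comm r t)) (m/n*n≤m m r) , (begin
    m                   ≡⟨ m≡m%n+[m/n]*n m r ⟩
    m % r + t * r       ≤⟨ +-monoˡ-≤ (t * r) (<⇒≤ (m%n<n m r)) ⟩
    r + t * r           ≤⟨ +-monoˡ-≤ (t * r) (m≤n*m r t {{>-nonZero 0<t}}) ⟩
    t * r + t * r       ≡⟨ lem t r ⟩
    2 * r * t           ∎)
    where
    open ≤-Reasoning
    t = m / r
    0<t : 0 < t
    0<t = m≥n⇒m/n>0 r≤m
    lem : ∀ t r → t * r + t * r ≡ 2 * r * t
    lem = solve-∀

  atoms : ℕ → ℕ
  atoms K = suc K * (2 ^ suc K * 2 ^ suc K)

  atoms-mono : ∀ {K M} → K ≤ M → atoms K ≤ atoms M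
  atoms-mono K≤M = *-mono-≤ (s≤s K≤M) (*-mono-≤ (^-monoʳ-≤ 2 (s≤s K≤M)) (^-monoʳ-≤ 2 (s≤s K≤M)))

  -- Pieces of this fraction of a class leave at most `atoms M` times their size uncut, which is at
  -- most n / `Z`; the successor keeps the divisor positive.
  refine-ratio : ℕ → ℕ → ℕ
  refine-ratio Z M = suc (atoms M * Z)

  -- Follows the constant in `n ≤ M * m` through `N` rounds: a round divides the class size by at
  -- most `2 * refine-ratio Z M`, where the 2 is due to rounding.
  tower : ℕ → ℕ → ℕ → ℕ
  tower Z zero    M = M
  tower Z (suc N) M = tower Z N (2 * refine-ratio Z M * M)

  M≤tower : ∀ Z N M → M ≤ tower Z N M
  M≤tower Z zero    M = ≤-refl
  M≤tower Z (suc N) M = ≤-trans (m≤n*m M (2 * refine-ratio Z M)) (M≤tower Z N _)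

  unpacked : ∀ {n q k} (lab : Fin n → Fin (suc k)) (lab' : Fin n → Fin (suc q)) →
    countF (block lab' zero) ≤ countF (block lab zero) + countF (λ u → not (block lab zero u) ∧ block lab' zero u)
  unpacked lab lab' = ≤-trans (≤-reflexive (count-split (block lab' zero) (block lab zero))) (+-mono-≤
    (count-mono {Y = block lab zero} (λ u p → proj₂ (∧-true {block lab' zero u} p)))
    (count-mono {X = block lab' zero ∖ block lab zero} (λ u p →
      ∧-intro (proj₂ (∧-true {block lab' zero u} p)) (proj₁ (∧-true p)))))

  module Regularise {n : ℕ} (a : Fin n → Fin n → Bool) (s d D z κ₀ : ℕ) {k : ℕ} (P : Fin n → Fin k) (N₀ : ℕ)
                    (0<n : 0 < n) where

    open Potential a s

    -- In `2 + z` the 2 keeps at least half of the vertices inside classes, and `z` is the demand on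
    -- the final leftover; `suc N₀` divides the permitted leftover among the rounds.
    Z : ℕ
    Z = (2 + z) * suc N₀

    -- N bounds the number of refinements still to come.
    record State (N M : ℕ) : Set where
      field
        {K m}   : ℕ
        lab     : Fin n → Fin (suc K)
        γ       : Fin n → Fin n → ℕ
        size    : ∀ i → countF (block lab (suc i)) ≡ m
        within  : ∀ {u u' i} → lab u ≡ suc i → lab u' ≡ suc i → P u ≡ P u'
        const   : ∀ {u u' v v' i j} → lab u ≡ suc i → lab u' ≡ suc i → lab v ≡ suc j → lab v' ≡ suc j →
                  γ u v ≡ γ u' v'
        n≤M*m   : n ≤ M * m
        m-small : 2 * κ₀ * m ≤ n
        -- A budget of `suc N₀` shares of n / `Z` leftover vertices: one for the initial cutting and
        -- one for each round, with `N` of them unspent.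
        small   : Z * countF (block lab zero) + N * n ≤ suc N₀ * n
        energy  : 4 * D * (d * d) * Φ γ ≤ N * (n * n)

    module Facts {N M : ℕ} (σ : State N M) where
      open State σ
      open ≤-Reasoning

      v₀ : ℕ
      v₀ = countF (block lab zero)

      0<m : 0 < m
      0<m = n≢0⇒n>0 λ { refl → n≮0 (≤-trans 0<n (subst (n ≤_) (*-zeroʳ M) n≤M*m)) }

      instance
        m≢0 : NonZero m
        m≢0 = >-nonZero 0<m

      total : n ≡ v₀ + K * m
      total = block-sizes lab size

      small′ : (2 + z) * v₀ ≤ n
      small′ = *-cancelˡ-≤ (suc N₀) (begin
        suc N₀ * ((2 + z) * v₀)  ≡⟨ lem (suc N₀) (2 + z) v₀ ⟩
        Z * v₀                   ≤⟨ m+n≤o⇒m≤o (Z * v₀) small ⟩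
        suc N₀ * n               ∎)
        where
        lem : ∀ p q v → p * (q * v) ≡ q * p * v
        lem = solve-∀

      n≤2Km : n ≤ 2 * K * m
      n≤2Km = +-cancelˡ-≤ n _ _ (begin
        n + n                            ≡⟨ cong₂ _+_ total total ⟩
        v₀ + K * m + (v₀ + K * m)        ≡⟨ lem v₀ K m ⟩
        2 * v₀ + 2 * K * m               ≤⟨ +-monoˡ-≤ (2 * K * m) (≤-trans (*-monoˡ-≤ v₀ (m≤m+n 2 z)) small′) ⟩
        n + 2 * K * m                    ∎)
        where
        lem : ∀ v K m → v + K * m + (v + K * m) ≡ 2 * v + 2 * K * m
        lem = solve-∀

      Km≤n : K * m ≤ n
      Km≤n = subst (K * m ≤_) (sym total) (m≤n+m (K * m) v₀)

      K≤M : K ≤ M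
      K≤M = *-cancelʳ-≤ K M m (≤-trans Km≤n n≤M*m)

      κ₀≤K : κ₀ ≤ K
      κ₀≤K = *-cancelˡ-≤ 2 (*-cancelʳ-≤ (2 * κ₀) (2 * K) m (≤-trans m-small n≤2Km))

      m≤n : m ≤ n
      m≤n = ≤-trans (m≤n*m m K {{>-nonZero 0<K}}) Km≤n
        where
        0<K : 0 < K
        0<K = n≢0⇒n>0 λ { refl → n≮0 (≤-trans 0<n n≤2Km) }

      open Refine a s d {K} {m} lab γ public

      -- More than K² / D irregular pairs gain m² / d² each, and K m is at least n / 2, so the
      -- potential falls by at least n² / (4 D d²).
      energy-drop : K * K < D * irregular-count → 4 * D * (d * d) * Φ γ′ + n * n ≤ 4 * D * (d * d) * Φ γ
      energy-drop h = begin
        4 * D * (d * d) * Φ γ′ + n * n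
          ≤⟨ +-monoʳ-≤ _ (*-mono-≤ n≤2Km n≤2Km) ⟩
        4 * D * (d * d) * Φ γ′ + 2 * K * m * (2 * K * m)
          ≡⟨ cong (4 * D * (d * d) * Φ γ′ +_) (l₁ K m) ⟩
        4 * D * (d * d) * Φ γ′ + 4 * (m * m) * (K * K)
          ≤⟨ +-monoʳ-≤ (4 * D * (d * d) * Φ γ′) (*-monoʳ-≤ (4 * (m * m)) (<⇒≤ h)) ⟩
        4 * D * (d * d) * Φ γ′ + 4 * (m * m) * (D * irregular-count)
          ≡⟨ l₂ D d (Φ γ′) m irregular-count ⟩
        4 * D * (d * d * Φ γ′ + m * m * irregular-count)
          ≤⟨ *-monoʳ-≤ (4 * D) potential-gain ⟩
        4 * D * (d * d * Φ γ)
          ≡⟨ sym (*-assoc (4 * D) (d * d) (Φ γ)) ⟩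
        4 * D * (d * d) * Φ γ ∎
        where
        l₁ : ∀ K m → 2 * K * m * (2 * K * m) ≡ 4 * (m * m) * (K * K)
        l₁ = solve-∀
        l₂ : ∀ D d p m c → 4 * D * (d * d) * p + 4 * (m * m) * (D * c) ≡ 4 * D * (d * d * p + m * m * c)
        l₂ = solve-∀

    refine : ∀ {N M} (σ : State (suc N) M) → refine-ratio Z M ≤ State.m σ →
      State.K σ * State.K σ < D * Facts.irregular-count σ → State N (2 * refine-ratio Z M * M)
    refine {N} {M} σ r≤m dense
      with 0<t , rt≤m , m≤2rt ← quotient-bounds (State.m σ) (refine-ratio Z M) r≤m
      with q , Q , rest ← chop (Facts.key σ) (State.m σ / refine-ratio Z M) 0<t (λ u → not (block (State.lab σ) zero u))
      = record
        { lab     = Packing.lab Q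
        ; γ       = γ′
        ; size    = Packing.size Q
        ; within  = λ p p' → let _ , eq = nonzero p in within eq (trans (sym (key-lab (same p p'))) eq)
        ; const   = λ p p' q q' → let _ , eu = nonzero p ; _ , ev = nonzero q in γ′-cong (same p p') (same q q')
            (const eu (trans (sym (key-lab (same p p'))) eu) ev (trans (sym (key-lab (same q q'))) ev))
        ; n≤M*m   = begin
            n                    ≤⟨ n≤M*m ⟩
            M * m                ≤⟨ *-monoʳ-≤ M m≤2rt ⟩
            M * (2 * r * t)      ≡⟨ l₁ M (2 * r) t ⟩
            2 * r * M * t        ∎
        ; m-small = ≤-trans (*-monoʳ-≤ (2 * κ₀) (≤-trans (m≤n*m t r) rt≤m)) m-small
        ; small   = begin
            Z * countF (block (Packing.lab Q) zero) + N * n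
              ≤⟨ +-monoˡ-≤ (N * n) (*-monoʳ-≤ Z (≤-trans (unpacked lab (Packing.lab Q)) (+-monoʳ-≤ v₀ rest))) ⟩
            Z * (v₀ + atoms K * t) + N * n
              ≤⟨ +-monoˡ-≤ (N * n) (*-monoʳ-≤ Z (+-monoʳ-≤ v₀ (*-monoˡ-≤ t (atoms-mono K≤M)))) ⟩
            Z * (v₀ + atoms M * t) + N * n
              ≡⟨ l₂ Z v₀ (atoms M) t (N * n) ⟩
            Z * v₀ + (atoms M * Z * t + N * n)
              ≤⟨ +-monoʳ-≤ (Z * v₀) (+-monoˡ-≤ (N * n) (≤-trans (m≤n+m (atoms M * Z * t) t) (≤-trans rt≤m m≤n))) ⟩
            Z * v₀ + (n + N * n)
              ≤⟨ small ⟩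
            suc N₀ * n ∎
        ; energy  = +-cancelʳ-≤ (n * n) _ _ (begin
            4 * D * (d * d) * Φ γ′ + n * n ≤⟨ energy-drop dense ⟩
            4 * D * (d * d) * Φ γ          ≤⟨ energy ⟩
            n * n + N * (n * n)            ≡⟨ +-comm (n * n) (N * (n * n)) ⟩
            N * (n * n) + n * n            ∎)
        }
      where
      open State σ
      open Facts σ
      open ≤-Reasoning
      r t : ℕ
      r = refine-ratio Z M
      t = m / r
      same : ∀ {u u' i} → Packing.lab Q u ≡ suc i → Packing.lab Q u' ≡ suc i → key u ≡ key u'
      same {u} {u'} {i} p p' = let j , mono = Packing.good Q i
        in trans (mono u (≟-complete p)) (sym (mono u' (≟-complete p')))
      nonzero : ∀ {u i} → Packing.lab Q u ≡ suc i → ∃ λ j → lab u ≡ suc j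
      nonzero {u} p with lab u | Packing.inside Q p
      ... | suc j | _ = j , refl
      l₁ : ∀ M r t → M * (r * t) ≡ r * M * t
      l₁ = solve-∀
      l₂ : ∀ Z v A t x → Z * (v + A * t) + x ≡ Z * v + (A * Z * t + x)
      l₂ = solve-∀

    regularise : ∀ N M → tower Z N M ≤ n → State N M → RegularPartition a s d D z κ₀ (tower Z N M) P
    regularise N M M≤n σ with D * Facts.irregular-count σ ≤? State.K σ * State.K σ
    ... | yes few = record
      { lab     = lab
      ; size    = size
      ; κ₀≤K    = κ₀≤K
      ; K≤M     = ≤-trans K≤M (M≤tower Z N M)
      ; n≤M*m   = ≤-trans n≤M*m (*-monoˡ-≤ m (M≤tower Z N M))
      ; small   = ≤-trans (*-monoˡ-≤ v₀ (m≤n+m z 2)) small′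
      ; within  = within
      ; irr     = irr
      ; few-irr = few
      ; regular = not-irr⇒regular size 0<m const
      }
      where
      open State σ
      open Facts σ
    -- No energy is left, whereas another drop would need the positive amount `n * n`.
    regularise zero M M≤n σ | no dense = ⊥-elim (<⇒≱ (*-mono-< 0<n 0<n)
      (≤-trans (m≤n+m (n * n) _) (≤-trans (Facts.energy-drop σ (≰⇒> dense)) (State.energy σ))))
    regularise (suc N) M M≤n σ | no dense = regularise N (2 * r * M) M≤n (refine σ r≤m (≰⇒> dense))
      where
      open State σ
      open Facts σ
      open ≤-Reasoning
      r : ℕ
      r = refine-ratio Z M
      0<M : 0 < M
      0<M = n≢0⇒n>0 λ { refl → n≮0 (≤-trans 0<n n≤M*m) }
      -- The tower bound provides classes large enough to be cut once more, as 2 r M ≤ n ≤ M m.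
      r≤m : r ≤ m
      r≤m = ≤-trans (m≤m+n r (r + 0)) (*-cancelʳ-≤ (2 * r) m M {{>-nonZero 0<M}} (begin
        2 * r * M                ≤⟨ M≤tower Z N (2 * r * M) ⟩
        tower Z N (2 * r * M)    ≤⟨ M≤n ⟩
        n                        ≤⟨ n≤M*m ⟩
        M * m                    ≡⟨ *-comm M m ⟩
        m * M                    ∎))

  -- From γ = 0 the potential starts at no more than s² n², and a round lowers it by at least n² /
  -- (4 D d²).
  regularity-steps : ℕ → ℕ → ℕ → ℕ
  regularity-steps s d D = 4 * D * (d * d) * (s * s)

  regularity-bound : (s d D z κ₀ k : ℕ) → ℕ
  regularity-bound s d D z κ₀ k = tower Z N₀ (2 * suc (k * Z + 2 * κ₀))
    where
    N₀ Z : ℕ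
    N₀ = regularity-steps s d D
    Z = (2 + z) * suc N₀

  -- The potential is the squared distance of s · edge a from a function γ that is constant
  -- on pairs of classes; moving γ by one on the witness of an irregular pair decreases it,
  -- and, unlike the index of a partition, it does not change when classes are cut up.
  regularity-lemma : ∀ s d D z κ₀ {k n} (a : Fin n → Fin n → Bool) (P : Fin n → Fin k) →
    regularity-bound s d D z κ₀ k ≤ n → RegularPartition a s d D z κ₀ (regularity-bound s d D z κ₀ k) P
  regularity-lemma s d D z κ₀ {k} {n} a P n₀≤n
    = regularise N₀ (2 * suc q₀) n₀≤n initial
    where
    open ≤-Reasoning
    N₀ q₀ : ℕ
    N₀ = regularity-steps s d D
    -- The first summand limits the leftover of the initial cutting; the second makes the pieces so
    -- small that at least `κ₀` of them appear.
    q₀ = k * ((2 + z) * suc N₀) + 2 * κ₀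
    r≤n : suc q₀ ≤ n
    r≤n = ≤-trans (m≤m+n (suc q₀) _) (≤-trans (M≤tower ((2 + z) * suc N₀) N₀ (2 * suc q₀)) n₀≤n)
    open Regularise a s d D z κ₀ P N₀ (≤-trans z<s r≤n)
    open Potential a s
    Φ₀ : Φ (λ _ _ → 0) ≤ s * s * (n * n)
    Φ₀ = begin
      Φ (λ _ _ → 0)                     ≤⟨ sum-mono (λ u → sum-mono (λ v → pointwise (a u v))) ⟩
      sumF {n} (λ u → sumF {n} (λ v → s * s)) ≡⟨ sum-cong {n} (λ u → sum-const n (s * s)) ⟩
      sumF {n} (λ u → n * (s * s))      ≡⟨ sum-const n (n * (s * s)) ⟩
      n * (n * (s * s))                 ≡⟨ lem n (s * s) ⟩
      s * s * (n * n)                   ∎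
      where
      lem : ∀ n x → n * (n * x) ≡ x * (n * n)
      lem = solve-∀
      pointwise : ∀ b → sq (s * ι b) 0 ≤ s * s
      pointwise b = ≤-trans (≤-reflexive (sq-0 (s * ι b))) (*-mono-≤ le le)
        where
        le : s * ι b ≤ s
        le = ≤-trans (*-monoʳ-≤ s (ι≤1 b)) (≤-reflexive (*-identityʳ s))
    initial : State N₀ (2 * suc q₀)
    initial
      with 0<t , rt≤n , n≤2rt ← quotient-bounds n (suc q₀) r≤n
      with q , Q , rest ← chop P (n / suc q₀) 0<t (λ _ → true)
      = record
        { lab     = Packing.lab Q
        ; γ       = λ _ _ → 0
        ; size    = Packing.size Q
        ; within  = λ {u} {u'} {i} p p' → let j , mono = Packing.good Q i
                      in trans (mono u (≟-complete p)) (sym (mono u' (≟-complete p')))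
        ; const   = λ _ _ _ _ → refl
        ; n≤M*m   = n≤2rt
        ; m-small = ≤-trans (*-monoˡ-≤ (n / suc q₀) (≤-trans (m≤n+m (2 * κ₀) (k * Z)) (n≤1+n q₀))) rt≤n
        ; small   = +-monoˡ-≤ (N₀ * n) (begin
            Z * countF (block (Packing.lab Q) zero)    ≤⟨ *-monoʳ-≤ Z rest ⟩
            Z * (k * (n / suc q₀))                     ≡⟨ lem Z k (n / suc q₀) ⟩
            k * Z * (n / suc q₀)                       ≤⟨ *-monoˡ-≤ (n / suc q₀) (≤-trans (m≤m+n (k * Z) (2 * κ₀)) (n≤1+n q₀)) ⟩
            suc q₀ * (n / suc q₀)                      ≤⟨ rt≤n ⟩
            n                                          ∎)
        ; energy  = begin
            4 * D * (d * d) * Φ (λ _ _ → 0)            ≤⟨ *-monoʳ-≤ (4 * D * (d * d)) Φ₀ ⟩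
            4 * D * (d * d) * (s * s * (n * n))        ≡⟨ sym (*-assoc (4 * D * (d * d)) (s * s) (n * n)) ⟩
            N₀ * (n * n)                               ∎
        }
      where
      lem : ∀ Z k t → Z * (k * t) ≡ k * Z * t
      lem = solve-∀

  -- From a regular partition to one with homogeneous classes

  -- Counting through pairs of vertices makes bad pairs of pieces comparable with irregular pairs of
  -- classes, although the two labellings differ.
  sum-lift : ∀ {n q t} (lab : Fin n → Fin (suc q)) → (∀ i → countF (block lab (suc i)) ≡ t) →
    ∀ g → sumF (λ u → sumF (λ v → lift g (lab u) (lab v))) ≡ t * t * sumF (λ i → sumF (g i))
  sum-lift {n} {q} {t} lab size g = begin
    sumF (λ u → sumF (λ v → lift g (lab u) (lab v)))
      ≡⟨ E-blocks lab (λ u v → lift g (lab u) (lab v)) ⟩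
    sumF (λ i → sumF (λ j → E (λ u v → lift g (lab u) (lab v)) (block lab i) (block lab j)))
      ≡⟨ sum-cong (λ i → sum-cong (λ j → trans
           (E-cong {X = block lab i} {block lab j} (λ u v p q → cong₂ (lift g) (≟-sound p) (≟-sound q)))
           (trans (E-const (lift g i j) (block lab i) (block lab j)) (sizes i j)))) ⟩
    sumF (λ i → sumF (λ j → t * t * lift g i j))
      ≡⟨ cong (_+ sumF (λ i → sumF (λ j → t * t * lift g (suc i) j)))
           (trans (sum-cong {suc q} (λ j → *-zeroʳ (t * t))) (sum-zero (suc q))) ⟩
    sumF (λ i → sumF (λ j → t * t * lift g (suc i) j))
      ≡⟨ sum-cong (λ i → cong (_+ sumF (λ j → t * t * g i j)) (*-zeroʳ (t * t))) ⟩
    sumF (λ i → sumF (λ j → t * t * g i j))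
      ≡⟨ trans (sum-cong (λ i → sum-*ˡ (t * t) (g i))) (sum-*ˡ (t * t) (λ i → sumF (g i))) ⟩
    t * t * sumF (λ i → sumF (g i)) ∎
    where
    open ≡-Reasoning
    sizes : ∀ i j → lift g i j * (countF (block lab i) * countF (block lab j)) ≡ t * t * lift g i j
    sizes (suc i) (suc j) = trans (cong₂ (λ x y → g i j * (x * y)) (size i) (size j)) (*-comm (g i j) (t * t))
    sizes (suc i) zero    = sym (*-zeroʳ (t * t))
    sizes zero    j       = sym (*-zeroʳ (t * t))

  -- A piece keeps its vertices, while the second labelling, which lives on the leftover, hands out
  -- the additional ones.
  merge : ∀ {q} → Fin (suc q) → Fin (suc q) → Fin (suc q)
  merge zero    j = j
  merge (suc i) j = suc i

  ι-merge : ∀ {q} (i j : Fin (suc q)) k → (∀ {l} → j ≡ suc l → i ≡ zero) →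
    ι ⌊ merge i j ≟ suc k ⌋ ≡ ι ⌊ i ≟ suc k ⌋ + ι ⌊ j ≟ suc k ⌋
  ι-merge zero    j       k h = refl
  ι-merge (suc i) zero    k h = sym (+-identityʳ _)
  ι-merge (suc i) (suc j) k h with () ← h refl

  private
    -- The piece accounts for 2 of 8 shares of w (w - 1), and the edges at the `c` added vertices
    -- for 4, since `suc t' ≤ 2 * t'`.
    sparse-arith : ∀ s t' c eP eW → 1 ≤ t' → 8 * s * c ≤ suc t' → 8 * s * eP ≤ 2 * (suc t' * t') →
      eW ≤ eP + 2 * (c * suc (t' + c)) → s * eW < suc (t' + c) * (t' + c)
    sparse-arith s t' c eP eW 1≤t' hc hP hW = *-cancelˡ-< 8 _ _ (begin-strict
      8 * (s * eW)                                        ≡⟨ sym (*-assoc 8 s eW) ⟩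
      8 * s * eW                                          ≤⟨ *-monoʳ-≤ (8 * s) hW ⟩
      8 * s * (eP + 2 * (c * w))                          ≡⟨ l₁ (8 * s) eP c w ⟩
      8 * s * eP + 2 * (8 * s * c * w)                    ≤⟨ +-mono-≤ hP (*-monoʳ-≤ 2 (*-monoˡ-≤ w hc)) ⟩
      2 * (suc t' * t') + 2 * (suc t' * w)                ≤⟨ +-mono-≤
          (*-monoʳ-≤ 2 (*-mono-≤ (s≤s (m≤m+n t' c)) (m≤m+n t' c)))
          (*-monoʳ-≤ 2 (*-monoˡ-≤ w (≤-trans (+-monoˡ-≤ t' 1≤t') (+-mono-≤ (m≤m+n t' c) (m≤m+n t' c))))) ⟩
      2 * (w * w') + 2 * ((w' + w') * w)                  ≡⟨ l₂ w w' ⟩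
      6 * (w * w')                                        <⟨ *-monoˡ-< (w * w')
          {{m*n≢0 w w' {{_}} {{>-nonZero (≤-trans 1≤t' (m≤m+n t' c))}}}}
          {6} {8} (m≤m+n 7 1) ⟩
      8 * (w * w')                                        ∎)
      where
      open ≤-Reasoning
      w w' : ℕ
      w' = t' + c
      w = suc w'
      l₁ : ∀ s e c w → s * (e + 2 * (c * w)) ≡ s * e + 2 * (s * c * w)
      l₁ = solve-∀
      l₂ : ∀ w v → 2 * (w * v) + 2 * ((v + v) * w) ≡ 6 * (w * v)
      l₂ = solve-∀

  sparse-with-extras : ∀ {n} (a : Fin n → Fin n → Bool) s t' c (P X W : Fin n → Bool) →
    (∀ u → ι (W u) ≡ ι (P u) + ι (X u)) → countF P ≡ suc t' → countF X ≡ c → 1 ≤ t' → 8 * s * c ≤ suc t' →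
    8 * s * E (edge a) P P ≤ 2 * (suc t' * t') → s * E (edge a) W W < suc (t' + c) * (t' + c)
  sparse-with-extras a s t' c P X W split P-size X-size 1≤t' hc hP =
    sparse-arith s t' c (E (edge a) P P) (E (edge a) W W) 1≤t' hc hP (begin
      E w W W                             ≡⟨ E-splitˡ w {W} {P} {X} W split ⟩
      E w P W + E w X W                   ≡⟨ cong (_+ E w X W) (E-splitʳ w P {W} {P} {X} split) ⟩
      E w P P + E w P X + E w X W         ≤⟨ +-mono-≤ (+-monoʳ-≤ (E w P P) (E-edge≤ a P X)) (E-edge≤ a X W) ⟩
      E w P P + countF P * countF X + countF X * countF W
        ≡⟨ cong₂ (λ x y → E w P P + x + y) (cong₂ _*_ P-size X-size) (cong₂ _*_ X-size W-size) ⟩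
      E w P P + suc t' * c + c * suc (t' + c)
        ≤⟨ +-monoˡ-≤ (c * suc (t' + c)) (+-monoʳ-≤ (E w P P) (*-monoˡ-≤ c (s≤s (m≤m+n t' c)))) ⟩
      E w P P + suc (t' + c) * c + c * suc (t' + c) ≡⟨ lem (E w P P) (suc (t' + c)) c ⟩
      E w P P + 2 * (c * suc (t' + c)) ∎)
    where
    open ≤-Reasoning
    w = edge a
    W-size : countF W ≡ suc (t' + c)
    W-size = trans (trans (sum-cong split) (sum-+ (ι ∘ P) (ι ∘ X))) (cong₂ _+_ P-size X-size)
    lem : ∀ e w c → e + w * c + c * w ≡ e + 2 * (c * w)
    lem = solve-∀

  private
    -- Each side loses at most the proportion 1 / (2 (s + 2)), so the product loses at most 1 / (s +
    -- 2) of itself.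
    product-gap : ∀ s x x' y y' c → x' ≤ x → x ≤ x' + c → y ≤ y' + c →
      2 * (s + 2) * c ≤ x → 2 * (s + 2) * c ≤ y → (s + 2) * (x * y) ≤ (s + 2) * (x' * y') + x * y
    product-gap s x x' y y' c x'≤x x≤ y≤ cx cy = *-cancelˡ-≤ 2 (begin
      2 * ((s + 2) * (x * y))                            ≡⟨ l₀ (s + 2) x y ⟩
      h * (x * y)                                        ≤⟨ *-monoʳ-≤ h (*-monoˡ-≤ y x≤) ⟩
      h * ((x' + c) * y)                                 ≡⟨ l₁ h x' c y ⟩
      h * (x' * y) + h * c * y                           ≤⟨ +-monoˡ-≤ (h * c * y) (*-monoʳ-≤ h (*-monoʳ-≤ x' y≤)) ⟩
      h * (x' * (y' + c)) + h * c * y                    ≡⟨ l₂ h x' y' c y ⟩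
      h * (x' * y') + (x' * (h * c) + h * c * y)
        ≤⟨ +-monoʳ-≤ (h * (x' * y')) (+-mono-≤ (*-mono-≤ x'≤x cy) (*-monoˡ-≤ y cx)) ⟩
      h * (x' * y') + (x * y + x * y)                    ≡⟨ l₃ (s + 2) x' y' x y ⟩
      2 * ((s + 2) * (x' * y') + x * y)                  ∎)
      where
      open ≤-Reasoning
      h : ℕ
      h = 2 * (s + 2)
      l₀ : ∀ s x y → 2 * (s * (x * y)) ≡ 2 * s * (x * y)
      l₀ = solve-∀
      l₁ : ∀ h x c y → h * ((x + c) * y) ≡ h * (x * y) + h * c * y
      l₁ = solve-∀
      l₂ : ∀ h x y' c y → h * (x * (y' + c)) + h * c * y ≡ h * (x * y') + (x * (h * c) + h * c * y)
      l₂ = solve-∀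
      l₃ : ∀ s x' y' x y → 2 * s * (x' * y') + (x * y + x * y) ≡ 2 * (s * (x' * y') + x * y)
      l₃ = solve-∀

    -- Passing from the inner rectangle to the outer one adds so few pairs that the density shifts
    -- by at most one unit, whence 3 in place of 2.
    deviation : ∀ s k e e' R R' → 0 < R' → R' ≤ R → (s + 2) * R ≤ (s + 2) * R' + R →
      e' ≤ e → e + R' ≤ e' + R → e' ≤ R' → s * e' ≤ (k + 2) * R' → k * R' ≤ s * e' + 2 * R' →
      s * e ≤ (k + 3) * R × k * R ≤ s * e + 3 * R
    deviation s k e e' R R' 0<R' R'≤R gap e'≤e e≤ e'≤R' upper lower
      with δ , refl ← m≤n⇒∃[o]m+o≡n R'≤R = (begin
        s * e                              ≤⟨ *-monoʳ-≤ s e≤′ ⟩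
        s * (e' + δ)                       ≡⟨ *-distribˡ-+ s e' δ ⟩
        s * e' + s * δ                     ≤⟨ +-mono-≤ upper (≤-trans (*-monoˡ-≤ δ (m≤m+n s 2)) δ≤) ⟩
        (k + 2) * R' + (R' + δ)            ≤⟨ +-monoˡ-≤ (R' + δ) (*-monoʳ-≤ (k + 2) R'≤R) ⟩
        (k + 2) * (R' + δ) + (R' + δ)      ≡⟨ l₁ k (R' + δ) ⟩
        (k + 3) * (R' + δ)                 ∎) , (begin
        k * (R' + δ)                       ≡⟨ *-distribˡ-+ k R' δ ⟩
        k * R' + k * δ                     ≤⟨ +-mono-≤ lower (≤-trans (*-monoˡ-≤ δ k≤) δ≤) ⟩
        s * e' + 2 * R' + (R' + δ)         ≤⟨ +-monoˡ-≤ (R' + δ) (+-mono-≤ (*-monoʳ-≤ s e'≤e) (*-monoʳ-≤ 2 R'≤R)) ⟩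
        s * e + 2 * (R' + δ) + (R' + δ)    ≡⟨ l₂ (s * e) (R' + δ) ⟩
        s * e + 3 * (R' + δ)               ∎)
      where
      open ≤-Reasoning
      l₁ : ∀ k R → (k + 2) * R + R ≡ (k + 3) * R
      l₁ = solve-∀
      l₂ : ∀ x R → x + 2 * R + R ≡ x + 3 * R
      l₂ = solve-∀
      l₃ : ∀ s R → s * R + 2 * R ≡ (s + 2) * R
      l₃ = solve-∀
      l₄ : ∀ e R δ → e + (R + δ) ≡ e + δ + R
      l₄ = solve-∀
      δ≤ : (s + 2) * δ ≤ R' + δ
      δ≤ = +-cancelˡ-≤ ((s + 2) * R') _ _ (≤-trans (≤-reflexive (sym (*-distribˡ-+ (s + 2) R' δ))) gap)
      e≤′ : e ≤ e' + δ
      e≤′ = +-cancelʳ-≤ R' _ _ (≤-trans e≤ (≤-reflexive (l₄ e' R' δ)))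
      -- A density is at most 1, so its approximation k / s is at most 1 + 2 / s.
      k≤ : k ≤ s + 2
      k≤ = *-cancelʳ-≤ k (s + 2) R' {{>-nonZero 0<R'}} (≤-trans lower
        (≤-trans (+-monoˡ-≤ (2 * R') (*-monoʳ-≤ s e'≤R')) (≤-reflexive (l₃ s R'))))

  -- A large subset of a piece is compared with its part inside the original class, to which
  -- regularity applies. It may be only 1 / s of its piece, which explains the factor `s` in the
  -- bound on the number of added vertices.
  regular-inherit : ∀ {n} (a : Fin n → Fin n → Bool) σ s B m t c {A A' P P' X X' W W' : Fin n → Bool} →
    Regular a σ (4 * s * B) A A' → 0 < m → countF A ≡ m → countF A' ≡ m → m ≤ 2 * B * t → s * (2 * (σ + 2)) * c ≤ t →
    .{{_ : NonZero s}} →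
    P ⊑ A → P' ⊑ A' → countF P ≡ t → countF P' ≡ t → countF X ≡ c → countF X' ≡ c →
    (∀ u → ι (W u) ≡ ι (P u) + ι (X u)) → (∀ u → ι (W' u) ≡ ι (P' u) + ι (X' u)) →
    ∃ λ k → ∀ Y Y' → Y ⊑ W → Y' ⊑ W' → t + c ≤ s * countF Y → t + c ≤ s * countF Y' →
      σ * E (edge a) Y Y' ≤ (k + 3) * (countF Y * countF Y') ×
      k * (countF Y * countF Y') ≤ σ * E (edge a) Y Y' + 3 * (countF Y * countF Y')
  regular-inherit {n} a σ s B m t c {A} {A'} {P} {P'} {X} {X'} {W} {W'} (k , reg) 0<m A-size A'-size m≤ c≤
    P⊑A P'⊑A' P-size P'-size X-size X'-size split split' = k , bounds
    where
    open ≤-Reasoning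
    module Side {P X W : Fin n → Bool} (X-size : countF X ≡ c)
                (split : ∀ u → ι (W u) ≡ ι (P u) + ι (X u)) {Y : Fin n → Bool} (Y⊑W : Y ⊑ W) (Y≥ : t + c ≤ s * countF Y) where
      Y₀ : Fin n → Bool
      Y₀ u = Y u ∧ P u
      h y y₀ : ℕ
      h = 2 * (σ + 2)
      y = countF Y
      y₀ = countF Y₀
      Y₀⊑Y : Y₀ ⊑ Y
      Y₀⊑Y u = proj₁ ∘ ∧-true
      y≤ : y ≤ y₀ + c
      y≤ = ≤-trans (≤-reflexive (count-split Y P))
        (+-monoʳ-≤ y₀ (≤-trans (count-mono {X = Y ∖ P} {X} extra) (≤-reflexive X-size)))
        where
        extra : (Y ∖ P) ⊑ X
        extra u p with X u | P u | W u | split u | Y u | Y⊑W u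
        ... | true  | _     | _     | _  | _     | _ = refl
        extra u () | false | true | _ | _ | true | _
        extra u () | false | true | _ | _ | false | _
        extra u p  | false | false | false | eq | true | f with () ← f refl
      c≤y : h * c ≤ y
      c≤y = *-cancelˡ-≤ s (begin
        s * (h * c)   ≡⟨ sym (*-assoc s h c) ⟩
        s * h * c     ≤⟨ c≤ ⟩
        t             ≤⟨ m≤m+n t c ⟩
        t + c         ≤⟨ Y≥ ⟩
        s * y         ∎)
      y≤2y₀ : y ≤ 2 * y₀
      y≤2y₀ = +-cancelˡ-≤ y _ _ (begin
        y + y                  ≤⟨ +-mono-≤ y≤ y≤ ⟩
        y₀ + c + (y₀ + c)      ≡⟨ lem y₀ c ⟩
        2 * c + 2 * y₀         ≤⟨ +-monoˡ-≤ (2 * y₀) (*-monoˡ-≤ c (*-monoʳ-≤ 2 {1} (≤-trans (s≤s z≤n) (m≤n+m 2 σ)))) ⟩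
        h * c + 2 * y₀         ≤⟨ +-monoˡ-≤ (2 * y₀) c≤y ⟩
        y + 2 * y₀             ∎)
        where
        lem : ∀ y c → y + c + (y + c) ≡ 2 * c + 2 * y
        lem = solve-∀
      -- The threshold of the class pair arises here: 2 B from the size of a piece, s from the size
      -- of the subset, 2 from discarding the added vertices.
      large : m ≤ 4 * s * B * y₀
      large = begin
        m                         ≤⟨ m≤ ⟩
        2 * B * t                 ≤⟨ *-monoʳ-≤ (2 * B) (≤-trans (m≤m+n t c) Y≥) ⟩
        2 * B * (s * y)           ≤⟨ *-monoʳ-≤ (2 * B) (*-monoʳ-≤ s y≤2y₀) ⟩
        2 * B * (s * (2 * y₀))    ≡⟨ lem B s y₀ ⟩
        4 * s * B * y₀            ∎
        where
        lem : ∀ B s y → 2 * B * (s * (2 * y)) ≡ 4 * s * B * y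
        lem = solve-∀
      0<y₀ : 0 < y₀
      0<y₀ = n≢0⇒n>0 λ eq → n≮0 (≤-trans 0<m (subst (m ≤_) (trans (cong (4 * s * B *_) eq) (*-zeroʳ (4 * s * B))) large))
    bounds : ∀ Y Y' → Y ⊑ W → Y' ⊑ W' → t + c ≤ s * countF Y → t + c ≤ s * countF Y' →
      σ * E (edge a) Y Y' ≤ (k + 3) * (countF Y * countF Y') ×
      k * (countF Y * countF Y') ≤ σ * E (edge a) Y Y' + 3 * (countF Y * countF Y')
    bounds Y Y' Y⊑ Y'⊑ Y≥ Y'≥ = deviation σ k (E (edge a) Y Y') (E (edge a) S.Y₀ S'.Y₀) (S.y * S'.y) (S.y₀ * S'.y₀)
        (*-mono-< S.0<y₀ S'.0<y₀) (*-mono-≤ (count-mono S.Y₀⊑Y) (count-mono S'.Y₀⊑Y))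
        (product-gap σ S.y S.y₀ S'.y S'.y₀ c (count-mono S.Y₀⊑Y) S.y≤ S'.y≤ S.c≤y S'.c≤y)
        (E-⊑ (edge a) S.Y₀⊑Y S'.Y₀⊑Y) (E-loss a S.Y₀⊑Y S'.Y₀⊑Y) (E-edge≤ a S.Y₀ S'.Y₀)
        (proj₁ inner) (proj₂ inner)
      where
      module S = Side {P} X-size split Y⊑ Y≥
      module S' = Side {P'} X'-size split' Y'⊑ Y'≥
      inner = reg S.Y₀ S'.Y₀ (λ u p → P⊑A u (proj₂ (∧-true {Y u} p))) (λ u p → P'⊑A' u (proj₂ (∧-true {Y' u} p)))
        (subst (_≤ 4 * s * B * S.y₀) (sym A-size) S.large) (subst (_≤ 4 * s * B * S'.y₀) (sym A'-size) S'.large)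

  -- The parameters needed for the final density bound 1 / s: vertices added to a piece
  -- make up at most the fraction 1 / spread s of it, and all but the fraction 1 / scale s of
  -- each class is covered by pieces of relative size about 1 / cut s r.
  spread scale : ℕ → ℕ
  spread s = s * (2 * (7 * s + 2))
  scale s  = 2 * spread s + 2

  -- Pieces are taken from what remains of a class, possibly just 1 / `scale s` of it. Hence `cut`
  -- multiplies the loss of the descent by `scale s`, and `cliqueConst` contains its `r`-th power.
  cut cliqueConst : ℕ → ℕ → ℕ
  cut s r         = scale s * (2 * (8 * s)) ^ r
  cliqueConst s r = scale s ^ r * sparseX (8 * s) r

  -- Everything is free of division: `uniform` bounds a difference of densities by 1 / s after
  -- multiplication by `s * R * R'`, and `homogeneous` compares ordered pairs, twice the number of
  -- edges, with twice a binomial coefficient.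
  record HomogeneousPartition {n} (a ā : Fin n → Fin n → Bool) (s K L : ℕ) : Set where
    field
      {q w}   : ℕ
      lab     : Fin n → Fin (suc q)
      size    : ∀ i → countF (block lab (suc i)) ≡ suc w
      rest    : countF (block lab zero) < q
      K≤q     : K ≤ q
      q≤L     : q ≤ L
      bad     : Fin q → Fin q → Bool
      few-bad : s * (sumF λ i → sumF λ j → ι (bad i j)) ≤ q * q
      uniform : ∀ {i j} → bad i j ≡ false → ∀ X Y → X ⊑ block lab (suc i) → Y ⊑ block lab (suc j) →
        suc w ≤ s * countF X → suc w ≤ s * countF Y →
        let e = E (edge a) X Y ; e' = E (edge a) (block lab (suc i)) (block lab (suc j))
            R = countF X * countF Y ; R' = suc w * suc w in
        0 < R × s * e * R' < s * e' * R + R * R' × s * e' * R < s * e * R' + R * R'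
      homogeneous : ∀ i → s * E (edge a) (block lab (suc i)) (block lab (suc i)) < suc w * w
        ⊎ s * E (edge ā) (block lab (suc i)) (block lab (suc i)) < suc w * w

  private
    -- Both densities lie within 3 units of the same k, so they differ by at most 6 units of 1 / (7
    -- s).
    density-arith : ∀ s k e e' R R' → 0 < R → 0 < R' → 7 * s * e ≤ (k + 3) * R → k * R' ≤ 7 * s * e' + 3 * R' →
      s * e * R' < s * e' * R + R * R'
    density-arith s k e e' R R' 0<R 0<R' h h' = *-cancelˡ-< 7 _ _ (begin-strict
      7 * (s * e * R')                    ≡⟨ l₁ s e R' ⟩
      7 * s * e * R'                      ≤⟨ *-monoˡ-≤ R' h ⟩
      (k + 3) * R * R'                    ≡⟨ l₂ k R R' ⟩
      R * (k * R') + 3 * (R * R')         ≤⟨ +-monoˡ-≤ (3 * (R * R')) (*-monoʳ-≤ R h') ⟩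
      R * (7 * s * e' + 3 * R') + 3 * (R * R') ≡⟨ l₃ R s e' R' ⟩
      7 * (s * e' * R) + 6 * (R * R')
        <⟨ +-monoʳ-< (7 * (s * e' * R)) (*-monoˡ-< (R * R') {{>-nonZero (*-mono-< 0<R 0<R')}} {6} {7} ≤-refl) ⟩
      7 * (s * e' * R) + 7 * (R * R')     ≡⟨ sym (*-distribˡ-+ 7 (s * e' * R) (R * R')) ⟩
      7 * (s * e' * R + R * R')           ∎)
      where
      open ≤-Reasoning
      l₁ : ∀ s e R → 7 * (s * e * R) ≡ 7 * s * e * R
      l₁ = solve-∀
      l₂ : ∀ k R R' → (k + 3) * R * R' ≡ R * (k * R') + 3 * (R * R')
      l₂ = solve-∀
      l₃ : ∀ R s e R' → R * (7 * s * e + 3 * R') + 3 * (R * R') ≡ 7 * (s * e * R) + 6 * (R * R')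
      l₃ = solve-∀

    large⇒0< : ∀ {m} d x → 0 < m → m ≤ d * x → 0 < x
    large⇒0< {m} d zero 0<m h = ⊥-elim (n≮0 (≤-trans 0<m (subst (m ≤_) (*-zeroʳ d) h)))
    large⇒0< d (suc x) 0<m h  = z<s

    covered : ∀ y n ρ p → n ≡ ρ + p → (2 * y + 2) * ρ ≤ 2 * n → 2 * y * n ≤ (2 * y + 2) * p
    covered y n ρ p eq h = +-cancelʳ-≤ (2 * n) _ _ (begin
      2 * y * n + 2 * n                        ≡⟨ sym (*-distribʳ-+ n (2 * y) 2) ⟩
      (2 * y + 2) * n                          ≡⟨ cong ((2 * y + 2) *_) eq ⟩
      (2 * y + 2) * (ρ + p)                    ≡⟨ *-distribˡ-+ (2 * y + 2) ρ p ⟩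
      (2 * y + 2) * ρ + (2 * y + 2) * p        ≤⟨ +-monoˡ-≤ ((2 * y + 2) * p) h ⟩
      2 * n + (2 * y + 2) * p                  ≡⟨ +-comm (2 * n) _ ⟩
      (2 * y + 2) * p + 2 * n                  ∎)
      where open ≤-Reasoning

    -- With `scale` equal to 2 y + 2 the leftover is at most n / (y + 1), that is, 1 / y of what the
    -- pieces cover; shared equally it enlarges each by at most 1 / y.
    extras-small : ∀ y n ρ q t c → .{{_ : NonZero q}} → q * c ≤ ρ → (2 * y + 2) * ρ ≤ 2 * n →
      2 * y * n ≤ (2 * y + 2) * (q * t) → y * c ≤ t
    extras-small y n ρ q t c qc≤ h h' = *-cancelˡ-≤ q
      (*-cancelˡ-≤ (2 * y + 2) {{>-nonZero (≤-trans (s≤s z≤n) (m≤n+m 2 (2 * y)))}} (begin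
      (2 * y + 2) * (q * (y * c))      ≡⟨ l₁ y q c ⟩
      y * ((2 * y + 2) * (q * c))      ≤⟨ *-monoʳ-≤ y (*-monoʳ-≤ (2 * y + 2) qc≤) ⟩
      y * ((2 * y + 2) * ρ)            ≤⟨ *-monoʳ-≤ y h ⟩
      y * (2 * n)                      ≡⟨ l₂ y n ⟩
      2 * y * n                        ≤⟨ h' ⟩
      (2 * y + 2) * (q * t)            ∎))
      where
      open ≤-Reasoning
      l₁ : ∀ y q c → (2 * y + 2) * (q * (y * c)) ≡ y * ((2 * y + 2) * (q * c))
      l₁ = solve-∀
      l₂ : ∀ y n → y * (2 * n) ≡ 2 * y * n
      l₂ = solve-∀

    half-covered : ∀ y n p → .{{_ : NonZero y}} → 2 * y * n ≤ (2 * y + 2) * p → n ≤ 2 * p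
    half-covered y n p h = *-cancelˡ-≤ (2 * y) {{m*n≢0 2 y}} (begin
      2 * y * n                ≤⟨ h ⟩
      (2 * y + 2) * p          ≤⟨ *-monoˡ-≤ p (+-monoʳ-≤ (2 * y) (m≤m*n 2 y)) ⟩
      (2 * y + 2 * y) * p      ≡⟨ lem y p ⟩
      2 * y * (2 * p)          ∎)
      where
      open ≤-Reasoning
      lem : ∀ y p → (2 * y + 2 * y) * p ≡ 2 * y * (2 * p)
      lem = solve-∀

    -- The pieces cover at least half of the vertices, so q t is at least K m / 2; squaring produces
    -- the factor 4 in `few-irr`.
    bad-arith : ∀ s t m K q n b i → 0 < t → t * t * b ≤ m * m * i → 4 * s * i ≤ K * K → K * m ≤ n → n ≤ 2 * (q * t) →
      s * b ≤ q * q
    bad-arith s t m K q n b i 0<t h₁ h₂ h₃ h₄ = *-cancelˡ-≤ (4 * (t * t))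
      {{m*n≢0 4 (t * t) {{_}} {{>-nonZero (*-mono-< 0<t 0<t)}}}} (begin
      4 * (t * t) * (s * b)      ≡⟨ l₁ t s b ⟩
      4 * s * (t * t * b)        ≤⟨ *-monoʳ-≤ (4 * s) h₁ ⟩
      4 * s * (m * m * i)        ≡⟨ l₂ s m i ⟩
      m * m * (4 * s * i)        ≤⟨ *-monoʳ-≤ (m * m) h₂ ⟩
      m * m * (K * K)            ≡⟨ l₃ m K ⟩
      K * m * (K * m)            ≤⟨ *-mono-≤ (≤-trans h₃ h₄) (≤-trans h₃ h₄) ⟩
      2 * (q * t) * (2 * (q * t)) ≡⟨ l₄ q t ⟩
      4 * (t * t) * (q * q)      ∎)
      where
      open ≤-Reasoning
      l₁ : ∀ t s b → 4 * (t * t) * (s * b) ≡ 4 * s * (t * t * b)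
      l₁ = solve-∀
      l₂ : ∀ s m i → 4 * s * (m * m * i) ≡ m * m * (4 * s * i)
      l₂ = solve-∀
      l₃ : ∀ m K → m * m * (K * K) ≡ K * m * (K * m)
      l₃ = solve-∀
      l₄ : ∀ q t → 2 * (q * t) * (2 * (q * t)) ≡ 4 * (t * t) * (q * q)
      l₄ = solve-∀

  -- Cutting the classes into homogeneous pieces

  module Homogenise {n : ℕ} (a ā : Fin n → Fin n → Bool)
    (a-sym : ∀ u v → a u v ≡ a v u) (a-irr : ∀ u → a u u ≡ false)
    (ā-sym : ∀ u v → ā u v ≡ ā v u) (ā-irr : ∀ u → ā u u ≡ false)
    (s r : ℕ) {{s≢0 : NonZero s}} {K m : ℕ} (lab : Fin n → Fin (suc K))
    (size : ∀ i → countF (block lab (suc i)) ≡ m)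
    (irr : Fin K → Fin K → Bool) (few-irr : 4 * s * (sumF λ i → sumF λ j → ι (irr i j)) ≤ K * K)
    (regular : ∀ {i j} → irr i j ≡ false →
      Regular a (7 * s) (4 * s * cut s r) (block lab (suc i)) (block lab (suc j)))
    (cliques : ∀ i → cliqueConst s r * T a r (block lab (suc i)) ≤ m ^ r
      ⊎ cliqueConst s r * T ā r (block lab (suc i)) ≤ m ^ r)
    (small : scale s * countF (block lab zero) ≤ n)
    (0<K : 0 < K) (big : 4 * K * cut s r ≤ n) where

    open ≤-Reasoning

    y z b B v₀ : ℕ
    y = spread s
    z = scale s
    b = (2 * (8 * s)) ^ r
    B = cut s r
    v₀ = countF (block lab zero)

    instance
      8s≢0 : NonZero (8 * s)
      8s≢0 = m*n≢0 8 s
      b≢0 : NonZero b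
      b≢0 = m^n≢0 (2 * (8 * s)) r {{m*n≢0 2 (8 * s)}}
      y≢0 : NonZero y
      y≢0 = m*n≢0 s (2 * (7 * s + 2)) {{s≢0}} {{>-nonZero (≤-trans (s≤s z≤n) (*-monoʳ-≤ 2 (m≤n+m 2 (7 * s))))}}
      K≢0 : NonZero K
      K≢0 = >-nonZero 0<K

    2≤z : 2 ≤ z
    2≤z = m≤n+m 2 (2 * y)

    instance
      z≢0 : NonZero z
      z≢0 = >-nonZero (≤-trans (s≤s z≤n) 2≤z)
      B≢0 : NonZero B
      B≢0 = m*n≢0 z b

    2≤B : 2 ≤ B
    2≤B = ≤-trans 2≤z (m≤m*n z b)

    total : n ≡ v₀ + K * m
    total = block-sizes lab size

    Km≤n : K * m ≤ n
    Km≤n = subst (K * m ≤_) (sym total) (m≤n+m (K * m) v₀)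

    n≤2Km : n ≤ 2 * K * m
    n≤2Km = +-cancelˡ-≤ n _ _ (begin
      n + n                            ≡⟨ cong₂ _+_ total total ⟩
      v₀ + K * m + (v₀ + K * m)        ≡⟨ lem v₀ K m ⟩
      2 * v₀ + 2 * K * m               ≤⟨ +-monoˡ-≤ (2 * K * m) (≤-trans (*-monoˡ-≤ v₀ 2≤z) small) ⟩
      n + 2 * K * m                    ∎)
      where
      lem : ∀ v K m → v + K * m + (v + K * m) ≡ 2 * v + 2 * K * m
      lem = solve-∀

    -- Ensures pieces of at least two vertices. For a single vertex w (w - 1) vanishes and the
    -- strict bounds on homogeneous classes would fail.
    2B≤m : 2 * B ≤ m
    2B≤m = *-cancelˡ-≤ (2 * K) {{m*n≢0 2 K}} (begin
      2 * K * (2 * B)   ≡⟨ lem K B ⟩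
      4 * K * B         ≤⟨ big ⟩
      n                 ≤⟨ n≤2Km ⟩
      2 * K * m         ∎)
      where
      lem : ∀ K B → 2 * K * (2 * B) ≡ 4 * K * B
      lem = solve-∀

    module Pieces (t' : ℕ) (1≤t' : 1 ≤ t') (Bt≤m : B * suc t' ≤ m) (m≤2Bt : m ≤ 2 * B * suc t') where

      t : ℕ
      t = suc t'

      0<m : 0 < m
      0<m = ≤-trans (s≤s z≤n) (≤-trans (*-mono-≤ 2≤B (s≤s (z≤n {t'}))) Bt≤m)

      Sparse : (Fin n → Fin n → Bool) → (Fin n → Bool) → Set
      Sparse α W = 8 * s * E (edge α) W W ≤ 2 * (suc t' * t')

      Good : (Fin n → Bool) → Set
      Good W = ∃ λ i → W ⊑ block lab (suc i) × (Sparse a W ⊎ Sparse ā W)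

      Good-resp : ∀ {W W'} → (∀ u → W u ≡ W' u) → Good W → Good W'
      Good-resp {W} {W'} eq (i , sub , sp) = i , (λ u p → sub u (trans (eq u) p)) , Data.Sum.map (resp a) (resp ā) sp
        where
        resp : ∀ α → Sparse α W → Sparse α W'
        resp α = subst (λ e → 8 * s * e ≤ 2 * (suc t' * t')) (E-congˢ (edge α) eq eq)

      Stop : (Fin n → Bool) → Set
      Stop R = ∀ i → z * countF (λ u → block lab (suc i) u ∧ R u) ≤ m

      -- The remainder of a class inherits the clique bound by monotonicity and is large while the
      -- greedy procedure runs; `scale s ^ r` in `cliqueConst` balances the two.
      find-piece : ∀ (α : Fin n → Fin n → Bool) → (∀ u v → α u v ≡ α v u) → (∀ u → α u u ≡ false) →
        ∀ (i : Fin K) (U : Fin n → Bool) →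
        cliqueConst s r * T α r (block lab (suc i)) ≤ m ^ r → m ≤ z * countF (λ u → block lab (suc i) u ∧ U u) →
        ∃ λ W → W ⊑ (λ u → block lab (suc i) u ∧ U u) × countF W ≡ t × Sparse α W
      find-piece α α-sym α-irr i U few m≤ = sparse-subset-of-size α α-sym α-irr (8 * s) r t' U₀
        (*-cancelˡ-≤ (z ^ r) {{m^n≢0 z r}} (begin
          z ^ r * (sparseX (8 * s) r * T α r U₀)     ≡⟨ sym (*-assoc (z ^ r) _ _) ⟩
          cliqueConst s r * T α r U₀                 ≤⟨ *-monoʳ-≤ (cliqueConst s r) (T-mono α r {U₀} (λ u → proj₁ ∘ ∧-true)) ⟩
          cliqueConst s r * T α r (block lab (suc i)) ≤⟨ few ⟩
          m ^ r                                      ≤⟨ ^-monoˡ-≤ r m≤ ⟩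
          (z * countF U₀) ^ r                        ≡⟨ ^-distribʳ-* r z (countF U₀) ⟩
          z ^ r * countF U₀ ^ r                      ∎))
        1≤t' (*-cancelˡ-≤ z (begin
          z * (b * suc t')    ≡⟨ sym (*-assoc z b (suc t')) ⟩
          B * suc t'          ≤⟨ Bt≤m ⟩
          m                   ≤⟨ m≤ ⟩
          z * countF U₀       ∎))
        where
        U₀ : Fin n → Bool
        U₀ u = block lab (suc i) u ∧ U u

      step : ∀ U → Stop U ⊎ ∃ λ W → W ⊑ U × countF W ≡ t × Good W
      step U = decide (any? (λ i → m <? z * countF (λ u → block lab (suc i) u ∧ U u)))
        where
        in-U : ∀ {i} {W : Fin n → Bool} → W ⊑ (λ u → block lab (suc i) u ∧ U u) → W ⊑ U
        in-U {i} sub u p = proj₂ (∧-true {block lab (suc i) u} (sub u p))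
        in-V : ∀ {i} {W : Fin n → Bool} → W ⊑ (λ u → block lab (suc i) u ∧ U u) → W ⊑ block lab (suc i)
        in-V sub u p = proj₁ (∧-true (sub u p))
        piece : ∀ i → m < z * countF (λ u → block lab (suc i) u ∧ U u) →
          cliqueConst s r * T a r (block lab (suc i)) ≤ m ^ r ⊎ cliqueConst s r * T ā r (block lab (suc i)) ≤ m ^ r →
          ∃ λ W → W ⊑ U × countF W ≡ t × Good W
        piece i lt (inj₁ few) = let W , sub , W-size , sp = find-piece a a-sym a-irr i U few (<⇒≤ lt)
          in W , in-U sub , W-size , i , in-V sub , inj₁ sp
        piece i lt (inj₂ few) = let W , sub , W-size , sp = find-piece ā ā-sym ā-irr i U few (<⇒≤ lt)
          in W , in-U sub , W-size , i , in-V sub , inj₂ sp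
        decide : Dec (∃ λ i → m < z * countF (λ u → block lab (suc i) u ∧ U u)) →
          Stop U ⊎ ∃ λ W → W ⊑ U × countF W ≡ t × Good W
        decide (no ¬∃)        = inj₁ (λ i → ≮⇒≥ (λ lt → ¬∃ (i , lt)))
        decide (yes (i , lt)) = inj₂ (piece i lt (cliques i))

      module Redistribute (q : ℕ) (Q : Packing (λ _ → true) t Good q) (R : Fin n → Bool) (stop : Stop R)
        (in-rest : ∀ u → Packing.lab Q u ≡ zero → R u ≡ true) where

        open Packing Q renaming (lab to lab₀; size to size₀; good to good₀) using ()

        ρ : ℕ
        ρ = countF (block lab₀ zero)

        total₀ : n ≡ ρ + q * t
        total₀ = block-sizes lab₀ size₀

        -- One share of n comes from the old exceptional class, the other from the remainders of
        -- size at most m / z in the K classes.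
        zρ≤2n : z * ρ ≤ 2 * n
        zρ≤2n = begin
          z * ρ           ≤⟨ *-monoʳ-≤ z (count-mono {Y = R} (λ u p → in-rest u (≟-sound p))) ⟩
          z * countF R    ≡⟨ cong (z *_) (count-fibre lab R) ⟩
          z * (countF (λ u → block lab zero u ∧ R u) + sumF c)
            ≤⟨ *-monoʳ-≤ z (+-monoˡ-≤ (sumF c) (count-mono {Y = block lab zero} (λ u → proj₁ ∘ ∧-true))) ⟩
          z * (v₀ + sumF c)         ≡⟨ *-distribˡ-+ z v₀ (sumF c) ⟩
          z * v₀ + z * sumF c       ≡⟨ cong (z * v₀ +_) (sym (sum-*ˡ z c)) ⟩
          z * v₀ + sumF (λ i → z * c i)  ≤⟨ +-mono-≤ small (sum-mono stop) ⟩
          n + sumF {K} (λ _ → m)         ≡⟨ cong (n +_) (sum-const K m) ⟩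
          n + K * m                 ≤⟨ +-monoʳ-≤ n Km≤n ⟩
          n + n                     ≡⟨ cong (n +_) (sym (+-identityʳ n)) ⟩
          2 * n                     ∎
          where
          c : Fin K → ℕ
          c i = countF (λ u → block lab (suc i) u ∧ R u)

        yn≤ : 2 * y * n ≤ z * (q * t)
        yn≤ = covered y n ρ (q * t) total₀ zρ≤2n

        n≤2qt : n ≤ 2 * (q * t)
        n≤2qt = half-covered y n (q * t) yn≤

        K≤q : K ≤ q
        K≤q = *-cancelˡ-≤ (2 * t) (begin
          2 * t * K       ≤⟨ *-monoˡ-≤ K (*-monoˡ-≤ t 2≤B) ⟩
          B * t * K       ≤⟨ *-monoˡ-≤ K Bt≤m ⟩
          m * K           ≡⟨ *-comm m K ⟩
          K * m           ≤⟨ ≤-trans Km≤n n≤2qt ⟩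
          2 * (q * t)     ≡⟨ lem q t ⟩
          2 * t * q       ∎)
          where
          lem : ∀ q t → 2 * (q * t) ≡ 2 * t * q
          lem = solve-∀

        q≤L : q ≤ 4 * K * B
        q≤L = *-cancelʳ-≤ q (4 * K * B) t (begin
          q * t               ≤⟨ m≤n+m (q * t) ρ ⟩
          ρ + q * t           ≡⟨ sym total₀ ⟩
          n                   ≤⟨ n≤2Km ⟩
          2 * K * m           ≤⟨ *-monoʳ-≤ (2 * K) m≤2Bt ⟩
          2 * K * (2 * B * t) ≡⟨ lem K B t ⟩
          4 * K * B * t       ∎)
          where
          lem : ∀ K B t → 2 * K * (2 * B * t) ≡ 4 * K * B * t
          lem = solve-∀

        instance
          q≢0 : NonZero q
          q≢0 = >-nonZero (≤-trans 0<K K≤q)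

        -- The leftover is dealt out evenly; the remainder of the division by `q` forms the new
        -- exceptional class, which is thereby smaller than `q`.
        c : ℕ
        c = ρ / q

        qc≤ρ : q * c ≤ ρ
        qc≤ρ = ≤-trans (≤-reflexive (*-comm q c)) (m/n*n≤m ρ q)

        yc≤t : y * c ≤ t
        yc≤t = extras-small y n ρ q t c qc≤ρ zρ≤2n yn≤

        Q₁ : Packing (block lab₀ zero) c (λ _ → ⊤) q
        Q₁ = split-off q c (block lab₀ zero) qc≤ρ

        open Packing Q₁ renaming (lab to lab₁; size to size₁; inside to inside₁) using ()

        lab₂ : Fin n → Fin (suc q)
        lab₂ u = merge (lab₀ u) (lab₁ u)

        split : ∀ i u → ι (block lab₂ (suc i) u) ≡ ι (block lab₀ (suc i) u) + ι (block lab₁ (suc i) u)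
        split i u = ι-merge (lab₀ u) (lab₁ u) i (λ p → ≟-sound (inside₁ p))

        size₂ : ∀ i → countF (block lab₂ (suc i)) ≡ suc (t' + c)
        size₂ i = trans (sum-cong (split i)) (trans (sum-+ (ι ∘ block lab₀ (suc i)) (ι ∘ block lab₁ (suc i)))
          (cong₂ _+_ (size₀ i) (size₁ i)))

        rest : countF (block lab₂ zero) < q
        rest = subst (_< q) (sym eq) (m%n<n ρ q)
          where
          lem₁ : ∀ v q t c → v + q * c + q * t ≡ v + q * (t + c)
          lem₁ = solve-∀
          eq : countF (block lab₂ zero) ≡ ρ % q
          eq = +-cancelʳ-≡ (q * c) _ _ (+-cancelʳ-≡ (q * t) _ _ (begin-equality
            countF (block lab₂ zero) + q * c + q * t  ≡⟨ lem₁ (countF (block lab₂ zero)) q t c ⟩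
            countF (block lab₂ zero) + q * (t + c)    ≡⟨ sym (block-sizes lab₂ size₂) ⟩
            n                                         ≡⟨ total₀ ⟩
            ρ + q * t
              ≡⟨ cong (_+ q * t) (trans (m≡m%n+[m/n]*n ρ q) (cong (ρ % q +_) (*-comm c q))) ⟩
            ρ % q + q * c + q * t                     ∎))

        κ : Fin q → Fin K
        κ i = proj₁ (good₀ i)

        κ-sub : ∀ i → block lab₀ (suc i) ⊑ block lab (suc (κ i))
        κ-sub i = proj₁ (proj₂ (good₀ i))

        bad : Fin q → Fin q → Bool
        bad i j = irr (κ i) (κ j)

        few-bad : s * (sumF λ i → sumF λ j → ι (bad i j)) ≤ q * q
        few-bad = bad-arith s t m K q n _ _ z<s (begin
          t * t * sumF (λ i → sumF λ j → ι (bad i j))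
            ≡⟨ sym (sum-lift lab₀ size₀ (λ i j → ι (bad i j))) ⟩
          sumF (λ u → sumF λ v → lift (λ i j → ι (bad i j)) (lab₀ u) (lab₀ v))
            ≤⟨ sum-mono (λ u → sum-mono (λ v → pointwise u v)) ⟩
          sumF (λ u → sumF λ v → lift (λ i j → ι (irr i j)) (lab u) (lab v))
            ≡⟨ sum-lift lab size (λ i j → ι (irr i j)) ⟩
          m * m * sumF (λ i → sumF λ j → ι (irr i j)) ∎) few-irr Km≤n n≤2qt
          where
          -- Two vertices in a bad pair of pieces lie in an irregular pair of classes, since each
          -- piece is contained in the class named by `κ`.
          pointwise : ∀ u v → lift (λ i j → ι (bad i j)) (lab₀ u) (lab₀ v) ≤ lift (λ i j → ι (irr i j)) (lab u) (lab v)
          pointwise u v with lab₀ u in eu | lab₀ v in ev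
          ... | zero  | _    = z≤n
          ... | suc i | zero = z≤n
          ... | suc i | suc j rewrite ≟-sound (κ-sub i u (≟-complete eu)) | ≟-sound (κ-sub j v (≟-complete ev)) = ≤-refl

        uniform : ∀ {i j} → bad i j ≡ false → ∀ X Y → X ⊑ block lab₂ (suc i) → Y ⊑ block lab₂ (suc j) →
          suc (t' + c) ≤ s * countF X → suc (t' + c) ≤ s * countF Y →
          let e = E (edge a) X Y ; e' = E (edge a) (block lab₂ (suc i)) (block lab₂ (suc j))
              P = countF X * countF Y ; P' = suc (t' + c) * suc (t' + c) in
          0 < P × s * e * P' < s * e' * P + P * P' × s * e' * P < s * e * P' + P * P'
        uniform {i} {j} ok X Y X⊑ Y⊑ X≥ Y≥ =
          0<P , density-arith s k e e' P P' 0<P z<s (proj₁ d₁) (proj₂ d₂) ,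
          subst (s * e' * P <_) (cong (s * e * P' +_) (*-comm P' P)) (density-arith s k e' e P' P z<s 0<P (proj₁ d₂) (proj₂ d₁))
          where
          e e' P P' w : ℕ
          w = suc (t' + c)
          e = E (edge a) X Y
          e' = E (edge a) (block lab₂ (suc i)) (block lab₂ (suc j))
          P = countF X * countF Y
          P' = w * w
          0<P : 0 < P
          0<P = *-mono-< (large⇒0< s (countF X) z<s X≥) (large⇒0< s (countF Y) z<s Y≥)
          -- The pieces themselves count as large subsets, so both densities are compared with the
          -- same k.
          full : ∀ i → w ≤ s * countF (block lab₂ (suc i))
          full i = ≤-trans (m≤n*m w s) (≤-reflexive (cong (s *_) (sym (size₂ i))))
          inherited = regular-inherit a (7 * s) s B m t c {X = block lab₁ (suc i)} {X' = block lab₁ (suc j)}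
            (regular ok) 0<m (size (κ i)) (size (κ j)) m≤2Bt yc≤t (κ-sub i) (κ-sub j)
            (size₀ i) (size₀ j) (size₁ i) (size₁ j) (split i) (split j)
          k : ℕ
          k = proj₁ inherited
          dev = proj₂ inherited
          d₁ : 7 * s * e ≤ (k + 3) * P × k * P ≤ 7 * s * e + 3 * P
          d₁ = dev X Y X⊑ Y⊑ X≥ Y≥
          d₂ : 7 * s * e' ≤ (k + 3) * P' × k * P' ≤ 7 * s * e' + 3 * P'
          d₂ = subst (λ x → 7 * s * e' ≤ (k + 3) * x × k * x ≤ 7 * s * e' + 3 * x) (cong₂ _*_ (size₂ i) (size₂ j))
            (dev (block lab₂ (suc i)) (block lab₂ (suc j)) (λ _ p → p) (λ _ p → p) (full i) (full j))

        homogeneous : ∀ i → s * E (edge a) (block lab₂ (suc i)) (block lab₂ (suc i)) < suc (t' + c) * (t' + c)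
          ⊎ s * E (edge ā) (block lab₂ (suc i)) (block lab₂ (suc i)) < suc (t' + c) * (t' + c)
        homogeneous i = Data.Sum.map (sparse a) (sparse ā) (proj₂ (proj₂ (good₀ i)))
          where
          8s≤y : 8 * s ≤ y
          8s≤y = ≤-trans (≤-reflexive (*-comm 8 s)) (*-monoʳ-≤ s (*-monoʳ-≤ 2 {4}
            (+-monoˡ-≤ 2 {2} {7 * s} (≤-trans (m≤m+n 2 5) (m≤m*n 7 s)))))
          sparse : ∀ α → Sparse α (block lab₀ (suc i)) →
            s * E (edge α) (block lab₂ (suc i)) (block lab₂ (suc i)) < suc (t' + c) * (t' + c)
          sparse α sp = sparse-with-extras α s t' c (block lab₀ (suc i)) (block lab₁ (suc i)) (block lab₂ (suc i)) (split i)
            (size₀ i) (size₁ i) 1≤t' (≤-trans (*-monoˡ-≤ c 8s≤y) yc≤t) sp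

        redistributed : HomogeneousPartition a ā s K (4 * K * B)
        redistributed = record
          { lab = lab₂ ; size = size₂ ; rest = rest ; K≤q = K≤q ; q≤L = q≤L ; bad = bad ; few-bad = few-bad
          ; uniform = uniform ; homogeneous = homogeneous }

      pieces : HomogeneousPartition a ā s K (4 * K * B)
      pieces = let q , Q , R , stop , in-rest = greedy Good-resp {Stop} z<s (λ _ → true) (λ U _ → step U)
        in Redistribute.redistributed q Q R stop (λ u → in-rest u refl)

    homogenise : HomogeneousPartition a ā s K (4 * K * B)
    homogenise =
      let _ , lower , upper = quotient-bounds m B (≤-trans (m≤n*m B 2) 2B≤m)
          o , eq = m≤n⇒∃[o]m+o≡n (≤-trans (≤-reflexive (sym (m*n/n≡m 2 B))) (/-monoˡ-≤ B 2B≤m))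
      in Pieces.pieces (suc o) (s≤s z≤n) (subst (λ t → B * t ≤ m) (sym eq) lower) (subst (λ t → m ≤ 2 * B * t) (sym eq) upper)

  -- Rationals with a given denominator

  toℚᵘ-ℕ→ℚ : ∀ m → ℚ.toℚᵘ (ℕ→ℚ m) ℚᵘ.≃ ℚᵘ.mkℚᵘ (int m) 0
  toℚᵘ-ℕ→ℚ m = ℚₚ.toℚᵘ-fromℚᵘ (ℚᵘ.mkℚᵘ (int m) 0)

  ℕ→ℚ-* : ∀ m n → ℕ→ℚ (m * n) ≡ ℕ→ℚ m ℚ.* ℕ→ℚ n
  ℕ→ℚ-* m n = ℚₚ.toℚᵘ-injective (ℚᵘₚ.≃-trans (toℚᵘ-ℕ→ℚ (m * n)) (ℚᵘₚ.≃-sym (ℚᵘₚ.≃-trans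
    (ℚₚ.toℚᵘ-homo-* (ℕ→ℚ m) (ℕ→ℚ n)) (ℚᵘₚ.≃-trans (ℚᵘₚ.*-cong (toℚᵘ-ℕ→ℚ m) (toℚᵘ-ℕ→ℚ n))
    (ℚᵘ.*≡* (cong (Data.Integer._* (int 1)) (sym (ℤₚ.pos-* m n))))))))

  ℕ→ℚ-+ : ∀ m n → ℕ→ℚ (m + n) ≡ ℕ→ℚ m ℚ.+ ℕ→ℚ n
  ℕ→ℚ-+ m n = ℚₚ.toℚᵘ-injective (ℚᵘₚ.≃-trans (toℚᵘ-ℕ→ℚ (m + n)) (ℚᵘₚ.≃-sym (ℚᵘₚ.≃-trans
    (ℚₚ.toℚᵘ-homo-+ (ℕ→ℚ m) (ℕ→ℚ n)) (ℚᵘₚ.≃-trans (ℚᵘₚ.+-cong (toℚᵘ-ℕ→ℚ m) (toℚᵘ-ℕ→ℚ n))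
    (ℚᵘ.*≡* (cong (Data.Integer._* (int 1)) (cong₂ Data.Integer._+_ (ℤₚ.*-identityʳ (int m)) (ℤₚ.*-identityʳ (int n)))))))))

  ℕ→ℚ-mono-≤ : ∀ {m n} → m ≤ n → ℕ→ℚ m ℚ.≤ ℕ→ℚ n
  ℕ→ℚ-mono-≤ {m} {n} h = ℚₚ.toℚᵘ-cancel-≤ (ℚᵘₚ.≤-respˡ-≃ (ℚᵘₚ.≃-sym (toℚᵘ-ℕ→ℚ m))
    (ℚᵘₚ.≤-respʳ-≃ (ℚᵘₚ.≃-sym (toℚᵘ-ℕ→ℚ n)) (ℚᵘ.*≤* (subst₂ Data.Integer._≤_
      (sym (ℤₚ.*-identityʳ (int m))) (sym (ℤₚ.*-identityʳ (int n))) (+≤+ h)))))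

  ℕ→ℚ-mono-< : ∀ {m n} → m < n → ℕ→ℚ m ℚ.< ℕ→ℚ n
  ℕ→ℚ-mono-< {m} {n} h = ℚₚ.toℚᵘ-cancel-< (ℚᵘₚ.<-respˡ-≃ (ℚᵘₚ.≃-sym (toℚᵘ-ℕ→ℚ m))
    (ℚᵘₚ.<-respʳ-≃ (ℚᵘₚ.≃-sym (toℚᵘ-ℕ→ℚ n)) (ℚᵘ.*<* (subst₂ Data.Integer._<_
      (sym (ℤₚ.*-identityʳ (int m))) (sym (ℤₚ.*-identityʳ (int n))) (+<+ h)))))

  ℕ→ℚ-cancel-≤ : ∀ {m n} → ℕ→ℚ m ℚ.≤ ℕ→ℚ n → m ≤ n
  ℕ→ℚ-cancel-≤ {m} {n} h with m ≤? n
  ... | yes p = p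
  ... | no ¬p = ⊥-elim (ℚₚ.<-irrefl refl (ℚₚ.<-≤-trans (ℕ→ℚ-mono-< (≰⇒> ¬p)) h))

  ℕ→ℚ-cancel-< : ∀ {m n} → ℕ→ℚ m ℚ.< ℕ→ℚ n → m < n
  ℕ→ℚ-cancel-< {m} {n} h with m <? n
  ... | yes p = p
  ... | no ¬p = ⊥-elim (ℚₚ.<-irrefl refl (ℚₚ.<-≤-trans h (ℕ→ℚ-mono-≤ (≮⇒≥ ¬p))))

  -- The product form avoids the normal forms of ℚ; two fractions over the same positive `c` are
  -- compared by their numerators.
  record Fraction (p : ℚ) (A c : ℕ) : Set where
    constructor fraction
    field
      equation : p ℚ.* ℕ→ℚ c ≡ ℕ→ℚ A

  module _ {c : ℕ} (0<c : 0 < c) where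
    private instance
      c-pos : ℚ.Positive (ℕ→ℚ c)
      c-pos = ℚ.positive (ℕ→ℚ-mono-< 0<c)
      c-nonNeg : ℚ.NonNegative (ℕ→ℚ c)
      c-nonNeg = ℚₚ.pos⇒nonNeg (ℕ→ℚ c)

    module _ {p q : ℚ} {A B : ℕ} (F : Fraction p A c) (G : Fraction q B c) where
      open Fraction F renaming (equation to pA)
      open Fraction G renaming (equation to qB)

      fraction-≤ : A ≤ B → p ℚ.≤ q
      fraction-≤ h = ℚₚ.*-cancelʳ-≤-pos (ℕ→ℚ c) (subst₂ ℚ._≤_ (sym pA) (sym qB) (ℕ→ℚ-mono-≤ h))

      fraction-< : A < B → p ℚ.< q
      fraction-< h = ℚₚ.*-cancelʳ-<-nonNeg (ℕ→ℚ c) (subst₂ ℚ._<_ (sym pA) (sym qB) (ℕ→ℚ-mono-< h))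

      fraction-≤⁻¹ : p ℚ.≤ q → A ≤ B
      fraction-≤⁻¹ h = ℕ→ℚ-cancel-≤ (subst₂ ℚ._≤_ pA qB (ℚₚ.*-monoʳ-≤-nonNeg (ℕ→ℚ c) h))

      fraction-<⁻¹ : p ℚ.< q → A < B
      fraction-<⁻¹ h = ℕ→ℚ-cancel-< (subst₂ ℚ._<_ pA qB (ℚₚ.*-monoˡ-<-pos (ℕ→ℚ c) h))

  fraction-ℕ : ∀ m c → Fraction (ℕ→ℚ m) (m * c) c
  fraction-ℕ m c = fraction (sym (ℕ→ℚ-* m c))

  fraction-+ : ∀ {p q A B c} → Fraction p A c → Fraction q B c → Fraction (p ℚ.+ q) (A + B) c
  fraction-+ {p} {q} {A} {B} {c} (fraction pA) (fraction qB) = fraction (trans (ℚₚ.*-distribʳ-+ (ℕ→ℚ c) p q)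
    (trans (cong₂ ℚ._+_ pA qB) (sym (ℕ→ℚ-+ A B))))

  fraction-* : ∀ {p q A B c d} → Fraction p A c → Fraction q B d → Fraction (p ℚ.* q) (A * B) (c * d)
  fraction-* {p} {q} {A} {B} {c} {d} (fraction pA) (fraction qB) = fraction (begin
    p ℚ.* q ℚ.* ℕ→ℚ (c * d)              ≡⟨ cong (p ℚ.* q ℚ.*_) (ℕ→ℚ-* c d) ⟩
    p ℚ.* q ℚ.* (ℕ→ℚ c ℚ.* ℕ→ℚ d)        ≡⟨ ℚₚ.*-assoc p q _ ⟩
    p ℚ.* (q ℚ.* (ℕ→ℚ c ℚ.* ℕ→ℚ d))      ≡⟨ cong (p ℚ.*_) (sym (ℚₚ.*-assoc q (ℕ→ℚ c) (ℕ→ℚ d))) ⟩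
    p ℚ.* (q ℚ.* ℕ→ℚ c ℚ.* ℕ→ℚ d)        ≡⟨ cong (λ z → p ℚ.* (z ℚ.* ℕ→ℚ d)) (ℚₚ.*-comm q (ℕ→ℚ c)) ⟩
    p ℚ.* (ℕ→ℚ c ℚ.* q ℚ.* ℕ→ℚ d)        ≡⟨ cong (p ℚ.*_) (ℚₚ.*-assoc (ℕ→ℚ c) q (ℕ→ℚ d)) ⟩
    p ℚ.* (ℕ→ℚ c ℚ.* (q ℚ.* ℕ→ℚ d))      ≡⟨ sym (ℚₚ.*-assoc p (ℕ→ℚ c) _) ⟩
    p ℚ.* ℕ→ℚ c ℚ.* (q ℚ.* ℕ→ℚ d)        ≡⟨ cong₂ ℚ._*_ pA qB ⟩
    ℕ→ℚ A ℚ.* ℕ→ℚ B                      ≡⟨ sym (ℕ→ℚ-* A B) ⟩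
    ℕ→ℚ (A * B)                          ∎)
    where open ≡-Reasoning

  fraction-scale : ∀ {p A c} k → Fraction p A c → Fraction p (A * k) (c * k)
  fraction-scale {p} {A} {c} k (fraction pA) = fraction (begin
    p ℚ.* ℕ→ℚ (c * k)           ≡⟨ cong (p ℚ.*_) (ℕ→ℚ-* c k) ⟩
    p ℚ.* (ℕ→ℚ c ℚ.* ℕ→ℚ k)     ≡⟨ sym (ℚₚ.*-assoc p (ℕ→ℚ c) (ℕ→ℚ k)) ⟩
    p ℚ.* ℕ→ℚ c ℚ.* ℕ→ℚ k       ≡⟨ cong (ℚ._* ℕ→ℚ k) pA ⟩
    ℕ→ℚ A ℚ.* ℕ→ℚ k             ≡⟨ sym (ℕ→ℚ-* A k) ⟩
    ℕ→ℚ (A * k)                 ∎)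
    where open ≡-Reasoning

  fraction-divℕ : ∀ e {M} → 0 < M → Fraction (divℕ e M) e M
  fraction-divℕ e {suc m} _ = fraction (ℚₚ.toℚᵘ-injective (ℚᵘₚ.≃-trans (ℚₚ.toℚᵘ-homo-* (divℕ e (suc m)) (ℕ→ℚ (suc m)))
    (ℚᵘₚ.≃-trans (ℚᵘₚ.*-cong (ℚₚ.toℚᵘ-fromℚᵘ (ℚᵘ.mkℚᵘ (int e) m)) (toℚᵘ-ℕ→ℚ (suc m)))
    (ℚᵘₚ.≃-trans (ℚᵘ.*≡* (trans (ℤₚ.*-assoc (int e) (int (suc m)) (int 1))
      (cong (λ z → int e Data.Integer.* int z) (trans (*-identityʳ (suc m)) (sym (*-identityʳ (suc m)))))))
    (ℚᵘₚ.≃-sym (toℚᵘ-ℕ→ℚ e))))))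

  inv : ℕ → ℚ
  inv = divℕ 1

  fraction-inv : ∀ {s} → 0 < s → ∀ m → Fraction (inv s ℚ.* ℕ→ℚ m) m s
  fraction-inv {s} 0<s m = subst₂ (Fraction (inv s ℚ.* ℕ→ℚ m)) (*-identityˡ m) (*-identityʳ s)
    (fraction-* {inv s} {ℕ→ℚ m} {1} {m} {s} {1} (fraction-divℕ 1 0<s) (fraction (ℚₚ.*-identityʳ (ℕ→ℚ m))))

  0<inv : ∀ {s} → 0 < s → 0ℚ ℚ.< inv s
  0<inv {s} 0<s = fraction-< 0<s {0ℚ} {inv s} {0} {1} (fraction (ℚₚ.*-zeroˡ (ℕ→ℚ s))) (fraction-divℕ 1 0<s) z<s

  -- The numerator of a positive ε is at least 1, so the reciprocal of its denominator will do.
  inv-below : ∀ ε → 0ℚ ℚ.< ε → ∃ λ s → 0 < s × inv s ℚ.≤ ε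
  inv-below ε@(mkℚ (int (suc p)) d _) _ = suc d , z<s , ℚₚ.toℚᵘ-cancel-≤ (ℚᵘₚ.≤-respˡ-≃
    (ℚᵘₚ.≃-sym (ℚₚ.toℚᵘ-fromℚᵘ (ℚᵘ.mkℚᵘ (int 1) d))) (ℚᵘ.*≤* (ℤₚ.*-monoʳ-≤-nonNeg (int (suc d)) (+≤+ {1} {suc p} (s≤s z≤n)))))
  inv-below (mkℚ (int zero) d _) (ℚ.*<* (+<+ ()))
  inv-below (mkℚ (Data.Integer.-[1+ _ ]) d _) (ℚ.*<* ())

  neg-sub : ∀ p q → ℚ.- (p ℚ.- q) ≡ q ℚ.- p
  neg-sub p q = trans (ℚₚ.neg-distrib-+ p (ℚ.- q)) (trans (cong (ℚ.- p ℚ.+_) (neg-involutive q)) (ℚₚ.+-comm (ℚ.- p) q))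
    where
    neg-involutive : ∀ q → ℚ.- (ℚ.- q) ≡ q
    neg-involutive (mkℚ (int zero) _ _)                = refl
    neg-involutive (mkℚ (int (suc _)) _ _)               = refl
    neg-involutive (mkℚ (Data.Integer.-[1+ _ ]) _ _) = refl

  abs-< : ∀ {p q ε} → p ℚ.< q ℚ.+ ε → q ℚ.< p ℚ.+ ε → abs (p ℚ.- q) ℚ.< ε
  abs-< {p} {q} {ε} h₁ h₂ = Data.Sum.[ (λ eq → subst (ℚ._< ε) (sym eq) (move h₁)) ,
      (λ eq → subst (ℚ._< ε) (sym (trans eq (neg-sub p q))) (move h₂)) ]′ (ℚₚ.∣p∣≡p∨∣p∣≡-p (p ℚ.- q))
    where
    move : ∀ {x y} → x ℚ.< y ℚ.+ ε → x ℚ.- y ℚ.< ε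
    move {x} {y} h = subst (x ℚ.- y ℚ.<_) (begin
        y ℚ.+ ε ℚ.- y           ≡⟨ cong (ℚ._- y) (ℚₚ.+-comm y ε) ⟩
        ε ℚ.+ y ℚ.- y           ≡⟨ ℚₚ.+-assoc ε y (ℚ.- y) ⟩
        ε ℚ.+ (y ℚ.- y)         ≡⟨ cong (ε ℚ.+_) (ℚₚ.+-inverseʳ y) ⟩
        ε ℚ.+ 0ℚ                ≡⟨ ℚₚ.+-identityʳ ε ⟩
        ε                       ∎) (ℚₚ.+-monoˡ-< (ℚ.- y) h)
      where open ≡-Reasoning

  abs-<⁻¹ : ∀ {p q ε} → abs (p ℚ.- q) ℚ.< ε → p ℚ.< q ℚ.+ ε × q ℚ.< p ℚ.+ ε
  abs-<⁻¹ {p} {q} {ε} h = back p q (ℚₚ.≤-<-trans (p≤∣p∣ (p ℚ.- q)) h) ,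
    back q p (ℚₚ.≤-<-trans (p≤∣p∣ (q ℚ.- p)) (subst (ℚ._< ε) swap h))
    where
    p≤∣p∣ : ∀ p → p ℚ.≤ abs p
    p≤∣p∣ (mkℚ (int _) _ _) = ℚₚ.≤-refl
    p≤∣p∣ p@(mkℚ (Data.Integer.-[1+ _ ]) _ _) = ℚₚ.≤-trans (ℚₚ.<⇒≤ (ℚₚ.negative⁻¹ p)) (ℚₚ.0≤∣p∣ p)
    back : ∀ x y → x ℚ.- y ℚ.< ε → x ℚ.< y ℚ.+ ε
    back x y h = subst₂ ℚ._<_ (trans (ℚₚ.+-comm y (x ℚ.- y)) (trans (ℚₚ.+-assoc x (ℚ.- y) y)
      (trans (cong (x ℚ.+_) (ℚₚ.+-inverseˡ y)) (ℚₚ.+-identityʳ x)))) refl (ℚₚ.+-monoʳ-< y h)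
    swap : abs (p ℚ.- q) ≡ abs (q ℚ.- p)
    swap = trans (sym (ℚₚ.∣-p∣≡∣p∣ (p ℚ.- q))) (cong abs (neg-sub p q))

  -- Densities e / M and e' / M' brought to the common denominator s M M'.
  module _ {s e e' M M' : ℕ} (0<s : 0 < s) (0<M : 0 < M) (0<M' : 0 < M') where
    private
      c : ℕ
      c = s * (M * M')
      0<c : 0 < c
      0<c = *-mono-< 0<s (*-mono-< 0<M 0<M')
      F : Fraction (divℕ e M) (s * e * M') c
      F = subst₂ (Fraction (divℕ e M)) (l₁ e s M') (l₂ M s M') (fraction-scale (s * M') (fraction-divℕ e 0<M))
        where
        l₁ : ∀ e s M → e * (s * M) ≡ s * e * M
        l₁ = solve-∀
        l₂ : ∀ M s N → M * (s * N) ≡ s * (M * N)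
        l₂ = solve-∀
      F' : Fraction (divℕ e' M') (s * e' * M) c
      F' = subst₂ (Fraction (divℕ e' M')) (l₁ e' s M) (l₂ M' s M) (fraction-scale (s * M) (fraction-divℕ e' 0<M'))
        where
        l₁ : ∀ e s M → e * (s * M) ≡ s * e * M
        l₁ = solve-∀
        l₂ : ∀ N s M → N * (s * M) ≡ s * (M * N)
        l₂ = solve-∀
      F₁ : Fraction (inv s) (M * M') c
      F₁ = subst (λ z → Fraction (inv s) z c) (*-identityˡ (M * M')) (fraction-scale (M * M') (fraction-divℕ 1 0<s))

    density-close : s * e * M' < s * e' * M + M * M' → s * e' * M < s * e * M' + M * M' →
      abs (divℕ e M ℚ.- divℕ e' M') ℚ.< inv s
    density-close h h' = abs-< {divℕ e M} {divℕ e' M'}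
      (fraction-< 0<c {divℕ e M} {divℕ e' M' ℚ.+ inv s} F (fraction-+ {divℕ e' M'} {inv s} F' F₁) h)
      (fraction-< 0<c {divℕ e' M'} {divℕ e M ℚ.+ inv s} F' (fraction-+ {divℕ e M} {inv s} F F₁) h')

    density-close⁻¹ : abs (divℕ e M ℚ.- divℕ e' M') ℚ.< inv s →
      s * e * M' < s * e' * M + M * M' × s * e' * M < s * e * M' + M * M'
    density-close⁻¹ h = let h₁ , h₂ = abs-<⁻¹ {divℕ e M} {divℕ e' M'} h in
      fraction-<⁻¹ 0<c {divℕ e M} {divℕ e' M' ℚ.+ inv s} F (fraction-+ {divℕ e' M'} {inv s} F' F₁) h₁ ,
      fraction-<⁻¹ 0<c {divℕ e' M'} {divℕ e M ℚ.+ inv s} F' (fraction-+ {divℕ e M} {inv s} F F₁) h₂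

  ℕ→ℚ-nonNeg : ∀ m → ℚ.NonNegative (ℕ→ℚ m)
  ℕ→ℚ-nonNeg m = ℚ.nonNegative (ℕ→ℚ-mono-≤ {0} {m} z≤n)

  module _ {s : ℕ} (0<s : 0 < s) where

    ≤inv* : ∀ {m k} → s * m ≤ k → ℕ→ℚ m ℚ.≤ inv s ℚ.* ℕ→ℚ k
    ≤inv* {m} {k} h = fraction-≤ 0<s {ℕ→ℚ m} {inv s ℚ.* ℕ→ℚ k}
      (fraction-ℕ m s) (fraction-inv 0<s k) (≤-trans (≤-reflexive (*-comm m s)) h)

    ≤inv*⁻¹ : ∀ {m k} → ℕ→ℚ m ℚ.≤ inv s ℚ.* ℕ→ℚ k → s * m ≤ k
    ≤inv*⁻¹ {m} {k} h = ≤-trans (≤-reflexive (*-comm s m))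
      (fraction-≤⁻¹ 0<s {ℕ→ℚ m} {inv s ℚ.* ℕ→ℚ k} (fraction-ℕ m s) (fraction-inv 0<s k) h)

    inv*≤ : ∀ {m k} → m ≤ s * k → inv s ℚ.* ℕ→ℚ m ℚ.≤ ℕ→ℚ k
    inv*≤ {m} {k} h = fraction-≤ 0<s {inv s ℚ.* ℕ→ℚ m} {ℕ→ℚ k}
      (fraction-inv 0<s m) (fraction-ℕ k s) (≤-trans h (≤-reflexive (*-comm s k)))

    inv*≤⁻¹ : ∀ {m k} → inv s ℚ.* ℕ→ℚ m ℚ.≤ ℕ→ℚ k → m ≤ s * k
    inv*≤⁻¹ {m} {k} h = ≤-trans (fraction-≤⁻¹ 0<s {inv s ℚ.* ℕ→ℚ m} {ℕ→ℚ k} (fraction-inv 0<s m) (fraction-ℕ k s) h)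
      (≤-reflexive (*-comm k s))

    <inv* : ∀ {m k} → s * m < k → ℕ→ℚ m ℚ.< inv s ℚ.* ℕ→ℚ k
    <inv* {m} {k} h = fraction-< 0<s {ℕ→ℚ m} {inv s ℚ.* ℕ→ℚ k} (fraction-ℕ m s) (fraction-inv 0<s k) (subst (_< k) (*-comm s m) h)

    -- The hypothesis is (1 - 1 / s) k < m without subtraction; as k is nonnegative, 1 / s may be
    -- replaced by the larger ε.
    [1-ε]*< : ∀ {ε m k} → inv s ℚ.≤ ε → s * k < s * m + k → (1ℚ ℚ.- ε) ℚ.* ℕ→ℚ k ℚ.< ℕ→ℚ m
    [1-ε]*< {ε} {m} {k} s≤ε h = subst₂ ℚ._<_ (sym left) right (ℚₚ.+-monoˡ-< (ℚ.- (ε ℚ.* ℕ→ℚ k)) k<)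
      where
      open ≡-Reasoning
      k< : ℕ→ℚ k ℚ.< ℕ→ℚ m ℚ.+ ε ℚ.* ℕ→ℚ k
      k< = ℚₚ.<-≤-trans (fraction-< 0<s {ℕ→ℚ k} {ℕ→ℚ m ℚ.+ inv s ℚ.* ℕ→ℚ k} (fraction-ℕ k s)
          (fraction-+ {ℕ→ℚ m} {inv s ℚ.* ℕ→ℚ k} (fraction-ℕ m s) (fraction-inv 0<s k))
          (subst₂ _<_ (*-comm s k) (cong (_+ k) (*-comm s m)) h))
        (ℚₚ.+-monoʳ-≤ (ℕ→ℚ m) (ℚₚ.*-monoʳ-≤-nonNeg (ℕ→ℚ k) {{ℕ→ℚ-nonNeg k}} s≤ε))
      left : (1ℚ ℚ.- ε) ℚ.* ℕ→ℚ k ≡ ℕ→ℚ k ℚ.- ε ℚ.* ℕ→ℚ k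
      left = trans (ℚₚ.*-distribʳ-+ (ℕ→ℚ k) 1ℚ (ℚ.- ε))
        (cong₂ ℚ._+_ (ℚₚ.*-identityˡ (ℕ→ℚ k)) (sym (ℚₚ.neg-distribˡ-* ε (ℕ→ℚ k))))
      right : ℕ→ℚ m ℚ.+ ε ℚ.* ℕ→ℚ k ℚ.- ε ℚ.* ℕ→ℚ k ≡ ℕ→ℚ m
      right = begin
        ℕ→ℚ m ℚ.+ ε ℚ.* ℕ→ℚ k ℚ.- ε ℚ.* ℕ→ℚ k      ≡⟨ ℚₚ.+-assoc (ℕ→ℚ m) _ _ ⟩
        ℕ→ℚ m ℚ.+ (ε ℚ.* ℕ→ℚ k ℚ.- ε ℚ.* ℕ→ℚ k)    ≡⟨ cong (ℕ→ℚ m ℚ.+_) (ℚₚ.+-inverseʳ (ε ℚ.* ℕ→ℚ k)) ⟩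
        ℕ→ℚ m ℚ.+ 0ℚ                               ≡⟨ ℚₚ.+-identityʳ (ℕ→ℚ m) ⟩
        ℕ→ℚ m                                      ∎

  -- Graphs

  compl-sym : ∀ {n} (G : Graph n) u v → compl G u v ≡ compl G v u
  compl-sym G u v = cong₂ (λ x y → not x ∧ not y) (adj-sym G u v)
    (bool-eq (λ p → ≟-complete (sym (≟-sound p))) (λ p → ≟-complete (sym (≟-sound p))))

  compl-irrefl : ∀ {n} (G : Graph n) u → compl G u u ≡ false
  compl-irrefl G u rewrite ≟-refl u = ∧-zeroʳ (not (adj G u u))

  lookup-cls : ∀ {n k} (P : Partition n k) i u → lookup (cls P i) u ≡ block (part P) i u
  lookup-cls P i = lookup∘tabulate (block (part P) i)

  ∣cls∣ : ∀ {n k} (P : Partition n k) i → ∣ cls P i ∣ ≡ countF (block (part P) i)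
  ∣cls∣ P i = trans (∣∣≡count (cls P i)) (count-cong (lookup-cls P i))

  eBetween≡E : ∀ {n} (G : Graph n) X Y → eBetween G X Y ≡ E (edge (adj G)) (lookup X) (lookup Y)
  eBetween≡E {n} G X Y = sum-cong (λ u → sum-cong (λ v → trans (ι-∧ (lookup X u) _)
    (cong (ι (lookup X u) *_) (ι-∧ (lookup Y v) (adj G u v)))))

  -- Of the two orders of an adjacent pair exactly one is counted by `eIn`.
  2eIn≡E : ∀ {n} (G : Graph n) U → 2 * eIn G U ≡ E (edge (adj G)) (lookup U) (lookup U)
  2eIn≡E {n} G U = begin
    2 * eIn G U          ≡⟨ cong (λ e → e + (e + 0)) eIn≡ ⟩
    E w W W + (E w W W + 0) ≡⟨ cong (λ e → E w W W + e) (trans (+-identityʳ _) (E-flip w W W)) ⟩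
    E w W W + E (flip w) W W ≡⟨ sym (E-+ w (flip w) W W) ⟩
    E (λ u v → w u v + w v u) W W ≡⟨ E-cong {X = W} {W} (λ u v _ _ → ordered u v) ⟩
    E (edge (adj G)) W W ∎
    where
    open ≡-Reasoning
    W : Fin n → Bool
    W = lookup U
    w : Fin n → Fin n → ℕ
    w u v = ι ((toℕ u <ᵇ toℕ v) ∧ adj G u v)
    eIn≡ : eIn G U ≡ E w W W
    eIn≡ = sum-cong (λ u → sum-cong (λ v → trans (ι-∧ (W u) _) (cong (ι (W u) *_) (ι-∧ (W v) _))))
    <ᵇ-true : ∀ {i j} → i < j → (i <ᵇ j) ≡ true
    <ᵇ-true {i} {j} h with i <ᵇ j | <⇒<ᵇ h
    ... | true | _ = refl
    <ᵇ-false : ∀ {i j} → ¬ i < j → (i <ᵇ j) ≡ false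
    <ᵇ-false {i} {j} h with i <ᵇ j in eq
    ... | false = refl
    ... | true  = ⊥-elim (h (<ᵇ⇒< i j (subst Data.Bool.T (sym eq) _)))
    ordered : ∀ u v → w u v + w v u ≡ edge (adj G) u v
    ordered u v with <-cmp (toℕ u) (toℕ v)
    ... | tri< u<v _ v≮u rewrite <ᵇ-true u<v | <ᵇ-false v≮u = +-identityʳ _
    ... | tri> u≮v _ v<u rewrite <ᵇ-true v<u | <ᵇ-false u≮v = cong ι (adj-sym G v u)
    ... | tri≈ u≮v u≡v v≮u rewrite <ᵇ-false u≮v | <ᵇ-false v≮u | toℕ-injective u≡v = sym (cong ι (adj-irrefl G v))

  -- Any two vertices are adjacent, adjacent in the complement, or equal; the equal pairs make up
  -- the term `countF W`.
  E+E-compl : ∀ {n} (G : Graph n) (W : Fin n → Bool) →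
    E (edge (adj G)) W W + E (edge (compl G)) W W + countF W ≡ countF W * countF W
  E+E-compl {n} G W = begin
    E (edge (adj G)) W W + E (edge (compl G)) W W + countF W
      ≡⟨ cong (λ e → E (edge (adj G)) W W + E (edge (compl G)) W W + e) (sym diagonal) ⟩
    E (edge (adj G)) W W + E (edge (compl G)) W W + E δ W W
      ≡⟨ trans (cong (_+ E δ W W) (sym (E-+ _ _ W W))) (sym (E-+ _ δ W W)) ⟩
    E (λ u v → edge (adj G) u v + edge (compl G) u v + δ u v) W W
      ≡⟨ E-cong {X = W} {W} (λ u v _ _ → pointwise u v) ⟩
    E (λ _ _ → 1) W W
      ≡⟨ trans (E-const 1 W W) (*-identityˡ _) ⟩
    countF W * countF W ∎
    where
    open ≡-Reasoning
    δ : Fin n → Fin n → ℕ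
    δ u v = ι ⌊ u ≟ v ⌋
    pointwise : ∀ u v → edge (adj G) u v + edge (compl G) u v + δ u v ≡ 1
    pointwise u v with u ≟ v
    ... | yes refl rewrite adj-irrefl G u = refl
    ... | no _ with adj G u v
    ...   | true  = refl
    ...   | false = refl
    idempotent : ∀ b → ι b * ι b ≡ ι b
    idempotent true  = refl
    idempotent false = refl
    diagonal : E δ W W ≡ countF W
    diagonal = sum-cong (λ u → trans (sum-*ˡ {n} (ι (W u)) _) (trans (cong (ι (W u) *_)
      (trans (sum-cong (λ v → *-comm (ι (W v)) (δ u v))) (sum-δ u (ι ∘ W)))) (idempotent (W u))))

  2*C2 : ∀ w → 2 * (suc w C 2) ≡ suc w * w
  2*C2 zero    = refl
  2*C2 (suc w) = begin
    2 * (suc (suc w) C 2)           ≡⟨ cong (2 *_) (sym (nCk+nC[k+1]≡[n+1]C[k+1] (suc w) 1)) ⟩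
    2 * (suc w C 1 + suc w C 2)     ≡⟨ *-distribˡ-+ 2 (suc w C 1) (suc w C 2) ⟩
    2 * (suc w C 1) + 2 * (suc w C 2) ≡⟨ cong₂ (λ x y → 2 * x + y) (nC1≡n (suc w)) (2*C2 w) ⟩
    2 * suc w + suc w * w           ≡⟨ lem w ⟩
    suc (suc w) * suc w             ∎
    where
    open ≡-Reasoning
    lem : ∀ w → 2 * suc w + suc w * w ≡ suc (suc w) * suc w
    lem = solve-∀

  ⊆⇒⊑ : ∀ {n} {X Y : Subset n} → X ⊆ Y → lookup X ⊑ lookup Y
  ⊆⇒⊑ {X = X} {Y} h u p = []=⇒lookup (h (lookup⇒[]= u X p))

  ⊑⇒⊆ : ∀ {n} {X Y : Subset n} → lookup X ⊑ lookup Y → X ⊆ Y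
  ⊑⇒⊆ {X = X} {Y} h {u} p = lookup⇒[]= u Y (h u ([]=⇒lookup p))

  few-cliques : ∀ {n} (α : Fin n → Fin n → Bool) → (∀ u v → α u v ≡ α v u) → (∀ u → α u u ≡ false) →
    ∀ r x y S → y * (x * r !) * kr α r S ≤ ∣ S ∣ ^ r → y * (x * T α r (lookup S)) ≤ ∣ S ∣ ^ r
  few-cliques α α-sym α-irr r x y S h = begin
    y * (x * T α r (lookup S))      ≤⟨ *-monoʳ-≤ y (*-monoʳ-≤ x (T≤r!*cliques α α-sym α-irr r (lookup S))) ⟩
    y * (x * (r ! * sumS (ι ∘ isCliqueIn α r (lookup S)))) ≡⟨ cong (λ z → y * (x * (r ! * z))) (sym (kr≡sumS α r S)) ⟩
    y * (x * (r ! * kr α r S))      ≡⟨ lem y x (r !) (kr α r S) ⟩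
    y * (x * r !) * kr α r S        ≤⟨ h ⟩
    ∣ S ∣ ^ r                       ∎
    where
    open ≤-Reasoning
    lem : ∀ y x f k → y * (x * (f * k)) ≡ y * (x * f) * k
    lem = solve-∀

  private
    -- The constant is the density of the whole pair rounded down to a multiple of 1 / σ. Rounding
    -- costs one unit and uniformity at most one more, which is why `Regular` allows two.
    regular-arith : ∀ σ d e e' R R' .{{_ : NonZero d}} .{{_ : NonZero R'}} →
      σ * d * e * R' < σ * d * e' * R + R * R' → σ * d * e' * R < σ * d * e * R' + R * R' →
      σ * e ≤ (σ * e' / R' + 2) * R × σ * e' / R' * R ≤ σ * e + 2 * R
    regular-arith σ d e e' R R' h h' = *-cancelʳ-≤ _ _ R' (begin
        σ * e * R'                      ≤⟨ unscale d (σ * e * R') (σ * e' * R) (R * R')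
          (subst₂ _<_ (l₁ σ d e R') (cong (_+ R * R') (l₁ σ d e' R)) h) ⟩
        σ * e' * R + R * R'             ≤⟨ +-monoˡ-≤ (R * R') (*-monoˡ-≤ R upper) ⟩
        (R' + c * R') * R + R * R'      ≡⟨ l₂ R' c R ⟩
        (c + 2) * R * R'                ∎) , *-cancelʳ-≤ _ _ R' (begin
        c * R * R'                      ≡⟨ l₃ c R R' ⟩
        c * R' * R                      ≤⟨ *-monoˡ-≤ R (m/n*n≤m (σ * e') R') ⟩
        σ * e' * R                      ≤⟨ unscale d (σ * e' * R) (σ * e * R') (R * R')
          (subst₂ _<_ (l₁ σ d e' R) (cong (_+ R * R') (l₁ σ d e R')) h') ⟩
        σ * e * R' + R * R'             ≤⟨ +-monoʳ-≤ (σ * e * R') (*-monoˡ-≤ R' (m≤m+n R (R + 0))) ⟩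
        σ * e * R' + 2 * R * R'         ≡⟨ sym (*-distribʳ-+ R' (σ * e) (2 * R)) ⟩
        (σ * e + 2 * R) * R'            ∎)
      where
      open ≤-Reasoning
      c : ℕ
      c = σ * e' / R'
      upper : σ * e' ≤ R' + c * R'
      upper = ≤-trans (≤-reflexive (m≡m%n+[m/n]*n (σ * e') R')) (+-monoˡ-≤ (c * R') (<⇒≤ (m%n<n (σ * e') R')))
      unscale : ∀ d x y z .{{_ : NonZero d}} → d * x < d * y + z → x ≤ y + z
      unscale d x y z h = *-cancelˡ-≤ d (≤-trans (<⇒≤ h)
        (≤-trans (+-monoʳ-≤ (d * y) (m≤n*m z d)) (≤-reflexive (sym (*-distribˡ-+ d y z)))))
      l₁ : ∀ σ d e R → σ * d * e * R ≡ d * (σ * e * R)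
      l₁ = solve-∀
      l₂ : ∀ P c R → (P + c * P) * R + R * P ≡ (c + 2) * R * P
      l₂ = solve-∀
      l₃ : ∀ c R P → c * R * P ≡ c * P * R
      l₃ = solve-∀

  -- The reciprocal of `σ * d` is small enough for both roles of δ: subsets of relative size 1 / d
  -- are tested, and deviations stay below one unit of 1 / σ.
  uniform⇒regular : ∀ {n} (G : Graph n) σ d .{{_ : NonZero σ}} .{{_ : NonZero d}} {A B : Subset n} {A' B' : Fin n → Bool} →
    (∀ u → lookup A u ≡ A' u) → (∀ u → lookup B u ≡ B' u) → 0 < countF A' → 0 < countF B' →
    UniformPair G (inv (σ * d)) A B → Regular (adj G) σ d A' B'
  uniform⇒regular {n} G σ d {A} {B} {A'} {B'} A≗ B≗ 0<A 0<B uniform = σ * e' / R' , λ X Y X⊑ Y⊑ X≥ Y≥ →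
    let 0<R = *-mono-< (large⇒0< d (countF X) 0<A X≥) (large⇒0< d (countF Y) 0<B Y≥)
        h , h' = density-close⁻¹ {σ * d} {E (edge (adj G)) X Y} {e'} {countF X * countF Y} {R'} 0<σd 0<R (*-mono-< 0<A 0<B)
          (subst₂ (λ p q → abs (p ℚ.- q) ℚ.< inv (σ * d)) (dens≡ (S X) (S Y) (≗ X) (≗ Y)) (dens≡ A B A≗ B≗)
            (uniform (S X) (S Y) (⊑⇒⊆ {X = S X} {A} (sub {S X} {A} (≗ X) A≗ X⊑)) (⊑⇒⊆ {X = S Y} {B} (sub {S Y} {B} (≗ Y) B≗ Y⊑))
              (large A (S X) A≗ (≗ X) X≥) (large B (S Y) B≗ (≗ Y) Y≥)))
    in regular-arith σ d _ e' (countF X * countF Y) R' h h'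
    where
    e' R' : ℕ
    e' = E (edge (adj G)) A' B'
    R' = countF A' * countF B'
    instance
      R'≢0 : NonZero R'
      R'≢0 = >-nonZero (*-mono-< 0<A 0<B)
    0<σd : 0 < σ * d
    0<σd = >-nonZero⁻¹ (σ * d) {{m*n≢0 σ d}}
    S : (Fin n → Bool) → Subset n
    S = tabulate
    ≗ : ∀ (Z : Fin n → Bool) u → lookup (S Z) u ≡ Z u
    ≗ Z = lookup∘tabulate Z
    size≡ : ∀ X {X' : Fin n → Bool} → (∀ u → lookup X u ≡ X' u) → ∣ X ∣ ≡ countF X'
    size≡ X h = trans (∣∣≡count X) (count-cong h)
    dens≡ : ∀ X Y {X' Y' : Fin n → Bool} → (∀ u → lookup X u ≡ X' u) → (∀ u → lookup Y u ≡ Y' u) →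
      dens G X Y ≡ divℕ (E (edge (adj G)) X' Y') (countF X' * countF Y')
    dens≡ X Y hX hY = cong₂ divℕ (trans (eBetween≡E G X Y) (E-congˢ (edge (adj G)) hX hY)) (cong₂ _*_ (size≡ X hX) (size≡ Y hY))
    sub : ∀ {X A : Subset n} {X' A' : Fin n → Bool} →
      (∀ u → lookup X u ≡ X' u) → (∀ u → lookup A u ≡ A' u) → X' ⊑ A' → lookup X ⊑ lookup A
    sub hX hA h u p = trans (hA u) (h u (trans (sym (hX u)) p))
    large : ∀ A X {A' X' : Fin n → Bool} → (∀ u → lookup A u ≡ A' u) → (∀ u → lookup X u ≡ X' u) →
      countF A' ≤ d * countF X' → inv (σ * d) ℚ.* ℕ→ℚ ∣ A ∣ ℚ.≤ ℕ→ℚ ∣ X ∣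
    large A X {A'} {X'} hA hX h = subst₂ (λ a x → inv (σ * d) ℚ.* ℕ→ℚ a ℚ.≤ ℕ→ℚ x) (sym (size≡ A hA)) (sym (size≡ X hX))
      (inv*≤ 0<σd {countF A'} {countF X'} (≤-trans h (*-monoˡ-≤ (countF X') (m≤n*m d σ))))

  Regular-swap : ∀ {n} (a : Fin n → Fin n → Bool) → (∀ u v → a u v ≡ a v u) → ∀ {σ d A B} →
    Regular a σ d A B → Regular a σ d B A
  Regular-swap a a-sym {σ} (c , h) = c , λ X Y X⊑ Y⊑ X≥ Y≥ → subst₂ (λ e R → σ * e ≤ (c + 2) * R × c * R ≤ σ * e + 2 * R)
    (trans (E-flip (edge a) Y X) (E-cong {X = X} {Y} (λ u v _ _ → cong ι (a-sym v u))))
    (*-comm (countF Y) (countF X)) (h Y X Y⊑ X⊑ Y≥ X≥)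

  -- Translation back to rational densities

  module Conclude {n : ℕ} (G : Graph n) {ε : ℚ} {s : ℕ} (0<s : 0 < s) (s≤ε : inv s ℚ.≤ ε) where

    mono-ε : ∀ k → inv s ℚ.* ℕ→ℚ k ℚ.≤ ε ℚ.* ℕ→ℚ k
    mono-ε k = ℚₚ.*-monoʳ-≤-nonNeg (ℕ→ℚ k) {{ℕ→ℚ-nonNeg k}} s≤ε

    module _ {K L : ℕ} (H : HomogeneousPartition (adj G) (compl G) s K L) where
      open HomogeneousPartition H

      Q : Partition n q
      Q = record { part = lab }

      ∣Q∣ : ∀ i → ∣ cls Q (suc i) ∣ ≡ suc w
      ∣Q∣ i = trans (∣cls∣ Q (suc i)) (size i)

      uniform-pair : ∀ i j → bad i j ≡ false → UniformPair G ε (cls Q (suc i)) (cls Q (suc j))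
      uniform-pair i j ok X Y X⊆ Y⊆ X≥ Y≥ = ℚₚ.<-≤-trans
        (subst₂ (λ p q → abs (p ℚ.- q) ℚ.< inv s)
          (cong₂ divℕ (sym (eBetween≡E G X Y)) (sym (cong₂ _*_ (∣∣≡count X) (∣∣≡count Y))))
          (cong₂ divℕ (sym (trans (eBetween≡E G (cls Q (suc i)) (cls Q (suc j)))
              (E-congˢ (edge (adj G)) (lookup-cls Q (suc i)) (lookup-cls Q (suc j)))))
            (sym (cong₂ _*_ (∣Q∣ i) (∣Q∣ j))))
          (density-close {s} {E (edge (adj G)) (lookup X) (lookup Y)} {e'} {countF (lookup X) * countF (lookup Y)} {suc w * suc w}
            0<s (proj₁ close) z<s (proj₁ (proj₂ close)) (proj₂ (proj₂ close))))
        s≤ε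
        where
        e' : ℕ
        e' = E (edge (adj G)) (block lab (suc i)) (block lab (suc j))
        inside : ∀ Z l → Z ⊆ cls Q (suc l) → lookup Z ⊑ block lab (suc l)
        inside Z l h u p = trans (sym (lookup-cls Q (suc l) u)) (⊆⇒⊑ {X = Z} {cls Q (suc l)} h u p)
        large : ∀ Z l → ε ℚ.* ℕ→ℚ ∣ cls Q (suc l) ∣ ℚ.≤ ℕ→ℚ ∣ Z ∣ → suc w ≤ s * countF (lookup Z)
        large Z l h = subst₂ (λ x y → x ≤ s * y) (∣Q∣ l) (∣∣≡count Z)
          (inv*≤⁻¹ 0<s {∣ cls Q (suc l) ∣} {∣ Z ∣} (ℚₚ.≤-trans (mono-ε ∣ cls Q (suc l) ∣) h))
        close = uniform ok (lookup X) (lookup Y) (inside X i X⊆) (inside Y j Y⊆) (large X i X≥) (large Y j Y≥)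

      few-bad-pairs : ℕ→ℚ (countPairs bad) ℚ.≤ ε ℚ.* ℕ→ℚ (q * q)
      few-bad-pairs = ℚₚ.≤-trans (≤inv* 0<s {countPairs bad} {q * q}
        (≤-trans (*-monoʳ-≤ s (sum-mono {q} (λ i → sum-mono {q} (λ j →
        ι-mono {y = bad i j} (λ p → proj₂ (∧-true {toℕ i <ᵇ toℕ j} p)))))) few-bad)) (mono-ε (q * q))

      homogeneous-class : ∀ i → ℕ→ℚ (eIn G (cls Q (suc i))) ℚ.< ε ℚ.* ℕ→ℚ (∣ cls Q (suc i) ∣ C 2)
        ⊎ (1ℚ ℚ.- ε) ℚ.* ℕ→ℚ (∣ cls Q (suc i) ∣ C 2) ℚ.< ℕ→ℚ (eIn G (cls Q (suc i)))
      homogeneous-class i = subst (λ c → ℕ→ℚ e ℚ.< ε ℚ.* ℕ→ℚ (c C 2) ⊎ (1ℚ ℚ.- ε) ℚ.* ℕ→ℚ (c C 2) ℚ.< ℕ→ℚ e)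
        (sym (∣Q∣ i)) (Data.Sum.map sparse dense (homogeneous i))
        where
        open ≤-Reasoning
        W : Fin n → Bool
        W = block lab (suc i)
        e c : ℕ
        e = eIn G (cls Q (suc i))
        c = suc w C 2
        2e≡ : 2 * e ≡ E (edge (adj G)) W W
        2e≡ = trans (2eIn≡E G (cls Q (suc i))) (E-congˢ (edge (adj G)) (lookup-cls Q (suc i)) (lookup-cls Q (suc i)))
        swap : ∀ s e → 2 * (s * e) ≡ s * (2 * e)
        swap = solve-∀
        sparse : s * E (edge (adj G)) W W < suc w * w → ℕ→ℚ e ℚ.< ε ℚ.* ℕ→ℚ c
        sparse h = ℚₚ.<-≤-trans (<inv* 0<s {e} {c} (*-cancelˡ-< 2 _ _ (begin-strict
          2 * (s * e)                     ≡⟨ swap s e ⟩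
          s * (2 * e)                     ≡⟨ cong (s *_) 2e≡ ⟩
          s * E (edge (adj G)) W W        <⟨ h ⟩
          suc w * w                       ≡⟨ sym (2*C2 w) ⟩
          2 * c                           ∎))) (mono-ε c)
        -- Edges and non-edges exhaust the pairs, so few complementary edges mean a density above 1
        -- - 1 / s.
        total : 2 * c ≡ 2 * e + E (edge (compl G)) W W
        total = +-cancelʳ-≡ (suc w) _ _ (begin-equality
          2 * c + suc w                   ≡⟨ cong (_+ suc w) (2*C2 w) ⟩
          suc w * w + suc w               ≡⟨ lem w ⟩
          suc w * suc w                   ≡⟨ cong₂ _*_ (sym (size i)) (sym (size i)) ⟩
          countF W * countF W             ≡⟨ sym (E+E-compl G W) ⟩
          E (edge (adj G)) W W + E (edge (compl G)) W W + countF W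
            ≡⟨ cong₂ (λ x y → x + E (edge (compl G)) W W + y) (sym 2e≡) (size i) ⟩
          2 * e + E (edge (compl G)) W W + suc w ∎)
          where
          lem : ∀ w → suc w * w + suc w ≡ suc w * suc w
          lem = solve-∀
        dense : s * E (edge (compl G)) W W < suc w * w → (1ℚ ℚ.- ε) ℚ.* ℕ→ℚ c ℚ.< ℕ→ℚ e
        dense h = [1-ε]*< 0<s {ε} {e} {c} s≤ε (*-cancelˡ-< 2 _ _ (begin-strict
          2 * (s * c)                               ≡⟨ swap s c ⟩
          s * (2 * c)                               ≡⟨ cong (s *_) total ⟩
          s * (2 * e + E (edge (compl G)) W W)      ≡⟨ *-distribˡ-+ s (2 * e) _ ⟩
          s * (2 * e) + s * E (edge (compl G)) W W  <⟨ +-monoʳ-< (s * (2 * e)) h ⟩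
          s * (2 * e) + suc w * w                   ≡⟨ cong₂ _+_ (sym (swap s e)) (sym (2*C2 w)) ⟩
          2 * (s * e) + 2 * c                       ≡⟨ sym (*-distribˡ-+ 2 (s * e) c) ⟩
          2 * (s * e + c)                           ∎))

      conclude : ∀ {k L'} → k ≤ K → L ≤ L' →
        Σ ℕ λ q → Σ (Partition n q) λ Q → k ≤ q × q ≤ L' × UniformPartition G ε Q ×
          ((i : Fin q) → ℕ→ℚ (eIn G (cls Q (suc i))) ℚ.< ε ℚ.* ℕ→ℚ (∣ cls Q (suc i) ∣ C 2)
            ⊎ (1ℚ ℚ.- ε) ℚ.* ℕ→ℚ (∣ cls Q (suc i) ∣ C 2) ℚ.< ℕ→ℚ (eIn G (cls Q (suc i))))
      conclude k≤K L≤L' = q , Q , ≤-trans k≤K K≤q , ≤-trans q≤L L≤L' ,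
        ((subst (_< q) (sym (∣cls∣ Q zero)) rest , λ i j → trans (∣Q∣ i) (sym (∣Q∣ j))) ,
          bad , few-bad-pairs , λ i j _ ok → uniform-pair i j ok) ,
        homogeneous-class

  cut-nonZero : ∀ s r .{{_ : NonZero s}} → NonZero (cut s r)
  cut-nonZero s r = m*n≢0 (scale s) ((2 * (8 * s)) ^ r) {{>-nonZero (≤-trans (s≤s z≤n) (m≤n+m 2 (2 * spread s)))}}
    {{m^n≢0 (2 * (8 * s)) r {{m*n≢0 2 (8 * s) {{_}} {{m*n≢0 8 s}}}}}}

  -- `bad` is meaningful only for i < j, while pieces are compared through ordered pairs of classes.
  -- The diagonal is declared irregular, as uniformity says nothing about two pieces of one class;
  -- this costs `k` pairs.
  symmetrised : ∀ {k} → (Fin k → Fin k → Bool) → Fin k → Fin k → Bool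
  symmetrised bad i j = ((toℕ i <ᵇ toℕ j) ∧ bad i j) ∨ ((toℕ j <ᵇ toℕ i) ∧ bad j i) ∨ ⌊ i ≟ j ⌋

  symmetrised-count : ∀ {k} (bad : Fin k → Fin k → Bool) →
    sumF (λ i → sumF (λ j → ι (symmetrised bad i j))) ≤ 2 * countPairs bad + k
  symmetrised-count {k} bad = begin
    ΣΣ (λ i j → ι (symmetrised bad i j))
      ≤⟨ sum-mono (λ i → sum-mono (λ j → ∨-bound (b i j) (b j i) ⌊ i ≟ j ⌋)) ⟩
    ΣΣ (λ i j → ι (b i j) + (ι (b j i) + ι ⌊ i ≟ j ⌋))
      ≡⟨ ΣΣ-+ (λ i j → ι (b i j)) (λ i j → ι (b j i) + ι ⌊ i ≟ j ⌋) ⟩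
    countPairs bad + ΣΣ (λ i j → ι (b j i) + ι ⌊ i ≟ j ⌋)
      ≡⟨ cong (countPairs bad +_) (ΣΣ-+ (λ i j → ι (b j i)) (λ i j → ι ⌊ i ≟ j ⌋)) ⟩
    countPairs bad + (ΣΣ (λ i j → ι (b j i)) + ΣΣ (λ i j → ι ⌊ i ≟ j ⌋))
      ≡⟨ cong (countPairs bad +_) (cong₂ _+_ (sum-swap (λ i j → ι (b j i))) diagonal) ⟩
    countPairs bad + (countPairs bad + k)
      ≡⟨ lem (countPairs bad) k ⟩
    2 * countPairs bad + k ∎
    where
    open ≤-Reasoning
    ΣΣ : (Fin k → Fin k → ℕ) → ℕ
    ΣΣ f = sumF λ i → sumF (f i)
    b : Fin k → Fin k → Bool
    b i j = (toℕ i <ᵇ toℕ j) ∧ bad i j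
    ΣΣ-+ : ∀ f g → ΣΣ (λ i j → f i j + g i j) ≡ ΣΣ f + ΣΣ g
    ΣΣ-+ f g = trans (sum-cong (λ i → sum-+ (f i) (g i))) (sum-+ (λ i → sumF (f i)) (λ i → sumF (g i)))
    ∨-bound : ∀ x y z → ι (x ∨ y ∨ z) ≤ ι x + (ι y + ι z)
    ∨-bound true  y     z = s≤s z≤n
    ∨-bound false true  z = s≤s z≤n
    ∨-bound false false z = ≤-refl
    diagonal : ΣΣ (λ i j → ι ⌊ i ≟ j ⌋) ≡ k
    diagonal = trans (sum-cong {k} (λ i → trans (sum-cong (λ j → sym (*-identityʳ (ι ⌊ i ≟ j ⌋))))
      (sum-δ i (λ _ → 1)))) (trans (sum-const k 1) (*-identityʳ k))
    lem : ∀ c k → c + (c + k) ≡ 2 * c + k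
    lem = solve-∀

  symmetrised-false : ∀ {k} (bad : Fin k → Fin k → Bool) {i j} → symmetrised bad i j ≡ false →
    (toℕ i < toℕ j × bad i j ≡ false) ⊎ (toℕ j < toℕ i × bad j i ≡ false)
  symmetrised-false bad {i} {j} h with <-cmp (toℕ i) (toℕ j)
  ... | tri< i<j _ _ = inj₁ (i<j , left (toℕ i <ᵇ toℕ j) (<⇒<ᵇ i<j) h)
    where
    left : ∀ x {y z} → Data.Bool.T x → (x ∧ y) ∨ z ≡ false → y ≡ false
    left true {false} _ _ = refl
  ... | tri> _ _ j<i = inj₂ (j<i , middle ((toℕ i <ᵇ toℕ j) ∧ bad i j) (toℕ j <ᵇ toℕ i) (<⇒<ᵇ j<i) h)
    where
    middle : ∀ w x {y z} → Data.Bool.T x → w ∨ (x ∧ y) ∨ z ≡ false → y ≡ false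
    middle false true {false} _ _ = refl
  ... | tri≈ _ i≡j _ = ⊥-elim (right ((toℕ i <ᵇ toℕ j) ∧ bad i j) ((toℕ j <ᵇ toℕ i) ∧ bad j i) ⌊ i ≟ j ⌋
      (≟-complete (toℕ-injective i≡j)) h)
    where
    right : ∀ x y z → z ≡ true → ¬ x ∨ y ∨ z ≡ false
    right true  y     true _ ()
    right false true  true _ ()
    right false false true _ ()

  -- Large k directly, small k by regularity

  module Assemble (s r : ℕ) {{s≢0 : NonZero s}} {n k : ℕ} (G : Graph n) (P : Partition n k) where

    open ≤-Reasoning

    B σ d : ℕ
    B = cut s r
    σ = 7 * s
    d = 4 * s * B

    V : Fin (suc k) → Fin n → Bool
    V = block (part P)

    FewCliques : ℕ → Set
    FewCliques y = ∀ i → y * (cliqueConst s r * T (adj G) r (V (suc i))) ≤ countF (V (suc i)) ^ r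
      ⊎ y * (cliqueConst s r * T (compl G) r (V (suc i))) ≤ countF (V (suc i)) ^ r

    few-cliques-cls : ∀ {x} y → y * (cliqueConst s r * r !) ≤ x → 0 < x → (∀ i →
        ℕ→ℚ (kᵣ G r (cls P (suc i))) ℚ.≤ inv x ℚ.* ℕ→ℚ (∣ cls P (suc i) ∣ ^ r)
        ⊎ ℕ→ℚ (kᵣ̄ G r (cls P (suc i))) ℚ.≤ inv x ℚ.* ℕ→ℚ (∣ cls P (suc i) ∣ ^ r)) → FewCliques y
    few-cliques-cls {x} y y≤x 0<x h i = Data.Sum.map
        (few (adj G) (adj-sym G) (adj-irrefl G)) (few (compl G) (compl-sym G) (compl-irrefl G)) (h i)
      where
      few : ∀ (α : Fin n → Fin n → Bool) → (∀ u v → α u v ≡ α v u) → (∀ u → α u u ≡ false) →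
        ℕ→ℚ (kr α r (cls P (suc i))) ℚ.≤ inv x ℚ.* ℕ→ℚ (∣ cls P (suc i) ∣ ^ r) →
        y * (cliqueConst s r * T α r (V (suc i))) ≤ countF (V (suc i)) ^ r
      few α α-sym α-irr h = begin
        y * (cliqueConst s r * T α r (V (suc i)))
          ≤⟨ *-monoʳ-≤ y (*-monoʳ-≤ (cliqueConst s r) (T-mono α r {V (suc i)} (λ u → trans (lookup-cls P (suc i) u)))) ⟩
        y * (cliqueConst s r * T α r (lookup (cls P (suc i))))
          ≤⟨ few-cliques α α-sym α-irr r (cliqueConst s r) y (cls P (suc i))
               (≤-trans (*-monoˡ-≤ (kr α r (cls P (suc i))) y≤x)
                 (≤inv*⁻¹ 0<x {kr α r (cls P (suc i))} {∣ cls P (suc i) ∣ ^ r} h)) ⟩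
        ∣ cls P (suc i) ∣ ^ r ≡⟨ cong (_^ r) (∣cls∣ P (suc i)) ⟩
        countF (V (suc i)) ^ r ∎

    direct : UniformPartition G (inv (σ * d)) P → 8 * s ≤ k → 0 < k → scale s * k ≤ n → 4 * k * B ≤ n →
      FewCliques 1 → HomogeneousPartition (adj G) (compl G) s k (4 * k * B)
    direct ((v₀<k , sizes) , bad , few-bad , uniform) 8s≤k 0<k zk≤n big few =
      Homogenise.homogenise (adj G) (compl G) (adj-sym G) (adj-irrefl G) (compl-sym G) (compl-irrefl G) s r
        (part P) size (symmetrised bad) few-irr regular
        (λ i → Data.Sum.map (few′ (adj G) i) (few′ (compl G) i) (few i))
        (≤-trans (*-monoʳ-≤ (scale s) (<⇒≤ v₀<k′)) zk≤n) 0<k big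
      where
      instance
        B≢0 : NonZero B
        B≢0 = cut-nonZero s r
        σ≢0 : NonZero σ
        σ≢0 = m*n≢0 7 s
        d≢0 : NonZero d
        d≢0 = m*n≢0 (4 * s) B {{m*n≢0 4 s}}
      i₀ : Fin k
      i₀ = fromℕ< 0<k
      m : ℕ
      m = countF (V (suc i₀))
      size : ∀ i → countF (V (suc i)) ≡ m
      size i = trans (sym (∣cls∣ P (suc i))) (trans (sizes i i₀) (∣cls∣ P (suc i₀)))
      v₀<k′ : countF (V zero) < k
      v₀<k′ = subst (_< k) (∣cls∣ P zero) v₀<k
      few′ : ∀ α i → 1 * (cliqueConst s r * T α r (V (suc i))) ≤ countF (V (suc i)) ^ r →
        cliqueConst s r * T α r (V (suc i)) ≤ m ^ r
      few′ α i = subst₂ _≤_ (*-identityˡ _) (cong (_^ r) (size i))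
      -- If the classes were empty, the graph would have fewer than k vertices.
      0<m : 0 < m
      0<m = n≢0⇒n>0 λ m≡0 → <⇒≱ v₀<k′ (begin
        k                             ≤⟨ m≤n*m k (scale s) {{>-nonZero (≤-trans (s≤s z≤n) (m≤n+m 2 (2 * spread s)))}} ⟩
        scale s * k                   ≤⟨ zk≤n ⟩
        n                             ≡⟨ block-sizes (part P) size ⟩
        countF (V zero) + k * m       ≡⟨ cong (λ z → countF (V zero) + k * z) m≡0 ⟩
        countF (V zero) + k * 0       ≡⟨ trans (cong (countF (V zero) +_) (*-zeroʳ k)) (+-identityʳ _) ⟩
        countF (V zero)               ∎)
      regular : ∀ {i j} → symmetrised bad i j ≡ false → Regular (adj G) σ d (V (suc i)) (V (suc j))
      regular {i} {j} h = Data.Sum.[ (λ (lt , ok) → pair i j lt ok) ,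
          (λ (lt , ok) → Regular-swap (adj G) (adj-sym G) {σ} {d} (pair j i lt ok)) ]′ (symmetrised-false bad h)
        where
        pair : ∀ i j → toℕ i < toℕ j → bad i j ≡ false → Regular (adj G) σ d (V (suc i)) (V (suc j))
        pair i j lt ok = uniform⇒regular G σ d {cls P (suc i)} {cls P (suc j)} (lookup-cls P (suc i)) (lookup-cls P (suc j))
          (subst (0 <_) (sym (size i)) 0<m) (subst (0 <_) (sym (size j)) 0<m) (uniform i j lt ok)
      16s≤ : 16 * s ≤ σ * d
      16s≤ = begin
        16 * s               ≤⟨ *-monoˡ-≤ s (m≤m+n 16 12) ⟩
        28 * s               ≤⟨ m≤m*n (28 * s) (s * B) {{m*n≢0 s B}} ⟩
        28 * s * (s * B)     ≡⟨ lem s B ⟩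
        σ * d                ∎
        where
        lem : ∀ s B → 28 * s * (s * B) ≡ 7 * s * (4 * s * B)
        lem = solve-∀
      -- Doubling the claim separates two budgets of k² each: the uniformity of `P` pays for the bad
      -- pairs, and `8 * s ≤ k` for the diagonal.
      few-irr : 4 * s * sumF (λ i → sumF (λ j → ι (symmetrised bad i j))) ≤ k * k
      few-irr = *-cancelˡ-≤ 2 (begin
        2 * (4 * s * _)                          ≤⟨ *-monoʳ-≤ 2 (*-monoʳ-≤ (4 * s) (symmetrised-count bad)) ⟩
        2 * (4 * s * (2 * countPairs bad + k))   ≡⟨ lem s (countPairs bad) k ⟩
        16 * s * countPairs bad + 8 * s * k      ≤⟨ +-mono-≤
            (≤-trans (*-monoˡ-≤ (countPairs bad) 16s≤)
              (≤inv*⁻¹ (>-nonZero⁻¹ (σ * d) {{m*n≢0 σ d}}) {countPairs bad} {k * k} few-bad)) (*-monoˡ-≤ k 8s≤k) ⟩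
        k * k + k * k                            ≡⟨ cong (k * k +_) (sym (+-identityʳ (k * k))) ⟩
        2 * (k * k)                              ∎)
        where
        lem : ∀ s c k → 2 * (4 * s * (2 * c + k)) ≡ 16 * s * c + 8 * s * k
        lem = solve-∀

    -- A part lies in one class and has at least n / M vertices, while the class has at most n; so
    -- the clique bound survives the passage to the part at the cost of `Y ^ r`.
    via-regularity : ∀ {M Y} (R : RegularPartition (adj G) σ d (4 * s) (scale s) k M (part P)) → M ≤ Y → 0 < k →
      Equitable P → M * k < n → 4 * M * B ≤ n → FewCliques (Y ^ r) →
      HomogeneousPartition (adj G) (compl G) s (RegularPartition.K R) (4 * RegularPartition.K R * B)
    via-regularity {M} {Y} R M≤Y 0<k (v₀<k , sizes) Mk<n big few =
      Homogenise.homogenise (adj G) (compl G) (adj-sym G) (adj-irrefl G) (compl-sym G) (compl-irrefl G) s r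
        lab size irr few-irr regular cliques small (≤-trans 0<k κ₀≤K)
        (≤-trans (*-monoˡ-≤ B (*-monoʳ-≤ 4 K≤M)) big)
      where
      open RegularPartition R
      k<m : k < m
      k<m = *-cancelˡ-< M k m (<-≤-trans Mk<n n≤M*m)
      cliques : ∀ i → cliqueConst s r * T (adj G) r (block lab (suc i)) ≤ m ^ r
        ⊎ cliqueConst s r * T (compl G) r (block lab (suc i)) ≤ m ^ r
      cliques i = inside (part P u₀) refl
        where
        inhabited = count-inhabited {X = block lab (suc i)} (subst (0 <_) (sym (size i)) (≤-trans z<s k<m))
        u₀ : Fin n
        u₀ = proj₁ inhabited
        sub : ∀ {j} → part P u₀ ≡ j → block lab (suc i) ⊑ V j
        sub eq u p = ≟-complete (trans (within (≟-sound p) (≟-sound (proj₂ inhabited))) eq)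
        0<n : 0 < n
        0<n = ≤-trans z<s Mk<n
        0<Y : 0 < Y
        0<Y = ≤-trans (n≢0⇒n>0 λ M≡0 → n≮0 (≤-trans 0<n (subst (λ z → n ≤ z * m) M≡0 n≤M*m))) M≤Y
        transfer : ∀ α j → part P u₀ ≡ suc j → Y ^ r * (cliqueConst s r * T α r (V (suc j))) ≤ countF (V (suc j)) ^ r →
          cliqueConst s r * T α r (block lab (suc i)) ≤ m ^ r
        transfer α j eq h = *-cancelˡ-≤ (Y ^ r) {{m^n≢0 Y r {{>-nonZero 0<Y}}}} (begin
          Y ^ r * (cliqueConst s r * T α r (block lab (suc i)))
            ≤⟨ *-monoʳ-≤ (Y ^ r) (*-monoʳ-≤ (cliqueConst s r) (T-mono α r (sub eq))) ⟩
          Y ^ r * (cliqueConst s r * T α r (V (suc j)))         ≤⟨ h ⟩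
          countF (V (suc j)) ^ r  ≤⟨ ^-monoˡ-≤ r (≤-trans (count≤n (V (suc j))) (≤-trans n≤M*m (*-monoˡ-≤ m M≤Y))) ⟩
          (Y * m) ^ r             ≡⟨ ^-distribʳ-* r Y m ⟩
          Y ^ r * m ^ r           ∎)
        inside : ∀ j → part P u₀ ≡ j → cliqueConst s r * T (adj G) r (block lab (suc i)) ≤ m ^ r
          ⊎ cliqueConst s r * T (compl G) r (block lab (suc i)) ≤ m ^ r
        inside (suc j) eq = Data.Sum.map (transfer (adj G) j eq) (transfer (compl G) j eq) (few j)
        -- The exceptional class is too small to contain a part, because |V₀| < k < m.
        inside zero    eq = ⊥-elim (<⇒≱ k<m (begin
          m                          ≡⟨ sym (size i) ⟩
          countF (block lab (suc i)) ≤⟨ count-mono (sub eq) ⟩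
          countF (V zero)            ≡⟨ sym (∣cls∣ P zero) ⟩
          ∣ cls P zero ∣             ≤⟨ <⇒≤ v₀<k ⟩
          k                          ∎))

  module Parameters (s r : ℕ) where

    -- There are `suc k` classes to refine because V₀ is treated as one of them; the argument `k`
    -- before it requests at least k parts.
    regularity-M : ℕ → ℕ
    regularity-M k = regularity-bound (7 * s) (4 * s * cut s r) (4 * s) (scale s) k (suc k)

    -- The regularity lemma is only invoked for k < 8 s.
    maxM : ℕ
    maxM = suc (sumF {8 * s} (λ i → regularity-M (toℕ i)))

    regularity-M≤maxM : ∀ {k} → k < 8 * s → regularity-M k ≤ maxM
    regularity-M≤maxM {k} k<8s = m≤n⇒m≤1+n (subst (λ j → regularity-M j ≤ sumF {8 * s} (λ i → regularity-M (toℕ i)))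
      (toℕ-fromℕ< k<8s) (term≤sum (λ i → regularity-M (toℕ i)) (fromℕ< k<8s)))

    -- The reciprocals of δ and ξ. In `cliqueBound`, `r !` turns cliques into ordered ones,
    -- `maxM ^ r` pays for the passage to parts of a regular partition, and the successor makes it
    -- positive.
    uniformity cliqueBound : ℕ
    uniformity  = 7 * s * (4 * s * cut s r)
    cliqueBound = suc (maxM ^ r * (cliqueConst s r * r !))

    -- `k + regularity-M k` bounds the number of classes to be cut in either case. The summands of
    -- `order` are the lower bounds on n that the two cases demand; the successor supplies the
    -- strict one.
    parts order : ℕ → ℕ
    parts k = 4 * (k + regularity-M k) * cut s r
    order k = suc (parts k + scale s * k + regularity-M k * k + regularity-M k)

  module Main {ε : ℚ} (s r : ℕ) {{s≢0 : NonZero s}} (s≤ε : inv s ℚ.≤ ε) where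

    open Parameters s r

    0<s : 0 < s
    0<s = >-nonZero⁻¹ s

    module _ (k : ℕ) (2≤k : 2 ≤ k) {n : ℕ} (order≤n : order k ≤ n) (G : Graph n) (P : Partition n k)
             (uniform : UniformPartition G (inv uniformity) P)
             (cliques : (i : Fin k) →
               ℕ→ℚ (kᵣ G r (cls P (suc i))) ℚ.≤ inv cliqueBound ℚ.* ℕ→ℚ (∣ cls P (suc i) ∣ ^ r)
               ⊎ ℕ→ℚ (kᵣ̄ G r (cls P (suc i))) ℚ.≤ inv cliqueBound ℚ.* ℕ→ℚ (∣ cls P (suc i) ∣ ^ r)) where

      open Assemble s r G P using (direct; via-regularity; few-cliques-cls)
      open Conclude G {ε} {s} 0<s s≤ε using (conclude)

      M : ℕ
      M = regularity-M k

      0<k : 0 < k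
      0<k = ≤-trans (s≤s z≤n) 2≤k

      sum<n : parts k + scale s * k + M * k + M < n
      sum<n = order≤n

      parts≤n : parts k ≤ n
      parts≤n = ≤-trans (m≤m+n (parts k) _) (≤-trans (m≤m+n _ (M * k)) (≤-trans (m≤m+n _ M) (<⇒≤ sum<n)))

      scale≤n : scale s * k ≤ n
      scale≤n = ≤-trans (m≤n+m (scale s * k) (parts k)) (≤-trans (m≤m+n _ (M * k)) (≤-trans (m≤m+n _ M) (<⇒≤ sum<n)))

      Mk<n : M * k < n
      Mk<n = ≤-<-trans (≤-trans (m≤n+m (M * k) _) (m≤m+n _ M)) sum<n

      M≤n : M ≤ n
      M≤n = ≤-trans (m≤n+m M _) (<⇒≤ sum<n)

      parts-≥ : ∀ {j} → j ≤ k + M → 4 * j * cut s r ≤ parts k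
      parts-≥ h = *-monoˡ-≤ (cut s r) (*-monoʳ-≤ 4 h)

      homogeneous-partition : Σ ℕ λ q → Σ (Partition n q) λ Q → k ≤ q × q ≤ parts k × UniformPartition G ε Q ×
        ((i : Fin q) → ℕ→ℚ (eIn G (cls Q (suc i))) ℚ.< ε ℚ.* ℕ→ℚ (∣ cls Q (suc i) ∣ C 2)
          ⊎ (1ℚ ℚ.- ε) ℚ.* ℕ→ℚ (∣ cls Q (suc i) ∣ C 2) ℚ.< ℕ→ℚ (eIn G (cls Q (suc i))))
      homogeneous-partition = decide (8 * s ≤? k)
        where
        decide : Dec (8 * s ≤ k) → _
        decide (yes 8s≤k) = conclude (direct uniform 8s≤k 0<k scale≤n (≤-trans (parts-≥ (m≤m+n k M)) parts≤n)
            -- The same ξ serves both cases; as `maxM` is a successor, `maxM ^ r` is at least 1.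
            (few-cliques-cls 1 (≤-trans (*-monoˡ-≤ (cliqueConst s r * r !) (m^n>0 maxM r)) (n≤1+n _)) z<s cliques))
          ≤-refl (parts-≥ (m≤m+n k M))
        decide (no 8s≰k) = conclude (via-regularity R (regularity-M≤maxM (≰⇒> 8s≰k)) 0<k (proj₁ uniform)
            Mk<n (≤-trans (parts-≥ (m≤n+m M k)) parts≤n) (few-cliques-cls (maxM ^ r) (n≤1+n _) z<s cliques))
          (RegularPartition.κ₀≤K R) (parts-≥ (≤-trans (RegularPartition.K≤M R) (m≤n+m M k)))
          where
          R : RegularPartition (adj G) (7 * s) (4 * s * cut s r) (4 * s) (scale s) k M (part P)
          R = regularity-lemma (7 * s) (4 * s * cut s r) (4 * s) (scale s) k (adj G) (part P) M≤n

    0<uniformity : 0 < uniformity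
    0<uniformity = >-nonZero⁻¹ uniformity {{m*n≢0 (7 * s) (4 * s * cut s r) {{m*n≢0 7 s}}
      {{m*n≢0 (4 * s) (cut s r) {{m*n≢0 4 s}} {{cut-nonZero s r}}}}}}


open import Defs
open import Data.Nat using (ℕ; _≤_; _^_)
open import Data.Nat.Combinatorics using (_C_)
open import Data.Fin using (Fin; suc)
open import Data.Fin.Subset using (∣_∣)
open import Data.Rational using (ℚ; 0ℚ; 1ℚ; _<_; _*_; _-_) renaming (_≤_ to _≤ℚ_)
open import Data.Product using (Σ; _×_)
open import Data.Sum using (_⊎_)
open import Data.Nat using (NonZero; >-nonZero; z<s)
open import Data.Product using (_,_; proj₁; proj₂)

theorem6 : (ε : ℚ) → 0ℚ < ε → (r : ℕ) → 2 ≤ r →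
    Σ ℚ λ δ → Σ ℚ λ ξ → 0ℚ < δ × 0ℚ < ξ ×
    ((k : ℕ) → 2 ≤ k →
    Σ ℕ λ L → Σ ℕ λ n₀ →
    (n : ℕ) → n₀ ≤ n → (G : Graph n) → (P : Partition n k) →
    UniformPartition G δ P →
    ((i : Fin k) →
    ℕ→ℚ (kᵣ G r (cls P (suc i))) ≤ℚ ξ * ℕ→ℚ (∣ cls P (suc i) ∣ ^ r)
    ⊎ ℕ→ℚ (kᵣ̄ G r (cls P (suc i))) ≤ℚ ξ * ℕ→ℚ (∣ cls P (suc i) ∣ ^ r)) →
    Σ ℕ λ q → Σ (Partition n q) λ Q →
    k ≤ q × q ≤ L × UniformPartition G ε Q ×
    ((i : Fin q) →
    ℕ→ℚ (eIn G (cls Q (suc i))) < ε * ℕ→ℚ (∣ cls Q (suc i) ∣ C 2)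
    ⊎ (1ℚ - ε) * ℕ→ℚ (∣ cls Q (suc i) ∣ C 2) < ℕ→ℚ (eIn G (cls Q (suc i)))))
theorem6 ε 0<ε r _ =
  Core.inv uniformity , Core.inv cliqueBound , Core.0<inv 0<uniformity ,
  Core.0<inv {cliqueBound} z<s ,
  λ k 2≤k → parts k , order k , λ n order≤n G P uniform cliques →
    homogeneous-partition k 2≤k order≤n G P uniform cliques
  where
  below = Core.inv-below ε 0<ε
  s : ℕ
  s = proj₁ below
  s≢0 : NonZero s
  s≢0 = >-nonZero (proj₁ (proj₂ below))
  open Core.Parameters s r
  open Core.Main {ε} s r {{s≢0}} (proj₂ (proj₂ below))
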